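{- Let $G$ be a finite simple undirected bipartite graph and let $m$ be a nonnegative integer. Then $G$ does not contain more than $m$ pairwise vertex-disjoint $4k$-cycles if and only if, for every even $i\in\{0,2,4,\dots\}$ and every induced subgraph $G_i$ of $G$ on $i$ vertices, \[ \operatorname{per}(G_i)=(-1)^{i/2}\sum_{z=0}^{m}\frac{4^z}{z!}\sum_{T_z}\det(G_i\setminus T_z), \] where, for each $z$, the inner sum runs over all ordered tuples $T_z=(R_1,\dots,R_z)$ of $z$ mutually vertex-disjoint $4k$-cycles of $G_i$.
   Context: For a graph $H$ with vertex set $\{v_1,\dots,v_n\}$, the adjacency matrix $A(H)=(a_{ij})$ is the $n\times n$ matrix with $a_{ij}=1$ if $v_i$ and $v_j$ are adjacent and $0$ otherwise; $\det(H)$ and $\operatorname{per}(H)$ denote the determinant and the permanent $\operatorname{per}(M)=\sum_{\sigma\in S_n}\prod_i a_{i,\sigma(i)}$ of $A(H)$ (for the empty graph both equal $1$). A cycle of length $l$ is a sequence of distinct vertices $u_1,\dots,u_l$ with $u_j\sim u_{j+1}$ for $j<l$ and $u_l\sim u_1$ (considered as a subgraph); a $4k$-cycle is a cycle whose length is a positive multiple of $4$. For a tuple $T_z$ of vertex-disjoint cycles in $H$, $\det(H\setminus T_z)$ is the determinant of the principal submatrix of $A(H)$ obtained by deleting the rows and columns of all vertices lying on the cycles of $T_z$ (empty determinant $=1$). For $z=0$ the only tuple is the empty tuple, so the $z=0$ term is $\det(H)$. -}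

module Defs where

open import Data.Bool.Base using (Bool; if_then_else_)
import Data.Bool.Properties as Bool
open import Data.Fin.Base as Fin using (Fin; zero; suc)
import Data.Fin.Properties as Fin
open import Data.Fin.Permutation using (Permutation′; _⟨$⟩ʳ_; insert) renaming (id to idₚ)
open import Data.Fin.Subset using (Subset; inside; outside; ∣_∣; _∩_; ⋃; ∁; ⁅_⁆; Empty)
open import Data.Fin.Subset.Properties using (nonempty?)
open import Data.Integer.Base as ℤ using (ℤ; 0ℤ; 1ℤ; -1ℤ)
import Data.Integer.Properties as ℤ
open import Data.List.Base
  using (List; []; _∷_; _∷ʳ_; [_]; length; map; foldr; filter; concatMap; zip; upTo; allFin
        ; cartesianProduct; cartesianProductWith; deduplicate)
import Data.List.Membership.DecPropositional as DecMembership
open import Data.List.Relation.Unary.All as All using (All)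
open import Data.List.Relation.Unary.Unique.Propositional using (Unique)
import Data.List.Relation.Unary.Unique.DecPropositional as DecUnique
open import Data.Nat.Base using (ℕ; zero; suc; _<_; _^_; _!)
import Data.Nat.Properties as ℕ
open import Data.Nat.Divisibility using (_∣_; _∣?_)
open import Data.Product.Base using (Σ; ∃-syntax; _×_; _,_; uncurry)
open import Data.Product.Properties using (≡-dec)
open import Data.Rational.Base as ℚ using (ℚ; 0ℚ)
open import Data.Vec.Base as Vec using (Vec; []; _∷_; tabulate; toList)
import Data.Vec.Properties as Vec
import Data.Vec.Relation.Unary.All as VecAll
open import Data.Vec.Relation.Unary.AllPairs as AllPairs using (AllPairs)
open import Level using (0ℓ)
open import Relation.Binary.Core using (Rel)
open import Relation.Binary.Definitions using (Decidable; DecidableEquality; Symmetric; Irreflexive)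
open import Relation.Binary.PropositionalEquality using (_≡_; _≢_; refl; cong)
open import Relation.Nullary.Decidable as Dec using (Dec; does; ¬?; _×-dec_; _⊎-dec_)

open import Algebra.Properties.CommutativeMonoid.Sum ℤ.*-1-commutativeMonoid
  using () renaming (sum to ∏)

private
  variable
    n : ℕ

sumℤ : List ℤ → ℤ
sumℤ = foldr ℤ._+_ 0ℤ

sumℚ : List ℚ → ℚ
sumℚ = foldr ℚ._+_ 0ℚ

------------------------------------------------------------------------
-- Matrices, determinant and permanent

Matrix : ℕ → Set
Matrix n = Fin n → Fin n → ℤ

-- Every permutation occurs exactly once up to extensional equality: one is
-- determined by the image j of zero and a bijection between the other points.
permutations : ∀ n → List (Permutation′ n)
permutations zero    = [ idₚ ]
permutations (suc n) =
  cartesianProductWith (insert zero) (allFin (suc n)) (permutations n)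

inversions : Permutation′ n → List (Fin n × Fin n)
inversions {n} σ =
  filter (λ (i , j) → (i Fin.<? j) ×-dec ((σ ⟨$⟩ʳ j) Fin.<? (σ ⟨$⟩ʳ i)))
         (cartesianProduct (allFin n) (allFin n))

sign : Permutation′ n → ℤ
sign σ = -1ℤ ℤ.^ length (inversions σ)

permanent : Matrix n → ℤ
permanent {n} M = sumℤ (map (λ σ → ∏ (λ i → M i (σ ⟨$⟩ʳ i))) (permutations n))

determinant : Matrix n → ℤ
determinant {n} M =
  sumℤ (map (λ σ → sign σ ℤ.* ∏ (λ i → M i (σ ⟨$⟩ʳ i))) (permutations n))

-- The increasing enumeration of the elements of a subset.
element : (S : Subset n) → Fin ∣ S ∣ → Fin n
element (inside  ∷ S) zero    = zero
element (inside  ∷ S) (suc i) = suc (element S i)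
element (outside ∷ S) i       = suc (element S i)

principal : Matrix n → (S : Subset n) → Matrix ∣ S ∣
principal M S i j = M (element S i) (element S j)

------------------------------------------------------------------------
-- Graphs

record Graph (n : ℕ) : Set₁ where
  infix 4 _∼_ _∼?_
  field
    _∼_    : Rel (Fin n) 0ℓ
    _∼?_   : Decidable _∼_
    symm   : Symmetric _∼_
    irrefl : Irreflexive _≡_ _∼_

Bipartite : Graph n → Set
Bipartite {n} G =
  Σ (Fin n → Bool) λ colour → ∀ u v → u ∼ v → colour u ≢ colour v
  where open Graph G

infix 8 _[_]

_[_] : Graph n → (S : Subset n) → Graph ∣ S ∣
G [ S ] = record
  { _∼_    = λ i j → element S i ∼ element S j
  ; _∼?_   = λ i j → element S i ∼? element S j
  ; symm   = symm
  ; irrefl = λ i≡j → irrefl (cong (element S) i≡j)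
  }
  where open Graph G

adjacency : Graph n → Matrix n
adjacency G u v = if does (u ∼? v) then 1ℤ else 0ℤ
  where open Graph G

per : Graph n → ℤ
per G = permanent (adjacency G)

------------------------------------------------------------------------
-- 4k-cycles

-- u₁, …, uₗ ↦ (u₁, u₂), …, (uₗ₋₁, uₗ), (uₗ, u₁)
cyclicSteps : ∀ {A : Set} → List A → List (A × A)
cyclicSteps []       = []
cyclicSteps (u ∷ us) = zip (u ∷ us) (us ∷ʳ u)

Is4kCycleSequence : Graph n → List (Fin n) → Set
Is4kCycleSequence G us =
  Unique us × All (uncurry _∼_) (cyclicSteps us) × 0 < length us × 4 ∣ length us
  where open Graph G

is4kCycleSequence? : (G : Graph n) (us : List (Fin n)) → Dec (Is4kCycleSequence G us)
is4kCycleSequence? G us =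
  DecUnique.unique? Fin._≟_ us
    ×-dec All.all? (λ (u , v) → u ∼? v) (cyclicSteps us)
    ×-dec (0 ℕ.<? length us)
    ×-dec (4 ∣? length us)
  where open Graph G

-- A vertex set together with the Boolean matrix of an edge relation, so that
-- equality of subgraphs is propositional equality.
record Subgraph (n : ℕ) : Set where
  constructor subgraph
  field
    vertices : Subset n
    edges    : Vec (Subset n) n

open Subgraph public

_≟ˢ_ : DecidableEquality (Subgraph n)
subgraph V E ≟ˢ subgraph V′ E′ =
  Dec.map′ (λ { (refl , refl) → refl }) (λ { refl → refl , refl })
    (Vec.≡-dec Bool._≟_ V V′ ×-dec Vec.≡-dec (Vec.≡-dec Bool._≟_) E E′)

-- The subgraph traced by a cyclic sequence; it forgets starting point and
-- direction.
trace : List (Fin n) → Subgraph n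
trace us = subgraph
  (⋃ (map ⁅_⁆ us))
  (tabulate λ u → tabulate λ v →
    does (((u , v) ∈? cyclicSteps us) ⊎-dec ((v , u) ∈? cyclicSteps us)))
  where open DecMembership (≡-dec Fin._≟_ Fin._≟_) using (_∈?_)

Is4kCycle : Graph n → Subgraph n → Set
Is4kCycle G C = ∃[ us ] (Is4kCycleSequence G us × trace us ≡ C)

VertexDisjoint : Rel (Subgraph n) 0ℓ
VertexDisjoint C D = Empty (vertices C ∩ vertices D)

vertexDisjoint? : Decidable (VertexDisjoint {n})
vertexDisjoint? C D = ¬? (nonempty? (vertices C ∩ vertices D))

Disjoint4kCycles : ∀ {z} → Graph n → Vec (Subgraph n) z → Set
Disjoint4kCycles G T = VecAll.All (Is4kCycle G) T × AllPairs VertexDisjoint T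

HasMoreThan_Disjoint4kCycles : ℕ → Graph n → Set
HasMoreThan_Disjoint4kCycles {n} m G =
  ∃[ z ] (m < z × Σ (Vec (Subgraph n) z) (Disjoint4kCycles G))

------------------------------------------------------------------------
-- Enumeration of the tuples of disjoint 4k-cycles

vecs : ∀ {A : Set} → List A → ∀ k → List (Vec A k)
vecs xs zero    = [ [] ]
vecs xs (suc k) = cartesianProductWith _∷_ xs (vecs xs k)

-- Length at most n suffices for sequences of distinct vertices.
sequences : ∀ n → List (List (Fin n))
sequences n = concatMap (λ l → map toList (vecs (allFin n) l)) (upTo (suc n))

fourKCycles : Graph n → List (Subgraph n)
fourKCycles {n} G =
  deduplicate _≟ˢ_ (map trace (filter (is4kCycleSequence? G) (sequences n)))

disjointTuples : Graph n → ∀ z → List (Vec (Subgraph n) z)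
disjointTuples G z = filter (AllPairs.allPairs? vertexDisjoint?) (vecs (fourKCycles G) z)

------------------------------------------------------------------------
-- The expansion

-- det (G ∖ T)
detDelete : ∀ {z} → Graph n → Vec (Subgraph n) z → ℤ
detDelete G T =
  determinant (principal (adjacency G) (∁ (⋃ (toList (Vec.map vertices T)))))

fromℤ : ℤ → ℚ
fromℤ i = i ℚ./ 1

coefficient : ℕ → ℚ
coefficient z = ℤ.+ (4 ^ z) ℚ./ (z !)
  where instance _ = ℕ._!≢0 z

detExpansion : ℕ → Graph n → ℚ
detExpansion m G =
  sumℚ (map (λ z → coefficient z ℚ.* fromℤ (sumℤ (map (detDelete G) (disjointTuples G z))))
            (upTo (suc m)))

{-# OPTIONS --safe #-}
-- Expand det and per along the cycle through the first vertex v: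
--
--   det H = ∑ (-1) ^ (l - 1) det (H ∖ C),   per H = ∑ per (H ∖ C),
--
-- over the closed sequences C of distinct vertices starting at v, l = |C|.
-- Apply this to the determinants in F(H) = ∑ 4ᶻ/z! ∑ det (H ∖ T) whose tuple T
-- avoids v; in the others one of the z cycles of T passes through v, and every
-- 4k-cycle through v is traced by exactly two sequences starting at v. Hence
--
--   F(H) = ∑ ((-1) ^ (l - 1) + 2 [4 ∣ l]) F(H ∖ C) = ∑ (-1) ^ (l / 2) F(H ∖ C),
--
-- all l being even, so (-1) ^ (|H| / 2) F(H) satisfies the recursion of per H.
-- If H has at most m disjoint 4k-cycles, the terms with z > m vanish.
-- Conversely, in a smallest induced subgraph with more than m disjoint
-- 4k-cycles every tuple of m + 1 of them is spanning, so the term z = m + 1 is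
-- 4ᵐ⁺¹/(m+1)! times the number of such tuples, and it is the only one missing.
module Submission where

open import Defs
open import Algebra.Structures using (IsCommutativeRing)
open import Data.Bool.Base using (Bool; true; false; if_then_else_)
open import Data.Fin.Base as Fin using (Fin; zero; suc; punchIn; toℕ)
open import Data.Fin.Permutation using (Permutation′; _⟨$⟩ʳ_; insert)
import Data.Fin.Properties as Fin
open import Data.Fin.Subset as Subset
  using (Subset; inside; outside; ⁅_⁆; _∪_; ⊥; ∁; _∩_; ⊤; ⋃; Empty; ∣_∣; _∈_; _∉_; Nonempty; _-_)
import Data.Fin.Subset.Properties as Subset
open import Data.Integer.Base as ℤ using (ℤ; 0ℤ; 1ℤ; -1ℤ)
import Data.Integer.Properties as ℤ
open import Data.Integer.Tactic.RingSolver using (solve-∀)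
open import Data.List.Base as List
  using (List; []; _∷_; map; filter; _++_; concatMap; cartesianProductWith; allFin; length; _∷ʳ_
        ; cartesianProduct; upTo; head; zip; reverse)
import Data.List.Membership.DecPropositional as DecMembership
import Data.List.Membership.Propositional as List
import Data.List.Membership.Propositional.Properties as List
import Data.List.Properties as List
import Data.List.Relation.Binary.Disjoint.Propositional as ListDisjoint
open import Data.List.Relation.Binary.Permutation.Propositional
  using (_↭_; ↭⇒↭ₛ; ↭-refl; ↭-sym; ↭-trans; ↭-reflexive; prep)
open import Data.List.Relation.Binary.Permutation.Propositional.Properties
  using (∈-resp-↭; All-resp-↭; ↭-length; ↭-reverse; ++-comm)
open import Data.List.Relation.Binary.Permutation.Setoid.Properties using (Unique-resp-↭)
open import Data.List.Relation.Unary.All as All using (All; []; _∷_)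
import Data.List.Relation.Unary.All.Properties as All
open import Data.List.Relation.Unary.AllPairs as ListAllPairs using ([]; _∷_)
import Data.List.Relation.Unary.AllPairs.Properties as ListAllPairs
open import Data.List.Relation.Unary.Any as Any using (here; there)
import Data.List.Relation.Unary.Any.Properties as Any
import Data.List.Relation.Unary.Unique.DecPropositional as DecUnique
open import Data.List.Relation.Unary.Unique.DecPropositional.Properties using (deduplicate-!)
open import Data.List.Relation.Unary.Unique.Propositional using (Unique)
open import Data.List.Relation.Unary.Unique.Propositional.Properties as Unique
  using (allFin⁺; upTo⁺)
open import Data.Maybe.Base using (just)
import Data.Maybe.Properties as Maybe
open import Data.Nat.Base as ℕ using (ℕ; _<_; _≤_; s≤s; pred; z≤n; _∸_; _!)
import Data.Nat.DivMod as ℕ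
open import Data.Nat.Divisibility using (_∣_; _∣?_; ∣⇒≤; divides; ∣m+n∣m⇒∣n; ∣m∣n⇒∣m+n; ∣-refl)
import Data.Nat.Properties as ℕ
open import Data.Product.Base as Product using (_×_; _,_; proj₁; proj₂; ∃; uncurry; ∃₂; swap; Σ)
open import Data.Product.Properties using (≡-dec)
open import Data.Rational.Base as ℚ using (ℚ)
import Data.Rational.Properties as ℚ
open import Data.Rational.Unnormalised.Base as ℚᵘ using (ℚᵘ; mkℚᵘ; *≡*)
import Data.Rational.Unnormalised.Properties as ℚᵘ
open import Data.Sum.Base as Sum using (_⊎_; inj₁; inj₂)
open import Data.Vec.Base as Vec using ([]; _∷_; Vec; toList)
import Data.Vec.Properties as Vec
import Data.Vec.Relation.Unary.All as VecAll
open import Data.Vec.Relation.Unary.AllPairs as AllPairs using (AllPairs; []; _∷_)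
open import Function.Base using (_∘_; id)
open import Function.Bundles using (mk⇔; _⇔_)
open import Relation.Binary.PropositionalEquality hiding ([_])
open import Relation.Nullary.Decidable as Dec using (Dec; yes; no; does; _×-dec_; ¬?; _⊎-dec_)
open import Relation.Nullary.Negation using (¬_; contradiction)
open import Relation.Unary using (Pred; Decidable)
open import Algebra.Properties.AbelianGroup ℤ.+-0-abelianGroup
  using () renaming (∙-cancelˡ to +-cancelˡ)
open import Algebra.Properties.CommutativeMonoid.Sum ℤ.*-1-commutativeMonoid
  using () renaming (sum to ∏)
open import Algebra.Properties.CommutativeMonoid.Sum ℤ.+-0-commutativeMonoid using (sum; ∑-permute)
open VecAll using ([]; _∷_)

-- The origin of the 4: the determinant gives each of the two orientations of a 4k-cycle the sign -1
-- where (-1) ^ (l / 2) = 1 is wanted, so each orientation lacks 2 and each cycle 4; `z !` undoes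
-- the ordering of the tuples. Graphs H ∖ X are never formed. Everything takes place on the vertices
-- of H, with the set X of deleted vertices as an argument, and the matrix of H ∖ X is given by the
-- list of the remaining vertices. Disjointness and similar conditions become 0-1 factors, so that
-- sums can be exchanged freely. A sign ε with ε² = 1 treats determinant and permanent together. To
-- stay within the integers, the coefficients are multiplied by M! for some M larger than m and n.
-- Summing up to this M also closes the recursion: the tuples through v shift z by one, and the term
-- left over at the top vanishes because M disjoint cycles do not fit into n vertices. The bound m
-- enters only afterwards, through a comparison of the sums up to m and up to M.

module CycleExpansions where

  open ≡-Reasoning

  private
    variable
      A B C : Set
      n : ℕ
      X Y Z : Subset n

  -- Finite sums and indicators

  -- Integer addition and multiplication unfold too eagerly for Agda to infer
  -- the functions being summed, hence the opaque copies.
  infixl 6 _+_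
  infixl 7 _*_
  infixr 8 _^_

  opaque
    _+_ _*_ : ℤ → ℤ → ℤ
    _+_ = ℤ._+_
    _*_ = ℤ._*_

    isCommutativeRing : IsCommutativeRing _≡_ _+_ _*_ ℤ.-_ 0ℤ 1ℤ
    isCommutativeRing = ℤ.+-*-isCommutativeRing

  open IsCommutativeRing isCommutativeRing public
    using (+-identityˡ; +-identityʳ; +-assoc; *-identityˡ; *-assoc; zeroˡ; zeroʳ; distribˡ)

  _^_ : ℤ → ℕ → ℤ
  i ^ ℕ.zero  = 1ℤ
  i ^ ℕ.suc n = i * i ^ n

  ∑ : List A → (A → ℤ) → ℤ
  ∑ []       f = 0ℤ
  ∑ (x ∷ xs) f = f x + ∑ xs f

  opaque
    unfolding _+_

    ∑-sumℤ : (xs : List A) (f : A → ℤ) → ∑ xs f ≡ sumℤ (map f xs)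
    ∑-sumℤ []       f = refl
    ∑-sumℤ (x ∷ xs) f = cong (ℤ._+_ (f x)) (∑-sumℤ xs f)

  ∑-cong∈ : (xs : List A) {f g : A → ℤ} → (∀ x → x List.∈ xs → f x ≡ g x) → ∑ xs f ≡ ∑ xs g
  ∑-cong∈ []       eq = refl
  ∑-cong∈ (x ∷ xs) eq = cong₂ _+_ (eq x (here refl)) (∑-cong∈ xs λ y y∈ → eq y (there y∈))

  ∑-cong : (xs : List A) {f g : A → ℤ} → (∀ x → f x ≡ g x) → ∑ xs f ≡ ∑ xs g
  ∑-cong xs eq = ∑-cong∈ xs λ x _ → eq x

  ∑-zero : (xs : List A) → ∑ xs (λ _ → 0ℤ) ≡ 0ℤ
  ∑-zero []       = refl
  ∑-zero (x ∷ xs) = trans (+-identityˡ _) (∑-zero xs)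

  ∑-+ : (xs : List A) (f g : A → ℤ) → ∑ xs (λ x → f x + g x) ≡ ∑ xs f + ∑ xs g
  ∑-+ []       f g = sym (+-identityʳ 0ℤ)
  ∑-+ (x ∷ xs) f g = begin
    (f x + g x) + ∑ xs (λ x → f x + g x)  ≡⟨ cong ((f x + g x) +_) (∑-+ xs f g) ⟩
    (f x + g x) + (∑ xs f + ∑ xs g)       ≡⟨ interchange (f x) (g x) _ _ ⟩
    (f x + ∑ xs f) + (g x + ∑ xs g)       ∎
    where
    opaque
      unfolding _+_ _*_
      interchange : ∀ a b c d → (a + b) + (c + d) ≡ (a + c) + (b + d)
      interchange = solve-∀

  ∑-*ˡ : (c : ℤ) (xs : List A) (f : A → ℤ) → ∑ xs (λ x → c * f x) ≡ c * ∑ xs f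
  ∑-*ˡ c []       f = sym (zeroʳ c)
  ∑-*ˡ c (x ∷ xs) f = trans (cong (c * f x +_) (∑-*ˡ c xs f)) (sym (distribˡ c (f x) _))

  ∑-swap : (xs : List A) (ys : List B) (f : A → B → ℤ) →
           ∑ xs (λ x → ∑ ys (f x)) ≡ ∑ ys (λ y → ∑ xs (λ x → f x y))
  ∑-swap []       ys f = sym (∑-zero ys)
  ∑-swap (x ∷ xs) ys f = begin
    ∑ ys (f x) + ∑ xs (λ x → ∑ ys (f x))          ≡⟨ cong (∑ ys (f x) +_) (∑-swap xs ys f) ⟩
    ∑ ys (f x) + ∑ ys (λ y → ∑ xs (λ x → f x y))  ≡⟨ ∑-+ ys (f x) _ ⟨
    ∑ ys (λ y → f x y + ∑ xs (λ x → f x y))       ∎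

  ∑-++ : (xs ys : List A) (f : A → ℤ) → ∑ (xs ++ ys) f ≡ ∑ xs f + ∑ ys f
  ∑-++ []       ys f = sym (+-identityˡ _)
  ∑-++ (x ∷ xs) ys f = trans (cong (f x +_) (∑-++ xs ys f)) (sym (+-assoc (f x) _ _))

  ∑-map : (g : B → A) (xs : List B) (f : A → ℤ) → ∑ (map g xs) f ≡ ∑ xs (f ∘ g)
  ∑-map g []       f = refl
  ∑-map g (x ∷ xs) f = cong (f (g x) +_) (∑-map g xs f)

  ∑-concatMap : (g : B → List A) (xs : List B) (f : A → ℤ) →
                ∑ (concatMap g xs) f ≡ ∑ xs (λ x → ∑ (g x) f)
  ∑-concatMap g []       f = refl
  ∑-concatMap g (x ∷ xs) f =
    trans (∑-++ (g x) (concatMap g xs) f) (cong (∑ (g x) f +_) (∑-concatMap g xs f))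

  ∑-cartesianProductWith : (h : A → B → C) (xs : List A) (ys : List B) (f : C → ℤ) →
    ∑ (cartesianProductWith h xs ys) f ≡ ∑ xs (λ x → ∑ ys (λ y → f (h x y)))
  ∑-cartesianProductWith h []       ys f = refl
  ∑-cartesianProductWith h (x ∷ xs) ys f = begin
    ∑ (map (h x) ys ++ cartesianProductWith h xs ys) f
      ≡⟨ ∑-++ (map (h x) ys) _ f ⟩
    ∑ (map (h x) ys) f + ∑ (cartesianProductWith h xs ys) f
      ≡⟨ cong₂ _+_ (∑-map (h x) ys f) (∑-cartesianProductWith h xs ys f) ⟩
    ∑ ys (λ y → f (h x y)) + ∑ xs (λ x → ∑ ys (λ y → f (h x y))) ∎

  ⟦_⟧ : {P : Set} → Dec P → ℤ
  ⟦ P? ⟧ = if does P? then 1ℤ else 0ℤ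

  ⟦⟧-yes : {P : Set} (P? : Dec P) → P → ⟦ P? ⟧ ≡ 1ℤ
  ⟦⟧-yes (yes _) p = refl
  ⟦⟧-yes (no ¬p) p = contradiction p ¬p

  ⟦⟧-no : {P : Set} (P? : Dec P) → ¬ P → ⟦ P? ⟧ ≡ 0ℤ
  ⟦⟧-no (yes p) ¬p = contradiction p ¬p
  ⟦⟧-no (no _)  ¬p = refl

  ⟦⟧-cong : {P Q : Set} (P? : Dec P) (Q? : Dec Q) → (P → Q) → (Q → P) → ⟦ P? ⟧ ≡ ⟦ Q? ⟧
  ⟦⟧-cong (yes p) Q? f g = sym (⟦⟧-yes Q? (f p))
  ⟦⟧-cong (no ¬p) Q? f g = sym (⟦⟧-no Q? (¬p ∘ g))

  ⟦⟧-× : {P Q : Set} (P? : Dec P) (Q? : Dec Q) → ⟦ P? ×-dec Q? ⟧ ≡ ⟦ P? ⟧ * ⟦ Q? ⟧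
  ⟦⟧-× (yes _) Q?      = sym (*-identityˡ ⟦ Q? ⟧)
  ⟦⟧-× (no _)  Q?      = sym (zeroˡ ⟦ Q? ⟧)

  ⟦⟧-¬ : {P : Set} (P? : Dec P) → ⟦ P? ⟧ + ⟦ ¬? P? ⟧ ≡ 1ℤ
  ⟦⟧-¬ (yes _) = +-identityʳ 1ℤ
  ⟦⟧-¬ (no _)  = +-identityˡ 1ℤ

  ⟦⟧-absorb : {P : Set} (P? : Dec P) {x y : ℤ} → (P → x ≡ y) → ⟦ P? ⟧ * x ≡ ⟦ P? ⟧ * y
  ⟦⟧-absorb (yes p) eq = cong (1ℤ *_) (eq p)
  ⟦⟧-absorb (no ¬p) {x} {y} eq = trans (zeroˡ x) (sym (zeroˡ y))

  ∑-filter : {P : Pred A _} (P? : Decidable P) (xs : List A) (f : A → ℤ) →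
             ∑ (filter P? xs) f ≡ ∑ xs (λ x → ⟦ P? x ⟧ * f x)
  ∑-filter P? []       f = refl
  ∑-filter P? (x ∷ xs) f with P? x
  ... | yes _ = cong₂ _+_ (sym (*-identityˡ (f x))) (∑-filter P? xs f)
  ... | no _  = trans (∑-filter P? xs f) (sym (zero-term (f x) _))
    where
    opaque
      unfolding _+_ _*_
      zero-term : ∀ a b → 0ℤ * a + b ≡ b
      zero-term = solve-∀

  ∑-split : {P : Pred A _} (P? : Decidable P) (xs : List A) (f : A → ℤ) →
            ∑ xs f ≡ ∑ xs (λ x → ⟦ P? x ⟧ * f x) + ∑ xs (λ x → ⟦ ¬? (P? x) ⟧ * f x)
  ∑-split P? xs f = trans (∑-cong xs λ x → eq (P? x) (f x)) (∑-+ xs _ _)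
    where
    opaque
      unfolding _+_ _*_
      distrib : ∀ p q a → p * a + q * a ≡ (p + q) * a
      distrib = solve-∀
    eq : ∀ {P : Set} (P? : Dec P) a → a ≡ ⟦ P? ⟧ * a + ⟦ ¬? P? ⟧ * a
    eq P? a = sym (trans (distrib ⟦ P? ⟧ _ a) (trans (cong (_* a) (⟦⟧-¬ P?)) (*-identityˡ a)))

  ∑-null : (xs : List A) {f : A → ℤ} → (∀ x → x List.∈ xs → f x ≡ 0ℤ) → ∑ xs f ≡ 0ℤ
  ∑-null xs eq = trans (∑-cong∈ xs eq) (∑-zero xs)

  ∑-single : {xs : List A} → Unique xs → {a : A} → a List.∈ xs → {f : A → ℤ} →
             (∀ x → x ≢ a → f x ≡ 0ℤ) → ∑ xs f ≡ f a
  ∑-single (x∉ ∷ u) (here refl) {f} eq =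
    trans (cong (f _ +_) (∑-null _ λ y y∈ → eq y λ { refl → All.lookup x∉ y∈ refl })) (+-identityʳ (f _))
  ∑-single {xs = x ∷ xs} (x∉ ∷ u) (there a∈) {f} eq =
    trans (cong₂ _+_ (eq x λ { refl → All.lookup x∉ a∈ refl }) (∑-single u a∈ eq)) (+-identityˡ (f _))

  -- Expansion along rows

  -- The sum over the ways of removing one entry of a list, the entry at
  -- position p being weighted by ε ^ p.
  pick : ℤ → List A → (A → List A → ℤ) → ℤ
  pick ε []       f = 0ℤ
  pick ε (x ∷ xs) f = f x xs + ε * pick ε xs (λ y ys → f y (x ∷ ys))

  pick-cong : ∀ ε (xs : List A) {f g : A → List A → ℤ} →
              (∀ x ys → f x ys ≡ g x ys) → pick ε xs f ≡ pick ε xs g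
  pick-cong ε []       eq = refl
  pick-cong ε (x ∷ xs) eq =
    cong₂ (λ a b → a + ε * b) (eq x xs) (pick-cong ε xs λ y ys → eq y (x ∷ ys))

  pick-linear : ∀ ε a b (xs : List A) (f g : A → List A → ℤ) →
                pick ε xs (λ x ys → a * f x ys + b * g x ys) ≡ a * pick ε xs f + b * pick ε xs g
  pick-linear ε a b []       f g = zeros a b
    where
    opaque
      unfolding _+_ _*_
      zeros : ∀ a b → 0ℤ ≡ a * 0ℤ + b * 0ℤ
      zeros = solve-∀
  pick-linear ε a b (x ∷ xs) f g =
    trans (cong (λ s → _ + ε * s) (pick-linear ε a b xs _ _)) (rearrange ε a b (f x xs) (g x xs) _ _)
    where
    opaque
      unfolding _+_ _*_
      rearrange : ∀ ε a b x y u v →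
        (a * x + b * y) + ε * (a * u + b * v) ≡ a * (x + ε * u) + b * (y + ε * v)
      rearrange = solve-∀

  pick-*ˡ : ∀ ε c (xs : List A) (f : A → List A → ℤ) →
            pick ε xs (λ x ys → c * f x ys) ≡ c * pick ε xs f
  pick-*ˡ ε c []       f = sym (zeroʳ c)
  pick-*ˡ ε c (x ∷ xs) f = trans (cong (λ s → _ + ε * s) (pick-*ˡ ε c xs _)) (rearrange ε c (f x xs) _)
    where
    opaque
      unfolding _+_ _*_
      rearrange : ∀ ε c x u → c * x + ε * (c * u) ≡ c * (x + ε * u)
      rearrange = solve-∀

  pick-map : ∀ ε (g : B → A) (xs : List B) (f : A → List A → ℤ) →
             pick ε (map g xs) f ≡ pick ε xs (λ x ys → f (g x) (map g ys))
  pick-map ε g []       f = refl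
  pick-map ε g (x ∷ xs) f = cong (λ s → _ + ε * s) (pick-map ε g xs _)

  -- Removing entry `j` from the table of `f` leaves the table of `f ∘ punchIn j`. The same
  -- `punchIn j` occurs in `insert zero j`, so that expansion along a row matches the enumeration in
  -- `permutations`.
  pick-tabulate : ∀ ε (f : Fin (ℕ.suc n) → A) (g : A → List A → ℤ) →
    pick ε (List.tabulate f) g ≡
    ∑ (allFin (ℕ.suc n)) (λ j → ε ^ toℕ j * g (f j) (List.tabulate (f ∘ punchIn j)))
  pick-tabulate {ℕ.zero}  ε f g = single ε (g (f zero) [])
    where
    opaque
      unfolding _+_ _*_
      single : ∀ ε a → a + ε * 0ℤ ≡ 1ℤ * a + 0ℤ
      single = solve-∀
  pick-tabulate {ℕ.suc n} ε f g = cong₂ _+_ (sym (*-identityˡ _)) (begin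
    ε * pick ε (List.tabulate (f ∘ suc)) (λ y ys → g y (f zero ∷ ys))
      ≡⟨ cong (ε *_) (pick-tabulate ε (f ∘ suc) (λ y ys → g y (f zero ∷ ys))) ⟩
    ε * ∑ (allFin (ℕ.suc n)) (λ j → ε ^ toℕ j * g′ j)
      ≡⟨ ∑-*ˡ ε (allFin (ℕ.suc n)) _ ⟨
    ∑ (allFin (ℕ.suc n)) (λ j → ε * (ε ^ toℕ j * g′ j))
      ≡⟨ ∑-cong (allFin (ℕ.suc n)) (λ j → sym (*-assoc ε (ε ^ toℕ j) (g′ j))) ⟩
    ∑ (allFin (ℕ.suc n)) (λ j → ε ^ toℕ (suc j) * g′ j)
      ≡⟨ ∑-map suc (allFin (ℕ.suc n)) (λ j → ε ^ toℕ j * g (f j) (List.tabulate (f ∘ punchIn j))) ⟨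
    ∑ (map suc (allFin (ℕ.suc n))) (λ j → ε ^ toℕ j * g (f j) (List.tabulate (f ∘ punchIn j)))
      ≡⟨ cong (λ js → ∑ js (λ j → ε ^ toℕ j * g (f j) (List.tabulate (f ∘ punchIn j))))
          (List.map-tabulate id suc) ⟩
    ∑ (List.tabulate suc) (λ j → ε ^ toℕ j * g (f j) (List.tabulate (f ∘ punchIn j))) ∎)
    where
    g′ : Fin (ℕ.suc n) → ℤ
    g′ j = g (f (suc j)) (List.tabulate (f ∘ punchIn (suc j)))

  -- Two entries at positions p < q have weight ε ^ p * ε ^ (q - 1) if the left one goes first,
  -- since its removal shifts the other, and ε ^ q * ε ^ p in the opposite order. As ε² = 1, the two
  -- orders differ by ε in both directions.
  pick-swap : ∀ ε → ε * ε ≡ 1ℤ → (xs : List A) (g : A → A → List A → ℤ) →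
              pick ε xs (λ x ys → pick ε ys (g x)) ≡ ε * pick ε xs (λ x ys → pick ε ys (λ y → g y x))
  pick-swap ε ε² []       g = sym (zeroʳ ε)
  pick-swap ε ε² (x ∷ xs) g = begin
    pick ε xs (g x) + ε * pick ε xs (λ y ys → g y x ys + ε * pick ε ys (λ z zs → g y z (x ∷ zs)))
      ≡⟨ cong (λ s → a + ε * s) (split g) ⟩
    a + ε * (b + ε * pick ε xs (λ y ys → pick ε ys (λ z zs → g y z (x ∷ zs))))
      ≡⟨ cong (λ s → a + ε * (b + ε * s)) (pick-swap ε ε² xs (λ y z zs → g y z (x ∷ zs))) ⟩
    a + ε * (b + ε * (ε * c))
      ≡⟨ lhs ε a b c ⟩
    a + ε * b + (ε * ε) * (ε * c)
      ≡⟨ cong (λ s → a + ε * b + s * (ε * c)) ε² ⟩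
    a + ε * b + 1ℤ * (ε * c)
      ≡⟨ one a (ε * b) (ε * c) ⟩
    1ℤ * a + ε * b + 1ℤ * (ε * c)
      ≡⟨ cong (λ s → s * a + ε * b + s * (ε * c)) ε² ⟨
    (ε * ε) * a + ε * b + (ε * ε) * (ε * c)
      ≡⟨ rhs ε a b c ⟩
    ε * (b + ε * (a + ε * c))
      ≡⟨ cong (λ s → ε * (b + ε * s)) (split (λ y z → g z y)) ⟨
    ε * (b + ε * pick ε xs (λ y ys → g x y ys + ε * pick ε ys (λ z zs → g z y (x ∷ zs)))) ∎
    where
    a b c : ℤ
    a = pick ε xs (g x)
    b = pick ε xs (λ y → g y x)
    c = pick ε xs (λ y ys → pick ε ys (λ z zs → g z y (x ∷ zs)))
    opaque
      unfolding _+_ _*_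
      lhs : ∀ ε a b c → a + ε * (b + ε * (ε * c)) ≡ a + ε * b + (ε * ε) * (ε * c)
      lhs = solve-∀
    opaque
      unfolding _+_ _*_
      one : ∀ a b c → a + b + 1ℤ * c ≡ 1ℤ * a + b + 1ℤ * c
      one = solve-∀
    opaque
      unfolding _+_ _*_
      rhs : ∀ ε a b c → (ε * ε) * a + ε * b + (ε * ε) * (ε * c) ≡ ε * (b + ε * (a + ε * c))
      rhs = solve-∀
    opaque
      unfolding _+_ _*_
      unit : ∀ ε u v → u + ε * v ≡ 1ℤ * u + ε * v
      unit = solve-∀
    split : ∀ h → pick ε xs (λ y ys → h y x ys + ε * pick ε ys (λ z zs → h y z (x ∷ zs))) ≡
                  pick ε xs (λ y → h y x) + ε * pick ε xs (λ y ys → pick ε ys (λ z zs → h y z (x ∷ zs)))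
    split h = begin
      pick ε xs (λ y ys → h y x ys + ε * pick ε ys (λ z zs → h y z (x ∷ zs)))
        ≡⟨ pick-cong ε xs (λ y ys → unit ε (h y x ys) _) ⟩
      pick ε xs (λ y ys → 1ℤ * h y x ys + ε * pick ε ys (λ z zs → h y z (x ∷ zs)))
        ≡⟨ pick-linear ε 1ℤ ε xs _ _ ⟩
      1ℤ * pick ε xs (λ y → h y x) + ε * pick ε xs (λ y ys → pick ε ys (λ z zs → h y z (x ∷ zs)))
        ≡⟨ unit ε _ _ ⟨
      pick ε xs (λ y → h y x) + ε * pick ε xs (λ y ys → pick ε ys (λ z zs → h y z (x ∷ zs))) ∎

  -- Expansion along the first row; ε = -1 gives determinants and ε = 1 permanents.
  immanant : ℤ → (A → A → ℤ) → List A → List A → ℤ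
  immanant ε a []       cs = 1ℤ
  immanant ε a (r ∷ rs) cs = pick ε cs (λ c cs′ → a r c * immanant ε a rs cs′)

  module _ (ε : ℤ) (ε² : ε * ε ≡ 1ℤ) (a : A → A → ℤ) where

    -- Transposing two adjacent rows only reverses the order in which their columns are picked.
    immanant-swap : ∀ r s rs cs →
      immanant ε a (r ∷ s ∷ rs) cs ≡ ε * immanant ε a (s ∷ r ∷ rs) cs
    immanant-swap r s rs cs = begin
      pick ε cs (λ c cs′ → a r c * pick ε cs′ (λ d ds → a s d * immanant ε a rs ds))
        ≡⟨ expand r s ⟩
      pick ε cs (λ c cs′ → pick ε cs′ (λ d ds → a r c * (a s d * immanant ε a rs ds)))
        ≡⟨ pick-swap ε ε² cs _ ⟩
      ε * pick ε cs (λ c cs′ → pick ε cs′ (λ d ds → a r d * (a s c * immanant ε a rs ds)))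
        ≡⟨ cong (ε *_) (pick-cong ε cs λ c cs′ → pick-cong ε cs′ λ d ds → commute (a r d) (a s c) _) ⟩
      ε * pick ε cs (λ c cs′ → pick ε cs′ (λ d ds → a s c * (a r d * immanant ε a rs ds)))
        ≡⟨ cong (ε *_) (expand s r) ⟨
      ε * pick ε cs (λ c cs′ → a s c * pick ε cs′ (λ d ds → a r d * immanant ε a rs ds)) ∎
      where
      opaque
        unfolding _+_ _*_
        commute : ∀ x y z → x * (y * z) ≡ y * (x * z)
        commute = solve-∀
      expand : ∀ r s →
        pick ε cs (λ c cs′ → a r c * pick ε cs′ (λ d ds → a s d * immanant ε a rs ds)) ≡
        pick ε cs (λ c cs′ → pick ε cs′ (λ d ds → a r c * (a s d * immanant ε a rs ds)))
      expand r s = pick-cong ε cs λ c cs′ → sym (pick-*ˡ ε (a r c) cs′ _)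

    immanant-move : ∀ rs r rs′ cs →
      immanant ε a (rs ++ r ∷ rs′) cs ≡ ε ^ length rs * immanant ε a (r ∷ rs ++ rs′) cs
    immanant-move []       r rs′ cs = sym (*-identityˡ _)
    immanant-move (s ∷ rs) r rs′ cs = begin
      pick ε cs (λ c cs′ → a s c * immanant ε a (rs ++ r ∷ rs′) cs′)
        ≡⟨ pick-cong ε cs (λ c cs′ → trans (cong (a s c *_) (immanant-move rs r rs′ cs′))
            (commute (a s c) p _)) ⟩
      pick ε cs (λ c cs′ → p * (a s c * immanant ε a (r ∷ rs ++ rs′) cs′))
        ≡⟨ pick-*ˡ ε p cs _ ⟩
      p * immanant ε a (s ∷ r ∷ rs ++ rs′) cs
        ≡⟨ cong (p *_) (immanant-swap s r (rs ++ rs′) cs) ⟩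
      p * (ε * immanant ε a (r ∷ s ∷ rs ++ rs′) cs)
        ≡⟨ assoc p ε _ ⟩
      (ε * p) * immanant ε a (r ∷ s ∷ rs ++ rs′) cs ∎
      where
      p : ℤ
      p = ε ^ length rs
      opaque
        unfolding _+_ _*_
        commute : ∀ x y z → x * (y * z) ≡ y * (x * z)
        commute = solve-∀
      opaque
        unfolding _+_ _*_
        assoc : ∀ x y z → x * (y * z) ≡ (y * x) * z
        assoc = solve-∀

    -- Moving the row of the picked entry to the front compensates the signs.
    pick-immanant : ∀ rs xs (cs : A → List A → List A) (f : A → List A → ℤ) →
      pick ε xs (λ x ys → f x ys * immanant ε a (rs ++ xs) (cs x ys)) ≡
      ε ^ length rs * pick 1ℤ xs (λ x ys → f x ys * immanant ε a (x ∷ rs ++ ys) (cs x ys))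
    pick-immanant rs []       cs f = sym (zeroʳ (ε ^ length rs))
    pick-immanant rs (x ∷ xs) cs f = begin
      f x xs * immanant ε a (rs ++ x ∷ xs) (cs x xs) +
      ε * pick ε xs (λ y ys → f y (x ∷ ys) * immanant ε a (rs ++ x ∷ xs) (cs y (x ∷ ys)))
        ≡⟨ cong₂ (λ s t → f x xs * s + ε * t) (immanant-move rs x xs (cs x xs)) tail ⟩
      f x xs * (p * u) + ε * ((ε * p) * v)
        ≡⟨ arrange ε p (f x xs) u v ⟩
      p * (f x xs * u + (ε * ε) * v)
        ≡⟨ cong (λ s → p * (f x xs * u + s * v)) ε² ⟩
      p * (f x xs * u + 1ℤ * v) ∎
      where
      p u v : ℤ
      p = ε ^ length rs
      u = immanant ε a (x ∷ rs ++ xs) (cs x xs)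
      v = pick 1ℤ xs (λ y ys → f y (x ∷ ys) * immanant ε a (y ∷ rs ++ x ∷ ys) (cs y (x ∷ ys)))
      opaque
        unfolding _+_ _*_
        arrange : ∀ ε p f u v → f * (p * u) + ε * ((ε * p) * v) ≡ p * (f * u + (ε * ε) * v)
        arrange = solve-∀
      snoc : ∀ ys → (rs ∷ʳ x) ++ ys ≡ rs ++ x ∷ ys
      snoc = List.++-assoc rs List.[ x ]
      tail : pick ε xs (λ y ys → f y (x ∷ ys) * immanant ε a (rs ++ x ∷ xs) (cs y (x ∷ ys))) ≡ (ε * p) * v
      tail = begin
        pick ε xs (λ y ys → f y (x ∷ ys) * immanant ε a (rs ++ x ∷ xs) (cs y (x ∷ ys)))
          ≡⟨ cong (λ rows → pick ε xs (λ y ys → f y (x ∷ ys) * immanant ε a rows (cs y (x ∷ ys)))) (snoc xs) ⟨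
        pick ε xs (λ y ys → f y (x ∷ ys) * immanant ε a ((rs ∷ʳ x) ++ xs) (cs y (x ∷ ys)))
          ≡⟨ pick-immanant (rs ∷ʳ x) xs (λ y ys → cs y (x ∷ ys)) (λ y ys → f y (x ∷ ys)) ⟩
        ε ^ length (rs ∷ʳ x) * pick 1ℤ xs
            (λ y ys → f y (x ∷ ys) * immanant ε a (y ∷ (rs ∷ʳ x) ++ ys) (cs y (x ∷ ys)))
          ≡⟨ cong₂ _*_ (cong (ε ^_) (List.length-++-comm rs List.[ x ]))
               (pick-cong 1ℤ xs λ y ys → cong
                   (λ rows → f y (x ∷ ys) * immanant ε a (y ∷ rows) (cs y (x ∷ ys))) (snoc ys)) ⟩
        (ε * p) * v ∎

    -- The principal matrix on `xs` is bordered by a row `u` and a column `v`. Taking column `v`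
    -- leaves the principal matrix. Taking a column `w` leaves row `w` without its own column, and
    -- moving that row to the front gives a bordered matrix again, with `w` in the role of `u`: a
    -- path from `u` to `v` has grown by the step to `w`. The row move compensates the position of
    -- `w` in `xs`, so the only sign left is the `ε` due to the column `v` in front.
    immanant-bordered : ∀ u v xs →
      immanant ε a (u ∷ xs) (v ∷ xs) ≡
      a u v * immanant ε a xs xs + ε * pick 1ℤ xs (λ w ys → a u w * immanant ε a (w ∷ ys) (v ∷ ys))
    immanant-bordered u v xs = cong (λ s → a u v * immanant ε a xs xs + ε * s)
      (trans (pick-immanant [] xs (λ _ ys → v ∷ ys) (λ w _ → a u w)) (*-identityˡ _))

  -- Lists of the vertices outside a deleted set

  free : Subset n → List (Fin n)
  free []            = []
  free (inside  ∷ X) = map suc (free X)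
  free (outside ∷ X) = zero ∷ map suc (free X)

  _∉?_ : (w : Fin n) (X : Subset n) → Dec (¬ (w Subset.∈ X))
  w ∉? X = ¬? (w Subset.∈? X)

  -- With ε = 1 positions carry no weight, so picking from the list becomes a sum over all vertices
  -- with an indicator, and removing `w` from the list amounts to adding `w` to the deleted set.
  pick-free : (X : Subset n) (f : Fin n → List (Fin n) → ℤ) →
              pick 1ℤ (free X) f ≡ ∑ (allFin n) (λ w → ⟦ w ∉? X ⟧ * f w (free (X ∪ ⁅ w ⁆)))
  pick-free []            f = refl
  pick-free {ℕ.suc n} (x ∷ X) f = go x
    where
    step : (x : _) → Fin (ℕ.suc n) → ℤ
    step x w = ⟦ w ∉? (x ∷ X) ⟧ * f w (free ((x ∷ X) ∪ ⁅ w ⁆))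
    shift : ∀ x → ∑ (allFin n) (step x ∘ suc) ≡ ∑ (List.tabulate suc) (step x)
    shift x = trans (sym (∑-map suc (allFin n) (step x)))
        (cong (λ js → ∑ js (step x)) (List.map-tabulate id suc))
    go : ∀ x → pick 1ℤ (free (x ∷ X)) f ≡ step x zero + ∑ (List.tabulate suc) (step x)
    go inside = begin
      pick 1ℤ (map suc (free X)) f
        ≡⟨ pick-map 1ℤ suc (free X) f ⟩
      pick 1ℤ (free X) (λ w ys → f (suc w) (map suc ys))
        ≡⟨ pick-free X _ ⟩
      ∑ (allFin n) (step inside ∘ suc)
        ≡⟨ shift inside ⟩
      ∑ (List.tabulate suc) (step inside)
        ≡⟨ zero-term (f zero _) _ ⟩
      step inside zero + ∑ (List.tabulate suc) (step inside) ∎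
      where
      opaque
        unfolding _+_ _*_
        zero-term : ∀ a b → b ≡ 0ℤ * a + b
        zero-term = solve-∀
    go outside = begin
      f zero (map suc (free X)) + 1ℤ * pick 1ℤ (map suc (free X)) (λ w ys → f w (zero ∷ ys))
        ≡⟨ one _ _ ⟩
      1ℤ * f zero (map suc (free X)) + pick 1ℤ (map suc (free X)) (λ w ys → f w (zero ∷ ys))
        ≡⟨ cong (λ Y → 1ℤ * f zero (map suc (free Y)) + pick 1ℤ (map suc (free X))
            (λ w ys → f w (zero ∷ ys))) (sym (Subset.∪-identityʳ X)) ⟩
      step outside zero + pick 1ℤ (map suc (free X)) (λ w ys → f w (zero ∷ ys))
        ≡⟨ cong (step outside zero +_)
            (trans (pick-map 1ℤ suc (free X) _) (trans (pick-free X _) (shift outside))) ⟩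
      step outside zero + ∑ (List.tabulate suc) (step outside) ∎
      where
      opaque
        unfolding _+_ _*_
        one : ∀ a b → a + 1ℤ * b ≡ 1ℤ * a + b
        one = solve-∀

  -- Leibniz sums

  opaque
    unfolding _+_ _*_

    length-filter : {P : Pred A _} (P? : Decidable P) (xs : List A) →
                    ℤ.+ length (filter P? xs) ≡ ∑ xs (λ x → ⟦ P? x ⟧)
    length-filter P? []       = refl
    length-filter P? (x ∷ xs) with P? x
    ... | yes _ = cong (ℤ._+_ 1ℤ) (length-filter P? xs)
    ... | no _  = trans (length-filter P? xs) (sym (ℤ.+-identityˡ _))

    ∑-tabulate : (g : Fin n → A) (f : A → ℤ) → ∑ (List.tabulate g) f ≡ sum (f ∘ g)
    ∑-tabulate {ℕ.zero}  g f = refl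
    ∑-tabulate {ℕ.suc n} g f = cong (ℤ._+_ (f (g zero))) (∑-tabulate (g ∘ suc) f)

    pos-+ : ∀ a b → ℤ.+ (a ℕ.+ b) ≡ ℤ.+ a + ℤ.+ b
    pos-+ = ℤ.pos-+

    ∏-suc : (f : Fin (ℕ.suc n) → ℤ) → ∏ f ≡ f zero * ∏ (f ∘ suc)
    ∏-suc f = refl

    ^-ℤ : ∀ i k → i ℤ.^ k ≡ i ^ k
    ^-ℤ i ℕ.zero    = refl
    ^-ℤ i (ℕ.suc k) = cong (ℤ._*_ i) (^-ℤ i k)

    *-ℤ : ∀ i j → i ℤ.* j ≡ i * j
    *-ℤ i j = refl

  ^-distribˡ-+-* : ∀ i a b → i ^ (a ℕ.+ b) ≡ i ^ a * i ^ b
  ^-distribˡ-+-* i ℕ.zero    b = sym (*-identityˡ (i ^ b))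
  ^-distribˡ-+-* i (ℕ.suc a) b = trans (cong (i *_) (^-distribˡ-+-* i a b)) (sym (*-assoc i (i ^ a) (i ^ b)))

  1^ : ∀ k → 1ℤ ^ k ≡ 1ℤ
  1^ ℕ.zero    = refl
  1^ (ℕ.suc k) = trans (*-identityˡ (1ℤ ^ k)) (1^ k)

  ∑-tabulate-suc : (f : Fin (ℕ.suc n) → ℤ) → ∑ (List.tabulate suc) f ≡ ∑ (allFin n) (f ∘ suc)
  ∑-tabulate-suc f = trans (∑-tabulate suc f) (sym (∑-tabulate id (f ∘ suc)))

  ∑-allFin-permute : (π : Permutation′ n) (f : Fin n → ℤ) →
                     ∑ (allFin n) (λ i → f (π ⟨$⟩ʳ i)) ≡ ∑ (allFin n) f
  ∑-allFin-permute π f =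
    trans (∑-tabulate id (λ i → f (π ⟨$⟩ʳ i))) (trans (sym (∑-permute f π)) (sym (∑-tabulate id f)))

  punchIn-mono-< : ∀ j {i k : Fin n} → i Fin.< k → punchIn j i Fin.< punchIn j k
  punchIn-mono-< j {i} {k} i<k = ℕ.≰⇒> λ le → ℕ.<⇒≱ i<k (Fin.punchIn-cancel-≤ j k i le)

  punchIn-cancel-< : ∀ j {i k : Fin n} → punchIn j i Fin.< punchIn j k → i Fin.< k
  punchIn-cancel-< j {i} {k} lt = ℕ.≰⇒> λ le → ℕ.<⇒≱ lt (Fin.punchIn-mono-≤ j k i le)

  ∑-punchIn-< : (j : Fin (ℕ.suc n)) → ∑ (allFin n) (λ k → ⟦ punchIn j k Fin.<? j ⟧) ≡ ℤ.+ toℕ j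
  ∑-punchIn-< {n} zero = ∑-null (allFin n) (λ k _ → refl)
  ∑-punchIn-< {ℕ.suc n} (suc j) = trans (cong (1ℤ +_) (begin
    ∑ (List.tabulate suc) (λ k → ⟦ punchIn (suc j) k Fin.<? suc j ⟧)
      ≡⟨ ∑-tabulate-suc (λ k → ⟦ punchIn (suc j) k Fin.<? suc j ⟧) ⟩
    ∑ (allFin n) (λ k → ⟦ suc (punchIn j k) Fin.<? suc j ⟧)
      ≡⟨ ∑-cong (allFin n) (λ k → ⟦⟧-cong (suc (punchIn j k) Fin.<? suc j)
          (punchIn j k Fin.<? j) ℕ.s<s⁻¹ ℕ.s<s) ⟩
    ∑ (allFin n) (λ k → ⟦ punchIn j k Fin.<? j ⟧)
      ≡⟨ ∑-punchIn-< j ⟩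
    ℤ.+ toℕ j ∎)) (sym (pos-+ 1 (toℕ j)))

  inverted? : (σ : Permutation′ n) (i k : Fin n) → Dec (i Fin.< k × (σ ⟨$⟩ʳ k) Fin.< (σ ⟨$⟩ʳ i))
  inverted? σ i k = (i Fin.<? k) ×-dec ((σ ⟨$⟩ʳ k) Fin.<? (σ ⟨$⟩ʳ i))

  length-inversions : (σ : Permutation′ n) →
    ℤ.+ length (inversions σ) ≡ ∑ (allFin n) (λ i → ∑ (allFin n) (λ k → ⟦ inverted? σ i k ⟧))
  length-inversions {n} σ =
    trans (length-filter (λ (i , k) → inverted? σ i k) (cartesianProduct (allFin n) (allFin n)))
          (∑-cartesianProductWith _,_ (allFin n) (allFin n) _)

  -- The inserted point `zero` precedes all others and has image `j`, so it is inverted with exactly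
  -- the `toℕ j` points whose images lie below `j`. Among the other points nothing changes, since
  -- `punchIn j` is monotone.
  length-inversions-insert : (j : Fin (ℕ.suc n)) (σ : Permutation′ n) →
    length (inversions (insert zero j σ)) ≡ toℕ j ℕ.+ length (inversions σ)
  length-inversions-insert {n} j σ = ℤ.+-injective (begin
    ℤ.+ length (inversions τ)
      ≡⟨ length-inversions τ ⟩
    (row zero zero + ∑ (List.tabulate suc) (row zero)) + ∑ (List.tabulate suc)
        (λ i → row i zero + ∑ (List.tabulate suc) (row i))
      ≡⟨ cong₂ _+_ firstRow otherRows ⟩
    ℤ.+ toℕ j + ℤ.+ length (inversions σ)
      ≡⟨ pos-+ (toℕ j) (length (inversions σ)) ⟨
    ℤ.+ (toℕ j ℕ.+ length (inversions σ)) ∎)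
    where
    τ = insert zero j σ
    row : Fin (ℕ.suc n) → Fin (ℕ.suc n) → ℤ
    row i k = ⟦ inverted? τ i k ⟧
    firstRow : row zero zero + ∑ (List.tabulate suc) (row zero) ≡ ℤ.+ toℕ j
    firstRow = begin
      0ℤ + ∑ (List.tabulate suc) (row zero)
        ≡⟨ +-identityˡ _ ⟩
      ∑ (List.tabulate suc) (row zero)
        ≡⟨ ∑-tabulate-suc (row zero) ⟩
      ∑ (allFin n) (λ k → row zero (suc k))
        ≡⟨ ∑-cong (allFin n) (λ k → ⟦⟧-cong (inverted? τ zero (suc k))
            (punchIn j (σ ⟨$⟩ʳ k) Fin.<? j) proj₂ (ℕ.z<s ,_)) ⟩
      ∑ (allFin n) (λ k → ⟦ punchIn j (σ ⟨$⟩ʳ k) Fin.<? j ⟧)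
        ≡⟨ ∑-allFin-permute σ (λ k → ⟦ punchIn j k Fin.<? j ⟧) ⟩
      ∑ (allFin n) (λ k → ⟦ punchIn j k Fin.<? j ⟧)
        ≡⟨ ∑-punchIn-< j ⟩
      ℤ.+ toℕ j ∎
    otherRow : ∀ i → row (suc i) zero + ∑ (List.tabulate suc) (row (suc i)) ≡ ∑ (allFin n)
        (λ k → ⟦ inverted? σ i k ⟧)
    otherRow i = begin
      0ℤ + ∑ (List.tabulate suc) (row (suc i))
        ≡⟨ +-identityˡ _ ⟩
      ∑ (List.tabulate suc) (row (suc i))
        ≡⟨ ∑-tabulate-suc (row (suc i)) ⟩
      ∑ (allFin n) (λ k → row (suc i) (suc k))
        ≡⟨ ∑-cong (allFin n) (λ k → ⟦⟧-cong (inverted? τ (suc i) (suc k)) (inverted? σ i k)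
             (λ (p , q) → ℕ.s<s⁻¹ p , punchIn-cancel-< j q)
             (λ (p , q) → ℕ.s<s p , punchIn-mono-< j q)) ⟩
      ∑ (allFin n) (λ k → ⟦ inverted? σ i k ⟧) ∎
    otherRows : ∑ (List.tabulate suc) (λ i → row i zero + ∑ (List.tabulate suc) (row i)) ≡ ℤ.+ length
        (inversions σ)
    otherRows = begin
      ∑ (List.tabulate suc) (λ i → row i zero + ∑ (List.tabulate suc) (row i))
        ≡⟨ ∑-tabulate-suc (λ i → row i zero + ∑ (List.tabulate suc) (row i)) ⟩
      ∑ (allFin n) (λ i → row (suc i) zero + ∑ (List.tabulate suc) (row (suc i)))
        ≡⟨ ∑-cong (allFin n) otherRow ⟩
      ∑ (allFin n) (λ i → ∑ (allFin n) (λ k → ⟦ inverted? σ i k ⟧))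
        ≡⟨ length-inversions σ ⟨
      ℤ.+ length (inversions σ) ∎

  leibniz : ∀ ε (a : A → B → ℤ) (r : Fin n → A) (c : Fin n → B) → ℤ
  leibniz {n = n} ε a r c =
    ∑ (permutations n) (λ σ → ε ^ length (inversions σ) * ∏ (λ i → a (r i) (c (σ ⟨$⟩ʳ i))))

  -- Grouping the permutations by the image `j` of the first row gives the Laplace expansion: by
  -- `length-inversions-insert`, the inversions involving that row account for the weight ε ^ j of
  -- the picked position.
  leibniz-immanant : ∀ ε (a : A → A → ℤ) (r c : Fin n → A) →
    leibniz ε a r c ≡ immanant ε a (List.tabulate r) (List.tabulate c)
  leibniz-immanant {n = ℕ.zero}  ε a r c = trans (+-identityʳ (1ℤ * 1ℤ)) (*-identityˡ 1ℤ)
  leibniz-immanant {n = ℕ.suc n} ε a r c = begin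
    ∑ (permutations (ℕ.suc n)) term
      ≡⟨ ∑-cartesianProductWith (insert zero) (allFin (ℕ.suc n)) (permutations n) term ⟩
    ∑ (allFin (ℕ.suc n)) (λ j → ∑ (permutations n) (λ σ → term (insert zero j σ)))
      ≡⟨ ∑-cong (allFin (ℕ.suc n)) (λ j → trans (∑-cong (permutations n) (split j))
          (∑-*ˡ (ε ^ toℕ j * a (r zero) (c j)) (permutations n) _)) ⟩
    ∑ (allFin (ℕ.suc n)) (λ j → (ε ^ toℕ j * a (r zero) (c j)) * leibniz ε a (r ∘ suc) (c ∘ punchIn j))
      ≡⟨ ∑-cong (allFin (ℕ.suc n)) (λ j → trans (*-assoc (ε ^ toℕ j) _ _)
          (cong (λ s → ε ^ toℕ j * (a (r zero) (c j) * s)) (leibniz-immanant ε a (r ∘ suc) (c ∘ punchIn j)))) ⟩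
    ∑ (allFin (ℕ.suc n)) (λ j → ε ^ toℕ j *
        (a (r zero) (c j) * immanant ε a (List.tabulate (r ∘ suc)) (List.tabulate (c ∘ punchIn j))))
      ≡⟨ pick-tabulate ε c (λ y ys → a (r zero) y * immanant ε a (List.tabulate (r ∘ suc)) ys) ⟨
    immanant ε a (List.tabulate r) (List.tabulate c) ∎
    where
    term : Permutation′ (ℕ.suc n) → ℤ
    term τ = ε ^ length (inversions τ) * ∏ (λ i → a (r i) (c (τ ⟨$⟩ʳ i)))
    opaque
      unfolding _+_ _*_
      rearrange : ∀ p q x y → (p * q) * (x * y) ≡ (p * x) * (q * y)
      rearrange = solve-∀
    split : ∀ j σ → term (insert zero j σ) ≡
      (ε ^ toℕ j * a (r zero) (c j)) *
          (ε ^ length (inversions σ) * ∏ (λ i → a (r (suc i)) (c (punchIn j (σ ⟨$⟩ʳ i)))))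
    split j σ = trans
      (cong₂ _*_
        (trans (cong (ε ^_) (length-inversions-insert j σ)) (^-distribˡ-+-* ε (toℕ j) (length (inversions σ))))
        (∏-suc (λ i → a (r i) (c (insert zero j σ ⟨$⟩ʳ i)))))
      (rearrange (ε ^ toℕ j) _ _ _)

  determinant-immanant : (a : A → A → ℤ) (r : Fin n → A) →
    determinant (λ i j → a (r i) (r j)) ≡ immanant -1ℤ a (List.tabulate r) (List.tabulate r)
  determinant-immanant {n = n} a r = begin
    determinant (λ i j → a (r i) (r j))
      ≡⟨ ∑-sumℤ (permutations n) _ ⟨
    ∑ (permutations n) (λ σ → sign σ ℤ.* ∏ (λ i → a (r i) (r (σ ⟨$⟩ʳ i))))
      ≡⟨ ∑-cong (permutations n) (λ σ → trans (*-ℤ _ _)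
          (cong (_* ∏ (λ i → a (r i) (r (σ ⟨$⟩ʳ i)))) (^-ℤ -1ℤ (length (inversions σ))))) ⟩
    leibniz -1ℤ a r r
      ≡⟨ leibniz-immanant -1ℤ a r r ⟩
    immanant -1ℤ a (List.tabulate r) (List.tabulate r) ∎

  permanent-immanant : (a : A → A → ℤ) (r : Fin n → A) →
    permanent (λ i j → a (r i) (r j)) ≡ immanant 1ℤ a (List.tabulate r) (List.tabulate r)
  permanent-immanant {n = n} a r = begin
    permanent (λ i j → a (r i) (r j))
      ≡⟨ ∑-sumℤ (permutations n) _ ⟨
    ∑ (permutations n) (λ σ → ∏ (λ i → a (r i) (r (σ ⟨$⟩ʳ i))))
      ≡⟨ ∑-cong (permutations n) (λ σ → sym
          (trans (cong (_* ∏ (λ i → a (r i) (r (σ ⟨$⟩ʳ i)))) (1^ (length (inversions σ)))) (*-identityˡ _))) ⟩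
    leibniz 1ℤ a r r
      ≡⟨ leibniz-immanant 1ℤ a r r ⟩
    immanant 1ℤ a (List.tabulate r) (List.tabulate r) ∎

  -- Turns the indexing of principal submatrices by `element` into lists, the form in which
  -- `immanant` takes its rows and columns.
  tabulate-element : (X : Subset n) → List.tabulate (element (∁ X)) ≡ free X
  tabulate-element []            = refl
  tabulate-element (inside  ∷ X) =
    trans (sym (List.map-tabulate (element (∁ X)) suc)) (cong (map suc) (tabulate-element X))
  tabulate-element (outside ∷ X) =
    cong (zero ∷_) (trans (sym (List.map-tabulate (element (∁ X)) suc)) (cong (map suc) (tabulate-element X)))

  free-⊥ : ∀ n → free (⊥ {n}) ≡ allFin n
  free-⊥ ℕ.zero    = refl
  free-⊥ (ℕ.suc n) = cong (zero ∷_) (trans (cong (map suc) (free-⊥ n)) (List.map-tabulate id suc))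

  -- Expansion along the cycles through a vertex

  Disjoint : Subset n → Subset n → Set
  Disjoint X Y = Empty (X ∩ Y)

  disjoint? : (X Y : Subset n) → Dec (Disjoint X Y)
  disjoint? X Y = ¬? (Subset.nonempty? (X ∩ Y))

  disjoint⁺ : (∀ {x} → x ∈ X → x ∉ Y) → Disjoint X Y
  disjoint⁺ {X = X} {Y} f (x , x∈) =
    let x∈X , x∈Y = Subset.x∈p∩q⁻ X Y x∈ in f x∈X x∈Y

  disjoint⁻ : Disjoint X Y → ∀ {x} → x ∈ X → x ∉ Y
  disjoint⁻ d x∈X x∈Y = d (_ , Subset.x∈p∩q⁺ (x∈X , x∈Y))

  disjoint-sym : Disjoint X Y → Disjoint Y X
  disjoint-sym d = disjoint⁺ λ y∈ x∈ → disjoint⁻ d x∈ y∈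

  disjoint-∪ : Disjoint X Z → Disjoint Y Z → Disjoint (X ∪ Y) Z
  disjoint-∪ {X = X} {Y = Y} d e = disjoint⁺ λ x∈ x∈Z → case (Subset.x∈p∪q⁻ X Y x∈) x∈Z
    where
    case : ∀ {x} → x ∈ X ⊎ x ∈ Y → x ∉ _
    case (inj₁ x∈X) = disjoint⁻ d x∈X
    case (inj₂ x∈Y) = disjoint⁻ e x∈Y

  disjoint-∪ˡ : Disjoint (X ∪ Y) Z → Disjoint X Z
  disjoint-∪ˡ d = disjoint⁺ λ x∈ → disjoint⁻ d (Subset.x∈p∪q⁺ (inj₁ x∈))

  disjoint-∪ʳ : Disjoint (X ∪ Y) Z → Disjoint Y Z
  disjoint-∪ʳ d = disjoint⁺ λ x∈ → disjoint⁻ d (Subset.x∈p∪q⁺ (inj₂ x∈))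

  disjoint-⁅⁆ : ∀ {w} → w ∉ X → Disjoint X ⁅ w ⁆
  disjoint-⁅⁆ {w = w} w∉ = disjoint⁺ λ x∈X x∈w → w∉ (subst (_∈ _) (Subset.x∈⁅y⁆⇒x≡y w x∈w) x∈X)

  -- As a factor, disjointness from a union splits into a product (`δ-∪ˡ`, `δ-∪ʳ`); this is how
  -- deletions are regrouped under the sums below.
  δ : Subset n → Subset n → ℤ
  δ X Y = ⟦ disjoint? X Y ⟧

  δ-sym : (X Y : Subset n) → δ X Y ≡ δ Y X
  δ-sym X Y = ⟦⟧-cong (disjoint? X Y) (disjoint? Y X) disjoint-sym disjoint-sym

  δ-∪ˡ : (X Y Z : Subset n) → δ (X ∪ Y) Z ≡ δ X Z * δ Y Z
  δ-∪ˡ X Y Z = trans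
    (⟦⟧-cong (disjoint? (X ∪ Y) Z) (disjoint? X Z ×-dec disjoint? Y Z)
      (λ d → disjoint-∪ˡ d , disjoint-∪ʳ d) (uncurry disjoint-∪))
    (⟦⟧-× (disjoint? X Z) (disjoint? Y Z))

  δ-∪ʳ : (X Y Z : Subset n) → δ X (Y ∪ Z) ≡ δ X Y * δ X Z
  δ-∪ʳ X Y Z = begin
    δ X (Y ∪ Z)    ≡⟨ δ-sym X (Y ∪ Z) ⟩
    δ (Y ∪ Z) X    ≡⟨ δ-∪ˡ Y Z X ⟩
    δ Y X * δ Z X  ≡⟨ cong₂ _*_ (δ-sym Y X) (δ-sym Z X) ⟩
    δ X Y * δ X Z  ∎

  δ-⊥ : (X : Subset n) → δ X ⊥ ≡ 1ℤ
  δ-⊥ X = ⟦⟧-yes (disjoint? X ⊥) (disjoint⁺ λ _ → Subset.∉⊥)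

  δ-⁅⁆ : (X : Subset n) (w : Fin n) → δ X ⁅ w ⁆ ≡ ⟦ w ∉? X ⟧
  δ-⁅⁆ X w = ⟦⟧-cong (disjoint? X ⁅ w ⁆) (w ∉? X)
    (λ d w∈ → disjoint⁻ d w∈ (Subset.x∈⁅x⁆ w)) disjoint-⁅⁆

  size : Subset n → ℕ
  size X = ∣ ∁ X ∣

  size-⊤ : ∀ n → size (⊤ {n}) ≡ 0
  size-⊤ ℕ.zero    = refl
  size-⊤ (ℕ.suc n) = size-⊤ n

  size-∪⁅⁆ : (X : Subset n) (w : Fin n) → w ∉ X → size X ≡ ℕ.suc (size (X ∪ ⁅ w ⁆))
  size-∪⁅⁆ (inside  ∷ X) zero    w∉ = contradiction Vec.here w∉
  size-∪⁅⁆ (outside ∷ X) zero    w∉ = cong (ℕ.suc ∘ size) (sym (Subset.∪-identityʳ X))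
  size-∪⁅⁆ (inside  ∷ X) (suc w) w∉ = size-∪⁅⁆ X w (w∉ ∘ Vec.there)
  size-∪⁅⁆ (outside ∷ X) (suc w) w∉ = cong ℕ.suc (size-∪⁅⁆ X w (w∉ ∘ Vec.there))

  size≤n : (X : Subset n) → size X ≤ n
  size≤n X = Subset.∣p∣≤n (∁ X)

  support : List (Fin n) → Subset n
  support us = ⋃ (map ⁅_⁆ us)

  ∈-support⁺ : ∀ {x : Fin n} {us} → x List.∈ us → x ∈ support us
  ∈-support⁺ {x = x} (here refl) = Subset.x∈p∪q⁺ (inj₁ (Subset.x∈⁅x⁆ x))
  ∈-support⁺ (there x∈)          = Subset.x∈p∪q⁺ (inj₂ (∈-support⁺ x∈))

  ∈-support⁻ : ∀ {x : Fin n} us → x ∈ support us → x List.∈ us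
  ∈-support⁻ []       x∈ = contradiction x∈ Subset.∉⊥
  ∈-support⁻ (u ∷ us) x∈ with Subset.x∈p∪q⁻ ⁅ u ⁆ (support us) x∈
  ... | inj₁ x∈u  = here (Subset.x∈⁅y⁆⇒x≡y u x∈u)
  ... | inj₂ x∈us = there (∈-support⁻ us x∈us)

  unique? : (us : List (Fin n)) → Dec (Unique us)
  unique? = DecUnique.unique? Fin._≟_

  ⟦unique?-∷⟧ : (u : Fin n) (us : List (Fin n)) →
                ⟦ unique? (u ∷ us) ⟧ ≡ δ ⁅ u ⁆ (support us) * ⟦ unique? us ⟧
  ⟦unique?-∷⟧ u us = trans
    (⟦⟧-cong (unique? (u ∷ us)) (disjoint? ⁅ u ⁆ (support us) ×-dec unique? us)
      (λ { (u∉ ∷ us!) → disjoint⁺ (λ x∈ x∈us → All.lookup u∉ (∈-support⁻ us x∈us)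
          (sym (Subset.x∈⁅y⁆⇒x≡y u x∈))) , us! })
      (λ (d , us!) → All.tabulate (λ { x∈ refl → disjoint⁻ d (Subset.x∈⁅x⁆ u) (∈-support⁺ x∈) }) ∷ us!))
    (⟦⟧-× (disjoint? ⁅ u ⁆ (support us)) (unique? us))

  size-∪-support : (X : Subset n) (us : List (Fin n)) → Unique us → Disjoint X (support us) →
                   size X ≡ length us ℕ.+ size (X ∪ support us)
  size-∪-support X []       us!        d = cong size (sym (Subset.∪-identityʳ X))
  size-∪-support X (u ∷ us) (u∉ ∷ us!) d = begin
    size X
      ≡⟨ size-∪⁅⁆ X u u∉X ⟩
    ℕ.suc (size (X ∪ ⁅ u ⁆))
      ≡⟨ cong ℕ.suc (size-∪-support (X ∪ ⁅ u ⁆) us us! d′) ⟩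
    ℕ.suc (length us ℕ.+ size ((X ∪ ⁅ u ⁆) ∪ support us))
      ≡⟨ cong (λ Y → ℕ.suc (length us ℕ.+ size Y)) (Subset.∪-assoc X ⁅ u ⁆ (support us)) ⟩
    ℕ.suc (length us ℕ.+ size (X ∪ support (u ∷ us))) ∎
    where
    u∉X : u ∉ X
    u∉X u∈X = disjoint⁻ d u∈X (Subset.x∈p∪q⁺ (inj₁ (Subset.x∈⁅x⁆ u)))
    d′ : Disjoint (X ∪ ⁅ u ⁆) (support us)
    d′ = disjoint-∪ (disjoint-sym (disjoint-∪ʳ (disjoint-sym d)))
      (disjoint⁺ λ x∈ x∈us → All.lookup u∉ (∈-support⁻ us x∈us) (sym (Subset.x∈⁅y⁆⇒x≡y u x∈)))

  lists : ∀ n → ℕ → List (List (Fin n))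
  lists n l = map Vec.toList (vecs (allFin n) l)

  -- sequences n is the case k = suc n.
  sequences< : ∀ n → ℕ → List (List (Fin n))
  sequences< n k = concatMap (lists n) (upTo k)

  ∑-sequences< : ∀ k (f : List (Fin n) → ℤ) →
    ∑ (sequences< n (ℕ.suc k)) f ≡
    f [] + ∑ (allFin n) (λ w → ∑ (sequences< n k) (λ ws → f (w ∷ ws)))
  ∑-sequences< {n} k f = begin
    ∑ (sequences< n (ℕ.suc k)) f
      ≡⟨ ∑-concatMap (lists n) (upTo (ℕ.suc k)) f ⟩
    (f [] + 0ℤ) + ∑ (List.applyUpTo ℕ.suc k) (λ l → ∑ (lists n l) f)
      ≡⟨ cong₂ _+_ (+-identityʳ (f [])) (begin
           ∑ (List.applyUpTo ℕ.suc k) (λ l → ∑ (lists n l) f)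
             ≡⟨ cong (λ ls → ∑ ls (λ l → ∑ (lists n l) f)) (List.map-applyUpTo id ℕ.suc k) ⟨
           ∑ (map ℕ.suc (upTo k)) (λ l → ∑ (lists n l) f)
             ≡⟨ ∑-map ℕ.suc (upTo k) (λ l → ∑ (lists n l) f) ⟩
           ∑ (upTo k) (λ l → ∑ (lists n (ℕ.suc l)) f)
             ≡⟨ ∑-cong (upTo k) step ⟩
           ∑ (upTo k) (λ l → ∑ (allFin n) (λ w → ∑ (lists n l) (λ ws → f (w ∷ ws))))
             ≡⟨ ∑-swap (upTo k) (allFin n) _ ⟩
           ∑ (allFin n) (λ w → ∑ (upTo k) (λ l → ∑ (lists n l) (λ ws → f (w ∷ ws))))
             ≡⟨ ∑-cong (allFin n) (λ w → sym (∑-concatMap (lists n) (upTo k) (λ ws → f (w ∷ ws)))) ⟩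
           ∑ (allFin n) (λ w → ∑ (sequences< n k) (λ ws → f (w ∷ ws))) ∎) ⟩
    f [] + ∑ (allFin n) (λ w → ∑ (sequences< n k) (λ ws → f (w ∷ ws))) ∎
    where
    step : ∀ l → ∑ (lists n (ℕ.suc l)) f ≡ ∑ (allFin n) (λ w → ∑ (lists n l) (λ ws → f (w ∷ ws)))
    step l = begin
      ∑ (lists n (ℕ.suc l)) f
        ≡⟨ ∑-map Vec.toList (vecs (allFin n) (ℕ.suc l)) f ⟩
      ∑ (vecs (allFin n) (ℕ.suc l)) (f ∘ Vec.toList)
        ≡⟨ ∑-cartesianProductWith _∷_ (allFin n) (vecs (allFin n) l) (f ∘ Vec.toList) ⟩
      ∑ (allFin n) (λ w → ∑ (vecs (allFin n) l) (λ ws → f (w ∷ Vec.toList ws)))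
        ≡⟨ ∑-cong (allFin n) (λ w → sym (∑-map Vec.toList (vecs (allFin n) l) (λ ws → f (w ∷ ws)))) ⟩
      ∑ (allFin n) (λ w → ∑ (lists n l) (λ ws → f (w ∷ ws))) ∎

  -- For `u = v` these are the cyclic steps of `v ∷ ws`, by `zip-walk`. Keeping the two ends apart
  -- makes recursion along the walk possible.
  walk : A → List A → A → List (A × A)
  walk u []       v = (u , v) ∷ []
  walk u (w ∷ ws) v = (u , w) ∷ walk w ws v

  zip-walk : (u : A) (ws : List A) (v : A) → zip (u ∷ ws) (ws ∷ʳ v) ≡ walk u ws v
  zip-walk u []       v = refl
  zip-walk u (w ∷ ws) v = cong ((u , w) ∷_) (zip-walk w ws v)

  -- Expansion is along the first row, so `v` has to head the list `free X`. Being the least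
  -- remaining vertex survives every deletion that avoids `v`, by `first-∪`.
  First : Fin n → Subset n → Set
  First v X = v ∉ X × (∀ u → u Fin.< v → u ∈ X)

  first⊎⊤ : (X : Subset n) → (∃ λ v → First v X) ⊎ X ≡ ⊤
  first⊎⊤ []            = inj₂ refl
  first⊎⊤ (outside ∷ X) = inj₁ (zero , (λ ()) , λ _ ())
  first⊎⊤ (inside  ∷ X) with first⊎⊤ X
  ... | inj₂ refl            = inj₂ refl
  ... | inj₁ (v , v∉ , below) = inj₁ (suc v , (λ { (Vec.there v∈) → v∉ v∈ }) ,
                                       λ { zero _ → Vec.here ; (suc u) (s≤s u<v) → Vec.there (below u u<v) })

  first-∪ : ∀ {v : Fin n} (X : Subset n) {Y} → First v X → v ∉ Y → First v (X ∪ Y)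
  first-∪ X {Y} (v∉X , below) v∉Y =
    (λ v∈ → case (Subset.x∈p∪q⁻ X Y v∈)) , λ u u<v → Subset.x∈p∪q⁺ (inj₁ (below u u<v))
    where
    case : ¬ (_ ∈ X ⊎ _ ∈ Y)
    case (inj₁ v∈X) = v∉X v∈X
    case (inj₂ v∈Y) = v∉Y v∈Y

  free-first : (X : Subset n) (v : Fin n) → First v X → free X ≡ v ∷ free (X ∪ ⁅ v ⁆)
  free-first (inside  ∷ X) zero    (v∉ , below) = contradiction Vec.here v∉
  free-first (outside ∷ X) zero    (v∉ , below) =
    cong (λ Y → zero ∷ map suc (free Y)) (sym (Subset.∪-identityʳ X))
  free-first (outside ∷ X) (suc v) (v∉ , below) = contradiction (below zero (s≤s ℕ.z≤n)) λ ()
  free-first (inside  ∷ X) (suc v) (v∉ , below) =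
    cong (map suc) (free-first X v (v∉ ∘ Vec.there , λ u u<v → Subset.drop-there (below (suc u) (s≤s u<v))))

  free-⊤ : ∀ n → free (⊤ {n}) ≡ []
  free-⊤ ℕ.zero    = refl
  free-⊤ (ℕ.suc n) = cong (map suc) (free-⊤ n)

  module CycleExpansion (H : Graph n) where

    open Graph H

    steps? : (steps : List (Fin n × Fin n)) → Dec (All (uncurry _∼_) steps)
    steps? = All.all? λ (u , v) → u ∼? v

    ⟦steps?-∷⟧ : ∀ u v steps → ⟦ steps? ((u , v) ∷ steps) ⟧ ≡ adjacency H u v * ⟦ steps? steps ⟧
    ⟦steps?-∷⟧ u v steps = trans
      (⟦⟧-cong (steps? ((u , v) ∷ steps)) (u ∼? v ×-dec steps? steps) (λ { (e ∷ es) → e , es })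
          (λ (e , es) → e ∷ es))
      (⟦⟧-× (u ∼? v) (steps? steps))

    -- Length two is included: an edge traversed back and forth is a transposition in the expansion.
    -- Length one is excluded by the absence of loops.
    Based : Fin n → List (Fin n) → Set
    Based v us = head us ≡ just v × Unique us × All (uncurry _∼_) (cyclicSteps us)

    based? : (v : Fin n) (us : List (Fin n)) → Dec (Based v us)
    based? v us = Maybe.≡-dec Fin._≟_ (head us) (just v) ×-dec unique? us ×-dec steps? (cyclicSteps us)

    module _ (ε : ℤ) (ε² : ε * ε ≡ 1ℤ) where

      minor : Subset n → ℤ
      minor X = immanant ε (adjacency H) (free X) (free X)

      -- The indicator of a path from `u` through `ws` to `v` whose inner vertices are distinct and
      -- outside `X`. When the expansion of a cycle uses it, `X` contains both ends and all vertices
      -- visited before, so no vertex is met twice.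
      pathWeight : Fin n → Subset n → Fin n → List (Fin n) → ℤ
      pathWeight v X u ws = δ X (support ws) * (⟦ unique? ws ⟧ * ⟦ steps? (walk u ws v) ⟧)

      pathWeight-[] : ∀ v X u → pathWeight v X u [] ≡ adjacency H u v
      pathWeight-[] v X u = begin
        δ X ⊥ * (1ℤ * ⟦ steps? ((u , v) ∷ []) ⟧)  ≡⟨ cong₂ (λ s t → s * (1ℤ * t)) (δ-⊥ X) (⟦steps?-∷⟧ u v []) ⟩
        1ℤ * (1ℤ * (adjacency H u v * 1ℤ))        ≡⟨ units (adjacency H u v) ⟩
        adjacency H u v                           ∎
        where
        opaque
          unfolding _+_ _*_
          units : ∀ a → 1ℤ * (1ℤ * (a * 1ℤ)) ≡ a
          units = solve-∀

      pathWeight-∷ : ∀ v X u w ws →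
        pathWeight v X u (w ∷ ws) ≡ ⟦ w ∉? X ⟧ * (adjacency H u w * pathWeight v (X ∪ ⁅ w ⁆) w ws)
      pathWeight-∷ v X u w ws = begin
        δ X (⁅ w ⁆ ∪ support ws) * (⟦ unique? (w ∷ ws) ⟧ * ⟦ steps? ((u , w) ∷ walk w ws v) ⟧)
          ≡⟨ cong₂ _*_ (trans (δ-∪ʳ X ⁅ w ⁆ (support ws)) (cong (_* δ X (support ws)) (δ-⁅⁆ X w)))
               (cong₂ _*_ (⟦unique?-∷⟧ w ws) (⟦steps?-∷⟧ u w (walk w ws v))) ⟩
        (⟦ w ∉? X ⟧ * δ X (support ws)) *
            ((δ ⁅ w ⁆ (support ws) * ⟦ unique? ws ⟧) * (adjacency H u w * ⟦ steps? (walk w ws v) ⟧))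
          ≡⟨ rearrange ⟦ w ∉? X ⟧ _ _ _ _ _ ⟩
        ⟦ w ∉? X ⟧ * (adjacency H u w *
            ((δ X (support ws) * δ ⁅ w ⁆ (support ws)) * (⟦ unique? ws ⟧ * ⟦ steps? (walk w ws v) ⟧)))
          ≡⟨ cong (λ s → ⟦ w ∉? X ⟧ * (adjacency H u w *
              (s * (⟦ unique? ws ⟧ * ⟦ steps? (walk w ws v) ⟧)))) (δ-∪ˡ X ⁅ w ⁆ (support ws)) ⟨
        ⟦ w ∉? X ⟧ * (adjacency H u w * pathWeight v (X ∪ ⁅ w ⁆) w ws) ∎
        where
        opaque
          unfolding _+_ _*_
          rearrange : ∀ a b c d e f → (a * b) * ((c * d) * (e * f)) ≡ a * (e * ((b * c) * (d * f)))
          rearrange = solve-∀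

      -- Each application of `immanant-bordered` either closes the path at `v` or extends it to a
      -- vertex `w`, which joins the deleted set and costs a factor ε. A path outside `X` has at
      -- most `size X` inner vertices, so the length bound `k` loses nothing, and it can drop by one
      -- at each step.
      walk-expansion : ∀ v k X u → size X < k →
        immanant ε (adjacency H) (u ∷ free X) (v ∷ free X) ≡
        ∑ (sequences< n k) (λ ws → pathWeight v X u ws * (ε ^ length ws * minor (X ∪ support ws)))
      walk-expansion v (ℕ.suc k) X u (s≤s size≤k) = begin
        immanant ε a (u ∷ free X) (v ∷ free X)
          ≡⟨ immanant-bordered ε ε² a u v (free X) ⟩
        a u v * minor X + ε * pick 1ℤ (free X) (λ w ys → a u w * immanant ε a (w ∷ ys) (v ∷ ys))
          ≡⟨ cong (λ s → a u v * minor X + ε * s) (pick-free X _) ⟩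
        a u v * minor X + ε * ∑ (allFin n)
            (λ w → ⟦ w ∉? X ⟧ * (a u w * immanant ε a (w ∷ free (X ∪ ⁅ w ⁆)) (v ∷ free (X ∪ ⁅ w ⁆))))
          ≡⟨ cong (a u v * minor X +_) (trans (sym (∑-*ˡ ε (allFin n) _)) (∑-cong (allFin n) step)) ⟩
        a u v * minor X + ∑ (allFin n) (λ w → ∑ (sequences< n k) (λ ws → term (w ∷ ws)))
          ≡⟨ cong (_+ ∑ (allFin n) (λ w → ∑ (sequences< n k) (λ ws → term (w ∷ ws)))) empty ⟩
        term [] + ∑ (allFin n) (λ w → ∑ (sequences< n k) (λ ws → term (w ∷ ws)))
          ≡⟨ ∑-sequences< k term ⟨
        ∑ (sequences< n (ℕ.suc k)) term ∎
        where
        a = adjacency H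
        term : List (Fin n) → ℤ
        term ws = pathWeight v X u ws * (ε ^ length ws * minor (X ∪ support ws))
        empty : a u v * minor X ≡ term []
        empty = cong₂ _*_ (sym (pathWeight-[] v X u))
            (trans (cong minor (sym (Subset.∪-identityʳ X))) (sym (*-identityˡ _)))
        opaque
          unfolding _+_ _*_
          rearrange : ∀ ε i e p q m → ε * (i * (e * (p * (q * m)))) ≡ (i * (e * p)) * ((ε * q) * m)
          rearrange = solve-∀
        step : ∀ w → ε * (⟦ w ∉? X ⟧ * (a u w * immanant ε a (w ∷ free (X ∪ ⁅ w ⁆)) (v ∷ free (X ∪ ⁅ w ⁆)))) ≡
                     ∑ (sequences< n k) (λ ws → term (w ∷ ws))
        step w = begin
          ε * (⟦ w ∉? X ⟧ * (a u w * immanant ε a (w ∷ free (X ∪ ⁅ w ⁆)) (v ∷ free (X ∪ ⁅ w ⁆))))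
            ≡⟨ cong (ε *_) (⟦⟧-absorb (w ∉? X) λ w∉X → cong (a u w *_)
                 (walk-expansion v k (X ∪ ⁅ w ⁆) w (subst (_≤ k) (size-∪⁅⁆ X w w∉X) size≤k))) ⟩
          ε * (⟦ w ∉? X ⟧ * (a u w * ∑ (sequences< n k)
              (λ ws → pathWeight v (X ∪ ⁅ w ⁆) w ws * (ε ^ length ws * minor ((X ∪ ⁅ w ⁆) ∪ support ws)))))
            ≡⟨ cong (λ s → ε * (⟦ w ∉? X ⟧ * s)) (∑-*ˡ (a u w) (sequences< n k) _) ⟨
          ε * (⟦ w ∉? X ⟧ * ∑ (sequences< n k) _)
            ≡⟨ cong (ε *_) (∑-*ˡ ⟦ w ∉? X ⟧ (sequences< n k) _) ⟨
          ε * ∑ (sequences< n k) _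
            ≡⟨ ∑-*ˡ ε (sequences< n k) _ ⟨
          ∑ (sequences< n k) (λ ws → ε *
              (⟦ w ∉? X ⟧ * (a u w * (pathWeight v (X ∪ ⁅ w ⁆) w ws *
              (ε ^ length ws * minor ((X ∪ ⁅ w ⁆) ∪ support ws))))))
            ≡⟨ ∑-cong (sequences< n k) (λ ws → trans (rearrange ε ⟦ w ∉? X ⟧ (a u w) _ _ _)
                 (cong₂ (λ s Y → s * (ε ^ length (w ∷ ws) * minor Y)) (sym (pathWeight-∷ v X u w ws))
                     (Subset.∪-assoc X ⁅ w ⁆ (support ws)))) ⟩
          ∑ (sequences< n k) (λ ws → term (w ∷ ws)) ∎

      -- Since `v` heads the list of remaining vertices, the matrix is the one without `v`, bordered
      -- by the row and the column of `v` itself: the case `u = v` of `walk-expansion`. A path from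
      -- `v` back to `v` is a closed sequence, and `pred` discounts its head `v`, which costs no
      -- sign.
      cycle-expansion : ∀ v X → First v X →
        minor X ≡ ∑ (sequences n) (λ us → ⟦ based? v us ⟧ *
            (δ X (support us) * (ε ^ pred (length us) * minor (X ∪ support us))))
      cycle-expansion v X v-first@(v∉X , _) = begin
        immanant ε (adjacency H) (free X) (free X)
          ≡⟨ cong (λ vs → immanant ε (adjacency H) vs vs) (free-first X v v-first) ⟩
        immanant ε (adjacency H) (v ∷ free X′) (v ∷ free X′)
          ≡⟨ walk-expansion v n X′ v (subst (_≤ n) (size-∪⁅⁆ X v v∉X) (size≤n X)) ⟩
        ∑ (sequences< n n) (λ ws → pathWeight v X′ v ws * (ε ^ length ws * minor (X′ ∪ support ws)))
          ≡⟨ ∑-cong (sequences< n n) rooted ⟩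
        ∑ (sequences< n n) (λ ws → term (v ∷ ws))
          -- Letting the head range over all vertices changes nothing, since only sequences with
          -- head `v` are based at `v`; this makes the sum run over the same `sequences n` that
          -- enumerate the 4k-cycles.
          ≡⟨ ∑-single (allFin⁺ n) (List.∈-allFin v) {λ w → ∑ (sequences< n n) (λ ws → term (w ∷ ws))}
               (λ w w≢v → ∑-null (sequences< n n) (λ ws _ → unrooted (w ∷ ws) λ { refl → w≢v refl })) ⟨
        ∑ (allFin n) (λ w → ∑ (sequences< n n) (λ ws → term (w ∷ ws)))
          ≡⟨ +-identityˡ _ ⟨
        0ℤ + ∑ (allFin n) (λ w → ∑ (sequences< n n) (λ ws → term (w ∷ ws)))
          ≡⟨ cong (_+ ∑ (allFin n) (λ w → ∑ (sequences< n n) (λ ws → term (w ∷ ws)))) (unrooted [] λ ()) ⟨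
        term [] + ∑ (allFin n) (λ w → ∑ (sequences< n n) (λ ws → term (w ∷ ws)))
          ≡⟨ ∑-sequences< n term ⟨
        ∑ (sequences n) term ∎
        where
        X′ = X ∪ ⁅ v ⁆
        term : List (Fin n) → ℤ
        term us = ⟦ based? v us ⟧ * (δ X (support us) * (ε ^ pred (length us) * minor (X ∪ support us)))
        unrooted : ∀ us → head us ≢ just v → term us ≡ 0ℤ
        unrooted us ≢v = trans (cong (_* _) (⟦⟧-no (based? v us) (≢v ∘ proj₁))) (zeroˡ _)
        opaque
          unfolding _+_ _*_
          rearrange : ∀ x y z e m → ((x * y) * (z * e)) * m ≡ ((y * z) * e) * ((1ℤ * x) * m)
          rearrange = solve-∀
        ⟦based?⟧ : ∀ ws → ⟦ based? v (v ∷ ws) ⟧ ≡ (δ ⁅ v ⁆ (support ws) * ⟦ unique? ws ⟧) * ⟦ steps?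
            (walk v ws v) ⟧
        ⟦based?⟧ ws = begin
          ⟦ based? v (v ∷ ws) ⟧
            ≡⟨ ⟦⟧-cong (based? v (v ∷ ws)) (unique? (v ∷ ws) ×-dec steps? (walk v ws v))
                 (λ (_ , us! , es) → us! , subst (All (uncurry _∼_)) (zip-walk v ws v) es)
                 (λ (us! , es) → refl , us! , subst (All (uncurry _∼_)) (sym (zip-walk v ws v)) es) ⟩
          ⟦ unique? (v ∷ ws) ×-dec steps? (walk v ws v) ⟧
            ≡⟨ ⟦⟧-× (unique? (v ∷ ws)) (steps? (walk v ws v)) ⟩
          ⟦ unique? (v ∷ ws) ⟧ * ⟦ steps? (walk v ws v) ⟧
            ≡⟨ cong (_* ⟦ steps? (walk v ws v) ⟧) (⟦unique?-∷⟧ v ws) ⟩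
          (δ ⁅ v ⁆ (support ws) * ⟦ unique? ws ⟧) * ⟦ steps? (walk v ws v) ⟧ ∎
        rooted : ∀ ws → pathWeight v X′ v ws * (ε ^ length ws * minor (X′ ∪ support ws)) ≡ term (v ∷ ws)
        rooted ws = begin
          (δ X′ (support ws) * (⟦ unique? ws ⟧ * ⟦ steps? (walk v ws v) ⟧)) *
              (ε ^ length ws * minor (X′ ∪ support ws))
            ≡⟨ cong₂ (λ s Y → (s * (⟦ unique? ws ⟧ * ⟦ steps? (walk v ws v) ⟧)) * (ε ^ length ws * minor Y))
                 (δ-∪ˡ X ⁅ v ⁆ (support ws)) (Subset.∪-assoc X ⁅ v ⁆ (support ws)) ⟩
          ((δ X (support ws) * δ ⁅ v ⁆ (support ws)) * (⟦ unique? ws ⟧ * ⟦ steps? (walk v ws v) ⟧)) *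
              (ε ^ length ws * minor (X ∪ support (v ∷ ws)))
            ≡⟨ rearrange (δ X (support ws)) (δ ⁅ v ⁆ (support ws)) _ _ _ ⟩
          ((δ ⁅ v ⁆ (support ws) * ⟦ unique? ws ⟧) * ⟦ steps? (walk v ws v) ⟧) *
              ((1ℤ * δ X (support ws)) * (ε ^ length ws * minor (X ∪ support (v ∷ ws))))
            ≡⟨ cong₂ (λ s t → s * (t * (ε ^ length ws * minor (X ∪ support (v ∷ ws))))) (sym (⟦based?⟧ ws))
                (sym (begin
                 δ X (⁅ v ⁆ ∪ support ws)        ≡⟨ δ-∪ʳ X ⁅ v ⁆ (support ws) ⟩
                 δ X ⁅ v ⁆ * δ X (support ws)    ≡⟨ cong (_* δ X (support ws))
                     (trans (δ-⁅⁆ X v) (⟦⟧-yes (v ∉? X) v∉X)) ⟩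
                 1ℤ * δ X (support ws)           ∎)) ⟩
          term (v ∷ ws) ∎

  -- Tuples of disjoint cycles

  size-∪-< : (X Y : Subset n) → Disjoint X Y → Nonempty Y → size (X ∪ Y) < size X
  size-∪-< X Y d (y , y∈Y) = Subset.p⊂q⇒∣p∣<∣q∣
    (Subset.p⊂q⇒∁p⊃∁q {p = X} {q = X ∪ Y}
        (Subset.p⊆p∪q Y , y , Subset.q⊆p∪q X Y y∈Y , λ y∈X → disjoint⁻ d y∈X y∈Y))

  ∪-exchange : (X Y Z : Subset n) → (X ∪ Y) ∪ Z ≡ (X ∪ Z) ∪ Y
  ∪-exchange X Y Z = begin
    (X ∪ Y) ∪ Z  ≡⟨ Subset.∪-assoc X Y Z ⟩
    X ∪ (Y ∪ Z)  ≡⟨ cong (X ∪_) (Subset.∪-comm Y Z) ⟩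
    X ∪ (Z ∪ Y)  ≡⟨ Subset.∪-assoc X Z Y ⟨
    (X ∪ Z) ∪ Y  ∎

  module DisjointTuples (cs : List A) (S : A → Subset n) (D : Subset n → ℤ) where

    -- The sum of D (X ∪ S R₁ ∪ … ∪ S Rz) over the ordered tuples of pairwise
    -- disjoint members of the family that are disjoint from X.
    τ : ℕ → Subset n → ℤ
    τ ℕ.zero    X = D X
    τ (ℕ.suc z) X = ∑ cs (λ R → δ X (S R) * τ z (X ∪ S R))

    Fits : ∀ {z} → Subset n → Vec A z → Set
    Fits X T = VecAll.All (λ R → Disjoint X (S R)) T × AllPairs (λ Q R → Disjoint (S Q) (S R)) T

    fits? : ∀ {z} (X : Subset n) (T : Vec A z) → Dec (Fits X T)
    fits? X T = VecAll.all? (λ R → disjoint? X (S R)) T ×-dec AllPairs.allPairs?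
        (λ Q R → disjoint? (S Q) (S R)) T

    ⟦fits?-∷⟧ : ∀ {z} X R (T : Vec A z) → ⟦ fits? X (R ∷ T) ⟧ ≡ δ X (S R) * ⟦ fits? (X ∪ S R) T ⟧
    ⟦fits?-∷⟧ X R T = trans
      (⟦⟧-cong (fits? X (R ∷ T)) (disjoint? X (S R) ×-dec fits? (X ∪ S R) T)
        (λ { (d ∷ ds , e ∷ es) → d , VecAll.map (uncurry disjoint-∪) (VecAll.zip (ds , e)) , es })
        (λ (d , ds , es) → d ∷ VecAll.map disjoint-∪ˡ ds , VecAll.map (disjoint-∪ʳ {X = X}) ds ∷ es))
      (⟦⟧-× (disjoint? X (S R)) (fits? (X ∪ S R) T))

    -- Each chosen member joins the deleted set, so that pairwise disjointness becomes disjointness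
    -- of the next member from what is already deleted.
    ∑-vecs : ∀ z X → ∑ (vecs cs z) (λ T → ⟦ fits? X T ⟧ * D (X ∪ ⋃ (toList (Vec.map S T)))) ≡ τ z X
    ∑-vecs ℕ.zero    X = trans (+-identityʳ _) (trans (*-identityˡ _) (cong D (Subset.∪-identityʳ X)))
    ∑-vecs (ℕ.suc z) X = begin
      ∑ (vecs cs (ℕ.suc z)) (λ T → ⟦ fits? X T ⟧ * D (X ∪ ⋃ (toList (Vec.map S T))))
        ≡⟨ ∑-cartesianProductWith _∷_ cs (vecs cs z) _ ⟩
      ∑ cs (λ R → ∑ (vecs cs z) (λ T → ⟦ fits? X (R ∷ T) ⟧ * D (X ∪ (S R ∪ ⋃ (toList (Vec.map S T))))))
        ≡⟨ ∑-cong cs (λ R → ∑-cong (vecs cs z) (λ T → trans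
             (cong₂ (λ s Y → s * D Y) (⟦fits?-∷⟧ X R T) (sym (Subset.∪-assoc X (S R) _)))
             (*-assoc (δ X (S R)) _ _))) ⟩
      ∑ cs (λ R → ∑ (vecs cs z) (λ T → δ X (S R) *
          (⟦ fits? (X ∪ S R) T ⟧ * D ((X ∪ S R) ∪ ⋃ (toList (Vec.map S T))))))
        ≡⟨ ∑-cong cs (λ R → trans (∑-*ˡ (δ X (S R)) (vecs cs z) _) (cong (δ X (S R) *_) (∑-vecs z (X ∪ S R)))) ⟩
      τ (ℕ.suc z) X ∎

    -- Each nonempty member of a tuple uses up at least one remaining vertex.
    τ-null : (∀ R → R List.∈ cs → Nonempty (S R)) → ∀ z X → size X < z → τ z X ≡ 0ℤ
    τ-null nonempty (ℕ.suc z) X (s≤s size≤z) = ∑-null cs λ R R∈ → trans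
      (⟦⟧-absorb (disjoint? X (S R)) λ d → τ-null nonempty z (X ∪ S R)
          (ℕ.≤-trans (size-∪-< X (S R) d (nonempty R R∈)) size≤z))
      (zeroʳ (δ X (S R)))

    module _ (v : Fin n) where

      δ-avoid : ∀ {Y} R → v ∈ Y → ⟦ v ∉? S R ⟧ * δ (S R) Y ≡ δ (S R) Y
      δ-avoid {Y} R v∈Y = trans (sym (⟦⟧-× (v ∉? S R) (disjoint? (S R) Y)))
        (⟦⟧-cong (v ∉? S R ×-dec disjoint? (S R) Y) (disjoint? (S R) Y) proj₂
            (λ d → (λ v∈R → disjoint⁻ d v∈R v∈Y) , d))

      -- Only those `x` count whose set `U x` contains `v`. Disjointness of `S R` from `U x` then
      -- already implies that `S R` avoids `v`, so this condition disappears once `x` is chosen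
      -- before `R`. It serves both for closed sequences based at `v` and for members of the family
      -- through `v`.
      ∑-exchange : (bs : List B) (U : B → Subset n) (k : B → ℤ) → (∀ x → v ∉ U x → k x ≡ 0ℤ) →
        (Φ : Subset n → ℤ) (X : Subset n) →
        ∑ cs (λ R → ⟦ v ∉? S R ⟧ * (δ X (S R) * ∑ bs (λ x → k x * (δ (X ∪ S R) (U x) * Φ ((X ∪ S R) ∪ U x))))) ≡
        ∑ bs (λ x → k x * (δ X (U x) * ∑ cs (λ R → δ (X ∪ U x) (S R) * Φ ((X ∪ U x) ∪ S R))))
      ∑-exchange bs U k k-null Φ X = begin
        ∑ cs (λ R → ⟦ v ∉? S R ⟧ * (δ X (S R) * ∑ bs (λ x → k x * (δ (X ∪ S R) (U x) * Φ ((X ∪ S R) ∪ U x)))))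
          ≡⟨ ∑-cong cs (λ R → sym (trans (∑-*ˡ ⟦ v ∉? S R ⟧ bs _)
              (cong (⟦ v ∉? S R ⟧ *_) (∑-*ˡ (δ X (S R)) bs _)))) ⟩
        ∑ cs (λ R → ∑ bs (λ x → ⟦ v ∉? S R ⟧ * (δ X (S R) * (k x * (δ (X ∪ S R) (U x) * Φ ((X ∪ S R) ∪ U x))))))
          ≡⟨ ∑-swap cs bs _ ⟩
        ∑ bs (λ x → ∑ cs (λ R → ⟦ v ∉? S R ⟧ * (δ X (S R) * (k x * (δ (X ∪ S R) (U x) * Φ ((X ∪ S R) ∪ U x))))))
          ≡⟨ ∑-cong bs (λ x → ∑-cong cs (pointwise x)) ⟩
        ∑ bs (λ x → ∑ cs (λ R → k x * (δ X (U x) * (δ (X ∪ U x) (S R) * Φ ((X ∪ U x) ∪ S R)))))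
          ≡⟨ ∑-cong bs (λ x → trans (∑-*ˡ (k x) cs _) (cong (k x *_) (∑-*ˡ (δ X (U x)) cs _))) ⟩
        ∑ bs (λ x → k x * (δ X (U x) * ∑ cs (λ R → δ (X ∪ U x) (S R) * Φ ((X ∪ U x) ∪ S R)))) ∎
        where
        opaque
          unfolding _+_ _*_
          null : ∀ a b c → a * (b * (0ℤ * c)) ≡ 0ℤ
          null = solve-∀
          lhs : ∀ i a k c d φ → i * (a * (k * ((c * d) * φ))) ≡ (k * (c * (a * φ))) * (i * d)
          lhs = solve-∀
          rhs : ∀ a k c d φ → (k * (c * (a * φ))) * d ≡ k * (c * ((a * d) * φ))
          rhs = solve-∀
        pointwise : ∀ x R →
          ⟦ v ∉? S R ⟧ * (δ X (S R) * (k x * (δ (X ∪ S R) (U x) * Φ ((X ∪ S R) ∪ U x)))) ≡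
          k x * (δ X (U x) * (δ (X ∪ U x) (S R) * Φ ((X ∪ U x) ∪ S R)))
        pointwise x R with v Subset.∈? U x
        ... | no v∉U rewrite k-null x v∉U = trans (null ⟦ v ∉? S R ⟧ (δ X (S R)) _) (sym (zeroˡ _))
        ... | yes v∈U = begin
          ⟦ v ∉? S R ⟧ * (δ X (S R) * (k x * (δ (X ∪ S R) (U x) * Φ ((X ∪ S R) ∪ U x))))
            ≡⟨ cong₂ (λ s Y → ⟦ v ∉? S R ⟧ * (δ X (S R) * (k x * (s * Φ Y)))) (δ-∪ˡ X (S R) (U x))
                (∪-exchange X (S R) (U x)) ⟩
          ⟦ v ∉? S R ⟧ * (δ X (S R) * (k x * ((δ X (U x) * δ (S R) (U x)) * Φ ((X ∪ U x) ∪ S R))))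
            ≡⟨ lhs ⟦ v ∉? S R ⟧ (δ X (S R)) (k x) (δ X (U x)) (δ (S R) (U x)) _ ⟩
          (k x * (δ X (U x) * (δ X (S R) * Φ ((X ∪ U x) ∪ S R)))) * (⟦ v ∉? S R ⟧ * δ (S R) (U x))
            ≡⟨ cong ((k x * (δ X (U x) * (δ X (S R) * Φ ((X ∪ U x) ∪ S R)))) *_)
                (trans (δ-avoid R v∈U) (δ-sym (S R) (U x))) ⟩
          (k x * (δ X (U x) * (δ X (S R) * Φ ((X ∪ U x) ∪ S R)))) * δ (U x) (S R)
            ≡⟨ rhs (δ X (S R)) (k x) (δ X (U x)) (δ (U x) (S R)) _ ⟩
          k x * (δ X (U x) * ((δ X (S R) * δ (U x) (S R)) * Φ ((X ∪ U x) ∪ S R)))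
            ≡⟨ cong (λ s → k x * (δ X (U x) * (s * Φ ((X ∪ U x) ∪ S R)))) (δ-∪ˡ X (U x) (S R)) ⟨
          k x * (δ X (U x) * (δ (X ∪ U x) (S R) * Φ ((X ∪ U x) ∪ S R))) ∎

      τ-through : ℕ → Subset n → ℤ
      τ-through z X = ∑ cs (λ R → ⟦ v Subset.∈? S R ⟧ * (δ X (S R) * τ z (X ∪ S R)))

      -- The determinant of the remaining graph is expanded at v if no member of
      -- the tuple contains v; otherwise one of its z members does.
      τ-expansion : (bs : List B) (U : B → Subset n) (k : B → ℤ) → (∀ x → v ∉ U x → k x ≡ 0ℤ) →
        (∀ X → First v X → D X ≡ ∑ bs (λ x → k x * (δ X (U x) * D (X ∪ U x)))) →
        ∀ z X → First v X →
        τ z X ≡ ∑ bs (λ x → k x * (δ X (U x) * τ z (X ∪ U x))) + ℤ.+ z * τ-through (pred z) X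
      τ-expansion bs U k k-null D-expansion ℕ.zero    X first =
        trans (D-expansion X first) (sym (trans (cong (_ +_) (zeroˡ _)) (+-identityʳ _)))
      τ-expansion bs U k k-null D-expansion (ℕ.suc z) X first = begin
        ∑ cs (λ R → δ X (S R) * τ z (X ∪ S R))
          ≡⟨ ∑-split (λ R → v Subset.∈? S R) cs _ ⟩
        τ-through z X + ∑ cs (λ R → ⟦ v ∉? S R ⟧ * (δ X (S R) * τ z (X ∪ S R)))
          ≡⟨ cong (τ-through z X +_) (begin
               ∑ cs (λ R → ⟦ v ∉? S R ⟧ * (δ X (S R) * τ z (X ∪ S R)))
                 -- A head `R` that avoids `v` leaves `v` first, so the induction hypothesis applies
                 -- to the other `z` members.
                 ≡⟨ ∑-cong cs (λ R → trans
                      (⟦⟧-absorb (v ∉? S R) λ v∉ → cong (δ X (S R) *_)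
                          (τ-expansion bs U k k-null D-expansion z (X ∪ S R) (first-∪ X first v∉)))
                      (distribute ⟦ v ∉? S R ⟧ (δ X (S R)) _ (ℤ.+ z) _)) ⟩
               ∑ cs (λ R → ⟦ v ∉? S R ⟧ * (δ X (S R) * ∑ bs
                   (λ x → k x * (δ (X ∪ S R) (U x) * τ z ((X ∪ S R) ∪ U x)))) +
                           ℤ.+ z * (⟦ v ∉? S R ⟧ * (δ X (S R) * τ-through (pred z) (X ∪ S R))))
                 -- In both sums the object through `v` is moved in front of `R`; behind it, `R` and
                 -- the remaining members reassemble to a `τ` with one member more.
                 ≡⟨ trans (∑-+ cs _ _) (cong₂ _+_
                      (∑-exchange bs U k k-null (τ z) X)
                      (trans (∑-*ˡ (ℤ.+ z) cs _) (cong (ℤ.+ z *_)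
                        (∑-exchange cs S (λ R → ⟦ v Subset.∈? S R ⟧) (λ R → ⟦⟧-no (v Subset.∈? S R))
                            (τ (pred z)) X)))) ⟩
               avoiding + ℤ.+ z * ∑ cs (λ R → ⟦ v Subset.∈? S R ⟧ * (δ X (S R) * τ (ℕ.suc (pred z)) (X ∪ S R)))
                 ≡⟨ cong (avoiding +_) (through z) ⟩
               avoiding + ℤ.+ z * τ-through z X ∎) ⟩
        τ-through z X + (avoiding + ℤ.+ z * τ-through z X)
          ≡⟨ collect (τ-through z X) avoiding (ℤ.+ z) ⟩
        avoiding + (1ℤ + ℤ.+ z) * τ-through z X
          ≡⟨ cong (λ s → avoiding + s * τ-through z X) (pos-+ 1 z) ⟨
        avoiding + ℤ.+ ℕ.suc z * τ-through z X ∎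
        where
        avoiding : ℤ
        avoiding = ∑ bs (λ x → k x * (δ X (U x) * τ (ℕ.suc z) (X ∪ U x)))
        -- For z = 0 the index `suc (pred z)` differs from `z`, but the factor `z` removes that
        -- term.
        through : ∀ z → ℤ.+ z * ∑ cs (λ R → ⟦ v Subset.∈? S R ⟧ * (δ X (S R) * τ (ℕ.suc (pred z)) (X ∪ S R))) ≡
                        ℤ.+ z * τ-through z X
        through ℕ.zero    = trans (zeroˡ _) (sym (zeroˡ _))
        through (ℕ.suc z) = refl
        opaque
          unfolding _+_ _*_
          distribute : ∀ i d a z t → i * (d * (a + z * t)) ≡ i * (d * a) + z * (i * (d * t))
          distribute = solve-∀
          collect : ∀ t a z → t + (a + z * t) ≡ a + (1ℤ + z) * t
          collect = solve-∀

  -- The two orientations of a 4k-cycle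

  unique-↭ : {xs ys : List A} → xs ↭ ys → Unique xs → Unique ys
  unique-↭ xs↭ys = Unique-resp-↭ (setoid _) (↭⇒↭ₛ xs↭ys)

  unique-map⁻ : (f : A → B) {xs : List A} → Unique (map f xs) → ∀ {x y} →
                x List.∈ xs → y List.∈ xs → f x ≡ f y → x ≡ y
  unique-map⁻ f u       (here refl) (here refl) eq = refl
  unique-map⁻ f (n ∷ u) (here refl) (there y∈)  eq = contradiction eq (All.lookup n (List.∈-map⁺ f y∈))
  unique-map⁻ f (n ∷ u) (there x∈)  (here refl) eq = contradiction (sym eq) (All.lookup n (List.∈-map⁺ f x∈))
  unique-map⁻ f (n ∷ u) (there x∈)  (there y∈)  eq = unique-map⁻ f u x∈ y∈ eq

  walk-++ : (u : A) (as : List A) (x : A) (bs : List A) (v : A) →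
            walk u (as ++ x ∷ bs) v ≡ walk u as x ++ walk x bs v
  walk-++ u []       x bs v = refl
  walk-++ u (a ∷ as) x bs v = cong ((u , a) ∷_) (walk-++ a as x bs v)

  walk-reverse : (u : A) (ws : List A) (v : A) →
                 walk v (reverse ws) u ≡ map swap (reverse (walk u ws v))
  walk-reverse u []       v = refl
  walk-reverse u (w ∷ ws) v = begin
    walk v (reverse (w ∷ ws)) u
      ≡⟨ cong (λ l → walk v l u) (List.unfold-reverse w ws) ⟩
    walk v (reverse ws ∷ʳ w) u
      ≡⟨ walk-++ v (reverse ws) w [] u ⟩
    walk v (reverse ws) w ∷ʳ (w , u)
      ≡⟨ cong (_∷ʳ (w , u)) (walk-reverse w ws v) ⟩
    map swap (reverse (walk w ws v)) ∷ʳ (w , u)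
      ≡⟨ List.map-++ swap (reverse (walk w ws v)) ((u , w) ∷ []) ⟨
    map swap (reverse (walk w ws v) ∷ʳ (u , w))
      ≡⟨ cong (map swap) (List.unfold-reverse (u , w) (walk w ws v)) ⟨
    map swap (reverse (walk u (w ∷ ws) v)) ∎

  ∈-walk-reverse : (u : A) (ws : List A) (v : A) → ∀ {a b} →
                   (a , b) List.∈ walk u ws v → (b , a) List.∈ walk v (reverse ws) u
  ∈-walk-reverse u ws v ab∈ = subst (_ List.∈_) (sym (walk-reverse u ws v))
    (List.∈-map⁺ swap (Any.reverse⁺ ab∈))

  map-proj₁-walk : (u : A) (ws : List A) (v : A) → map proj₁ (walk u ws v) ≡ u ∷ ws
  map-proj₁-walk u []       v = refl
  map-proj₁-walk u (w ∷ ws) v = cong (u ∷_) (map-proj₁-walk w ws v)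

  map-proj₂-walk : (u : A) (ws : List A) (v : A) → map proj₂ (walk u ws v) ≡ ws ∷ʳ v
  map-proj₂-walk u []       v = refl
  map-proj₂-walk u (w ∷ ws) v = cong (w ∷_) (map-proj₂-walk w ws v)

  -- Of the steps, `trace` records only this undirected relation; the orientation has to be
  -- recovered from it.
  Linked : A → List A → A → A → Set
  Linked v xs a b = (a , b) List.∈ walk v xs v ⊎ (b , a) List.∈ walk v xs v

  linked-reverse : (v : A) (xs : List A) → ∀ {a b} → Linked v xs a b → Linked v (reverse xs) a b
  linked-reverse v xs (inj₁ ab∈) = inj₂ (∈-walk-reverse v xs v ab∈)
  linked-reverse v xs (inj₂ ba∈) = inj₁ (∈-walk-reverse v xs v ba∈)

  unique-∷-reverse : {v : A} (xs : List A) → Unique (v ∷ xs) → Unique (v ∷ reverse xs)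
  unique-∷-reverse xs = unique-↭ (prep _ (↭-sym (↭-reverse xs)))

  module _ {v : A} {xs : List A} (xs! : Unique (v ∷ xs)) where

    successor : ∀ {a b c} → (a , b) List.∈ walk v xs v → (a , c) List.∈ walk v xs v → b ≡ c
    successor ab∈ ac∈ = cong proj₂
      (unique-map⁻ proj₁ (subst Unique (sym (map-proj₁-walk v xs v)) xs!) ab∈ ac∈ refl)

    predecessor : ∀ {a b c} → (a , c) List.∈ walk v xs v → (b , c) List.∈ walk v xs v → a ≡ b
    predecessor ac∈ bc∈ = cong proj₁
      (unique-map⁻ proj₂ (subst Unique (sym (map-proj₂-walk v xs v))
          (unique-↭ (++-comm (v ∷ []) xs) xs!)) ac∈ bc∈ refl)

    -- A walk without repetitions that starts along the orientation of the cycle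
    -- cannot turn back.
    walk-directed : ∀ p u s → (p , u) List.∈ walk v xs v → All (v ≢_) (p ∷ u ∷ s) → Unique (p ∷ u ∷ s) →
      (∀ {a b} → (a , b) List.∈ walk u s v → Linked v xs a b) →
      ∀ {a b} → (a , b) List.∈ walk u s v → (a , b) List.∈ walk v xs v
    walk-directed p u []      pu∈ (v≢p ∷ _) u! linked (here refl) with linked (here refl)
    ... | inj₁ uv∈ = uv∈
    ... | inj₂ vu∈ = contradiction (predecessor vu∈ pu∈) v≢p
    walk-directed p u (w ∷ s) pu∈ (_ ∷ v∉) ((_ ∷ p≢w ∷ _) ∷ u!) linked = directed
      where
      uw∈ : (u , w) List.∈ walk v xs v
      uw∈ with linked (here refl)
      ... | inj₁ uw∈ = uw∈
      ... | inj₂ wu∈ = contradiction (predecessor pu∈ wu∈) p≢w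
      directed : ∀ {a b} → (a , b) List.∈ walk u (w ∷ s) v → (a , b) List.∈ walk v xs v
      directed (here refl) = uw∈
      directed (there ab∈) = walk-directed u w s uw∈ v∉ u! (linked ∘ there) ab∈

    -- Each vertex has only one successor on the cycle, so two walks along it from `u` cannot part,
    -- and neither can end before the other because `v` does not occur inside.
    walk-determined : ∀ u r s → All (v ≢_) r → All (v ≢_) s →
      (∀ {a b} → (a , b) List.∈ walk u r v → (a , b) List.∈ walk v xs v) →
      (∀ {a b} → (a , b) List.∈ walk u s v → (a , b) List.∈ walk v xs v) → r ≡ s
    walk-determined u []      []      v∉r v∉s r⊆ s⊆ = refl
    walk-determined u []      (w ∷ s) v∉r (v≢w ∷ _) r⊆ s⊆ =
      contradiction (successor (r⊆ (here refl)) (s⊆ (here refl))) v≢w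
    walk-determined u (w ∷ r) []      (v≢w ∷ _) v∉s r⊆ s⊆ =
      contradiction (successor (s⊆ (here refl)) (r⊆ (here refl))) v≢w
    walk-determined u (w ∷ r) (x ∷ s) (_ ∷ v∉r) (_ ∷ v∉s) r⊆ s⊆ with successor (r⊆ (here refl)) (s⊆ (here refl))
    ... | refl = cong (w ∷_) (walk-determined w r s v∉r v∉s (r⊆ ∘ there) (s⊆ ∘ there))

    -- `walk-directed` needs a previous vertex other than `v`, so the first two steps are oriented
    -- by hand: the first by assumption, the second because its reversal would make `y₂` a
    -- predecessor of `y₁` besides `v`.
    walk-same-orientation : ∀ y₁ y₂ ys → Unique (v ∷ y₁ ∷ y₂ ∷ ys) → (v , y₁) List.∈ walk v xs v →
      (∀ {a b} → (a , b) List.∈ walk v (y₁ ∷ y₂ ∷ ys) v → Linked v xs a b) → xs ≡ y₁ ∷ y₂ ∷ ys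
    walk-same-orientation y₁ y₂ ys (v∉@(_ ∷ v≢y₂ ∷ _) ∷ ys!) vy₁∈ linked =
      walk-determined v xs (y₁ ∷ y₂ ∷ ys) (ListAllPairs.head xs!) v∉ id directed
      where
      y₁y₂∈ : (y₁ , y₂) List.∈ walk v xs v
      y₁y₂∈ with linked (there (here refl))
      ... | inj₁ ∈walk = ∈walk
      ... | inj₂ ∈walk = contradiction (predecessor vy₁∈ ∈walk) v≢y₂
      directed : ∀ {a b} → (a , b) List.∈ walk v (y₁ ∷ y₂ ∷ ys) v → (a , b) List.∈ walk v xs v
      directed (here refl)         = vy₁∈
      directed (there (here refl)) = y₁y₂∈
      directed (there (there ab∈)) = walk-directed y₁ y₂ ys y₁y₂∈ v∉ ys! (linked ∘ there ∘ there) ab∈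

  -- The direction of the first step decides the whole walk; if it runs against `xs`, it runs along
  -- `reverse xs`.
  walk-two-orientations : {v : A} (xs : List A) → Unique (v ∷ xs) →
    ∀ y₁ y₂ ys → Unique (v ∷ y₁ ∷ y₂ ∷ ys) →
    (∀ {a b} → (a , b) List.∈ walk v (y₁ ∷ y₂ ∷ ys) v → Linked v xs a b) →
    xs ≡ y₁ ∷ y₂ ∷ ys ⊎ reverse xs ≡ y₁ ∷ y₂ ∷ ys
  walk-two-orientations {v = v} xs xs! y₁ y₂ ys ys! linked with linked (here refl)
  ... | inj₁ vy₁∈ = inj₁ (walk-same-orientation xs! y₁ y₂ ys ys! vy₁∈ linked)
  ... | inj₂ y₁v∈ = inj₂ (walk-same-orientation (unique-∷-reverse xs xs!) y₁ y₂ ys ys!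
                      (∈-walk-reverse v xs v y₁v∈) (linked-reverse v xs ∘ linked))

  -- In the reversal `x` comes last, behind at least one entry, so equality would repeat `x`. This
  -- keeps the two orientations of a cycle apart.
  reverse-≢ : (x y : A) (zs : List A) → Unique (x ∷ y ∷ zs) → x ∷ y ∷ zs ≢ reverse (x ∷ y ∷ zs)
  reverse-≢ x y zs (x∉ ∷ _) eq with reverse (y ∷ zs) | trans eq (List.unfold-reverse x (y ∷ zs))
  ... | []     | ()
  ... | r ∷ rs | eq′ = All.lookup x∉
      (subst (x List.∈_) (sym (List.∷-injectiveʳ eq′)) (List.∈-++⁺ʳ rs (here refl))) refl

  ∈-lists⁺ : (us : List (Fin n)) → us List.∈ lists n (length us)
  ∈-lists⁺ us = subst (List._∈ lists _ (length us)) (Vec.toList∘fromList us)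
    (List.∈-map⁺ toList (∈-vecs (Vec.fromList us)))
    where
    ∈-vecs : ∀ {l} (us : Vec (Fin _) l) → us List.∈ vecs (allFin _) l
    ∈-vecs []       = here refl
    ∈-vecs (u ∷ us) = List.∈-cartesianProductWith⁺ _∷_ (List.∈-allFin u) (∈-vecs us)

  ∈-lists⁻ : ∀ {l} {us : List (Fin n)} → us List.∈ lists n l → length us ≡ l
  ∈-lists⁻ us∈ with List.∈-map⁻ toList us∈
  ... | vs , _ , refl = Vec.length-toList vs

  lists-unique : ∀ n l → Unique (lists n l)
  lists-unique n l = Unique.map⁺
      (λ {xs ys} eq → trans (sym (Vec.cast-is-id refl xs)) (Vec.toList-injective refl xs ys eq)) (vecs-unique l)
    where
    vecs-unique : ∀ l → Unique (vecs (allFin n) l)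
    vecs-unique ℕ.zero    = [] ∷ []
    vecs-unique (ℕ.suc l) = Unique.cartesianProductWith⁺ _∷_ Vec.∷-injective (allFin⁺ n) (vecs-unique l)

  sequences-unique : ∀ n → Unique (sequences n)
  sequences-unique n = Unique.concat⁺ {xss = map (lists n) (upTo (ℕ.suc n))}
    (All.map⁺ {f = lists n} (All.tabulate {xs = upTo (ℕ.suc n)} λ {l} _ → lists-unique n l))
    (ListAllPairs.map⁺ {f = lists n} (ListAllPairs.map (λ {l} {m} → lists-disjoint l m) (upTo⁺ (ℕ.suc n))))
    where
    lists-disjoint : ∀ l m → l ≢ m → ListDisjoint.Disjoint (lists n l) (lists n m)
    lists-disjoint l m l≢m (us∈l , us∈m) = l≢m (trans (sym (∈-lists⁻ us∈l)) (∈-lists⁻ us∈m))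

  unique⇒length≤ : (us : List (Fin n)) → Unique us → length us ≤ n
  unique⇒length≤ {n} us us! = ℕ.≤-trans
    (subst (length us ≤_) (sym (size-∪-support ⊥ us us! (disjoint⁺ λ x∈ → contradiction x∈ Subset.∉⊥)))
        (ℕ.m≤m+n _ _))
    (size≤n {n} ⊥)

  -- Distinctness bounds the length by `n`, so the length bound of the enumeration misses no cycle
  -- sequence.
  ∈-sequences : (us : List (Fin n)) → Unique us → us List.∈ sequences n
  ∈-sequences us us! = List.∈-concat⁺′ (∈-lists⁺ us)
    (List.∈-map⁺ (lists _) (List.∈-upTo⁺ (s≤s (unique⇒length≤ us us!))))

  LinkedIn : List (Fin n) → Fin n → Fin n → Set
  LinkedIn us a b = (a , b) List.∈ cyclicSteps us ⊎ (b , a) List.∈ cyclicSteps us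

  linkedIn? : (us : List (Fin n)) (a b : Fin n) → Dec (LinkedIn us a b)
  linkedIn? us a b = ((a , b) ∈? cyclicSteps us) ⊎-dec ((b , a) ∈? cyclicSteps us)
    where open DecMembership (≡-dec Fin._≟_ Fin._≟_) using (_∈?_)

  trace-cong : (us vs : List (Fin n)) →
    (∀ {x} → x List.∈ us → x List.∈ vs) → (∀ {x} → x List.∈ vs → x List.∈ us) →
    (∀ {a b} → LinkedIn us a b → LinkedIn vs a b) → (∀ {a b} → LinkedIn vs a b → LinkedIn us a b) →
    trace us ≡ trace vs
  trace-cong us vs us⊆vs vs⊆us linked linked⁻¹ = cong₂ subgraph
    (Subset.⊆-antisym (∈-support⁺ ∘ us⊆vs ∘ ∈-support⁻ us) (∈-support⁺ ∘ vs⊆us ∘ ∈-support⁻ vs))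
    (Vec.tabulate-cong λ a → Vec.tabulate-cong λ b → Dec.does-⇔ (mk⇔ linked linked⁻¹) (linkedIn? us a b)
        (linkedIn? vs a b))

  trace-linked : (us vs : List (Fin n)) → trace us ≡ trace vs → ∀ {a b} → LinkedIn us a b → LinkedIn vs a b
  trace-linked us vs eq {a} {b} = transfer (linkedIn? us a b) (linkedIn? vs a b) (begin
    does (linkedIn? us a b)                       ≡⟨ entry us ⟨
    Vec.lookup (Vec.lookup (edges (trace us)) a) b  ≡⟨ cong (λ C → Vec.lookup (Vec.lookup (edges C) a) b) eq ⟩
    Vec.lookup (Vec.lookup (edges (trace vs)) a) b  ≡⟨ entry vs ⟩
    does (linkedIn? vs a b)                       ∎)
    where
    entry : ∀ ws → Vec.lookup (Vec.lookup (edges (trace ws)) a) b ≡ does (linkedIn? ws a b)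
    entry ws = trans (cong (λ row → Vec.lookup row b) (Vec.lookup∘tabulate _ a)) (Vec.lookup∘tabulate _ b)
    transfer : {P Q : Set} (P? : Dec P) (Q? : Dec Q) → does P? ≡ does Q? → P → Q
    transfer (yes _) (yes q) _  _ = q
    transfer (no ¬p) _       _  p = contradiction p ¬p

  cyclicSteps-∷ : (v : A) (ws : List A) → cyclicSteps {A} (v ∷ ws) ≡ walk v ws v
  cyclicSteps-∷ v ws = zip-walk v ws v

  -- Cutting at `v` and exchanging the two pieces rotates vertices and steps alike. Equality up to
  -- `↭` is enough, since being a 4k-cycle sequence and the trace do not depend on the order of
  -- either list.
  rotate : {v : A} {us : List A} → v List.∈ us →
           ∃ λ ws → us ↭ v ∷ ws × cyclicSteps us ↭ cyclicSteps (v ∷ ws)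
  rotate {A} {v = v} v∈ with List.∈-∃++ v∈
  ... | []     , bs , refl = bs , ↭-refl , ↭-refl
  ... | a ∷ as , bs , refl = bs ++ a ∷ as , ++-comm (a ∷ as) (v ∷ bs) , ↭-trans
    (↭-reflexive (trans (cyclicSteps-∷ a (as ++ v ∷ bs)) (walk-++ a as v bs a)))
    (↭-trans (++-comm (walk a as v) (walk v bs a))
      (↭-reflexive (sym (trans (cyclicSteps-∷ v (bs ++ a ∷ as)) (walk-++ v bs a as v)))))

  -- Counting the sequences that trace a given 4k-cycle

  module CycleCount (H : Graph n) where

    open Graph H
    open CycleExpansion H

    is4k-rotate : ∀ {us vs} → us ↭ vs → cyclicSteps us ↭ cyclicSteps vs → Is4kCycleSequence H us → Is4kCycleSequence H vs
    is4k-rotate us↭vs steps↭ (us! , es , 0<l , 4∣l) =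
      unique-↭ us↭vs us! , All-resp-↭ steps↭ es , subst (0 <_) (↭-length us↭vs) 0<l , subst (4 ∣_)
          (↭-length us↭vs) 4∣l

    trace-rotate : {us vs : List (Fin n)} → us ↭ vs → cyclicSteps us ↭ cyclicSteps vs → trace us ≡ trace vs
    trace-rotate us↭vs steps↭ = trace-cong _ _ (∈-resp-↭ us↭vs) (∈-resp-↭ (↭-sym us↭vs))
      (Sum.map (∈-resp-↭ steps↭) (∈-resp-↭ steps↭))
      (Sum.map (∈-resp-↭ (↭-sym steps↭)) (∈-resp-↭ (↭-sym steps↭)))

    linked⇒linkedIn : ∀ (v : Fin n) ws {a b} → Linked v ws a b → LinkedIn (v ∷ ws) a b
    linked⇒linkedIn v ws {a} {b} = subst (λ l → (a , b) List.∈ l ⊎ (b , a) List.∈ l) (sym (cyclicSteps-∷ v ws))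

    linkedIn⇒linked : ∀ (v : Fin n) ws {a b} → LinkedIn (v ∷ ws) a b → Linked v ws a b
    linkedIn⇒linked v ws {a} {b} = subst (λ l → (a , b) List.∈ l ⊎ (b , a) List.∈ l) (cyclicSteps-∷ v ws)

    is4k-reverse : ∀ v ws → Is4kCycleSequence H (v ∷ ws) → Is4kCycleSequence H (v ∷ reverse ws)
    is4k-reverse v ws (us! , es , 0<l , 4∣l) =
      unique-∷-reverse ws us! ,
      subst (All (uncurry _∼_)) (sym (trans (cyclicSteps-∷ v (reverse ws)) (walk-reverse v ws v)))
        (All.map⁺ (All-resp-↭ (↭-sym (↭-reverse (walk v ws v)))
            (All.map symm (subst (All (uncurry _∼_)) (cyclicSteps-∷ v ws) es)))) ,
      s≤s z≤n , subst (4 ∣_) (cong ℕ.suc (sym (List.length-reverse ws))) 4∣l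

    trace-reverse : ∀ (v : Fin n) ws → trace (v ∷ ws) ≡ trace (v ∷ reverse ws)
    trace-reverse v ws = trace-cong _ _
      (∈-resp-↭ (prep v (↭-sym (↭-reverse ws)))) (∈-resp-↭ (prep v (↭-reverse ws)))
      (linked⇒linkedIn v (reverse ws) ∘ linked-reverse v ws ∘ linkedIn⇒linked v ws)
      (λ {a} {b} → linked⇒linkedIn v ws ∘ subst (λ l → Linked v l a b)
          (List.reverse-involutive ws) ∘ linked-reverse v (reverse ws) ∘ linkedIn⇒linked v (reverse ws))

    -- Divisibility by four rules out lengths one and two. The two further vertices matter: on a
    -- single edge both orientations would be the same sequence.
    cycle-shape : ∀ v ws → Is4kCycleSequence H (v ∷ ws) → ∃ λ x → ∃₂ λ y zs → ws ≡ x ∷ y ∷ zs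
    cycle-shape v []           (_ , _ , _ , 4∣l) = contradiction (∣⇒≤ 4∣l) λ { (s≤s ()) }
    cycle-shape v (x ∷ [])     (_ , _ , _ , 4∣l) = contradiction (∣⇒≤ 4∣l) λ { (s≤s (s≤s ())) }
    cycle-shape v (x ∷ y ∷ zs) _                 = x , y , zs , refl

    cycleSequences : List (List (Fin n))
    cycleSequences = filter (is4kCycleSequence? H) (sequences n)

    ∈-cycleSequences : ∀ {us} → Is4kCycleSequence H us → us List.∈ cycleSequences
    ∈-cycleSequences c@(us! , _) = List.∈-filter⁺ (is4kCycleSequence? H) (∈-sequences _ us!) c

    ∈-fourKCycles⁺ : ∀ {C} → Is4kCycle H C → C List.∈ fourKCycles H
    ∈-fourKCycles⁺ (us , c , refl) = List.∈-deduplicate⁺ _≟ˢ_ (List.∈-map⁺ trace (∈-cycleSequences c))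

    ∈-fourKCycles⁻ : ∀ {C} → C List.∈ fourKCycles H → Is4kCycle H C
    ∈-fourKCycles⁻ C∈ with List.∈-map⁻ trace (List.∈-deduplicate⁻ _≟ˢ_ (map trace cycleSequences) C∈)
    ... | us , us∈ , refl = us , proj₂ (List.∈-filter⁻ (is4kCycleSequence? H) {xs = sequences n} us∈) , refl

    cycle-nonempty : ∀ {C} → Is4kCycle H C → Nonempty (vertices C)
    cycle-nonempty (u ∷ us , _                , refl) = u , ∈-support⁺ {us = u ∷ us} (here refl)
    cycle-nonempty ([]     , (_ , _ , () , _) , refl)

    headed? : (v : Fin n) (us : List (Fin n)) → Dec (head us ≡ just v)
    headed? v us = Maybe.≡-dec Fin._≟_ (head us) (just v)

    list-≟ : (us vs : List (Fin n)) → Dec (us ≡ vs)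
    list-≟ = List.≡-dec Fin._≟_

    -- Rotated to start at `v`, a cycle through `v` can be traversed only forwards and backwards,
    -- and the two directions give different sequences.
    count-sequences : ∀ v R → R List.∈ fourKCycles H →
      ∑ cycleSequences (λ us → ⟦ headed? v us ⟧ * ⟦ trace us ≟ˢ R ⟧) ≡ (1ℤ + 1ℤ) * ⟦ v Subset.∈? vertices R ⟧
    count-sequences v R R∈ with ∈-fourKCycles⁻ R∈
    count-sequences v .(trace us₀) R∈ | us₀ , c₀ , refl with v Subset.∈? support us₀
    ... | no v∉ = trans (∑-null cycleSequences λ us _ → trans
        (sym (⟦⟧-× (headed? v us) (trace us ≟ˢ trace us₀)))
                    (⟦⟧-no (headed? v us ×-dec trace us ≟ˢ trace us₀) λ (h , t) → v∉
                        (subst (v ∈_) (cong vertices t) (∈-headed us h))))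
                  (sym (zeroʳ _))
      where
      ∈-headed : ∀ us → head us ≡ just v → v ∈ support us
      ∈-headed (u ∷ us) refl = ∈-support⁺ {us = u ∷ us} (here refl)
    -- The sequence witnessing that `R` is a 4k-cycle starts anywhere; its rotation to `v` becomes
    -- `forth`.
    ... | yes v∈ with rotate (∈-support⁻ us₀ v∈)
    ... | ws , us₀↭ , steps↭ with is4k-rotate us₀↭ steps↭ c₀ | trace-rotate us₀↭ steps↭
    ... | c | t with cycle-shape v ws c
    ... | x , y , zs , refl = begin
      ∑ cycleSequences (λ us → ⟦ headed? v us ⟧ * ⟦ trace us ≟ˢ trace us₀ ⟧)
        ≡⟨ ∑-cong∈ cycleSequences (λ us us∈ → pointwise us
            (proj₂ (List.∈-filter⁻ (is4kCycleSequence? H) {xs = sequences n} us∈))) ⟩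
      ∑ cycleSequences (λ us → ⟦ list-≟ us forth ⟧ + ⟦ list-≟ us back ⟧)
        ≡⟨ ∑-+ cycleSequences _ _ ⟩
      ∑ cycleSequences (λ us → ⟦ list-≟ us forth ⟧) + ∑ cycleSequences (λ us → ⟦ list-≟ us back ⟧)
        ≡⟨ cong₂ _+_ (single forth c) (single back (is4k-reverse v (x ∷ y ∷ zs) c)) ⟩
      1ℤ + 1ℤ
        ≡⟨ unit (1ℤ + 1ℤ) ⟩
      (1ℤ + 1ℤ) * 1ℤ ∎
      where
      forth back : List (Fin n)
      forth = v ∷ x ∷ y ∷ zs
      back = v ∷ reverse (x ∷ y ∷ zs)
      opaque
        unfolding _+_ _*_
        unit : ∀ a → a ≡ a * 1ℤ
        unit = solve-∀
      single : ∀ vs → Is4kCycleSequence H vs → ∑ cycleSequences (λ us → ⟦ list-≟ us vs ⟧) ≡ 1ℤ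
      single vs cvs = trans
        (∑-single (Unique.filter⁺ (is4kCycleSequence? H) (sequences-unique n)) (∈-cycleSequences cvs)
          {λ us → ⟦ list-≟ us vs ⟧} (λ us us≢vs → ⟦⟧-no (list-≟ us vs) us≢vs))
        (⟦⟧-yes (list-≟ vs vs) refl)
      forth≢back : forth ≢ back
      forth≢back eq = reverse-≢ x y zs (ListAllPairs.tail (proj₁ c)) (List.∷-injectiveʳ eq)
      orientations : ∀ us → Is4kCycleSequence H us → head us ≡ just v → trace us ≡ trace us₀ → us ≡ forth ⊎ us ≡ back
      orientations (u ∷ us) cu refl tu with cycle-shape u us cu
      ... | x′ , y′ , zs′ , refl = Sum.map (cong (v ∷_) ∘ sym) (cong (v ∷_) ∘ sym)
        (walk-two-orientations (x ∷ y ∷ zs) (proj₁ c) x′ y′ zs′ (proj₁ cu)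
          (λ ab∈ → linkedIn⇒linked v (x ∷ y ∷ zs)
              (trace-linked (u ∷ us) forth (trans tu t) (linked⇒linkedIn u us (inj₁ ab∈)))))
      exclusive : ∀ us → ⟦ list-≟ us forth ⟧ + ⟦ list-≟ us back ⟧ ≡ ⟦ list-≟ us forth ⊎-dec list-≟ us back ⟧
      exclusive us with list-≟ us forth | list-≟ us back
      ... | yes p | yes q = contradiction (trans (sym p) q) forth≢back
      ... | yes p | no _  = +-identityʳ 1ℤ
      ... | no _  | yes q = +-identityˡ 1ℤ
      ... | no _  | no _  = +-identityˡ 0ℤ
      pointwise : ∀ us → Is4kCycleSequence H us →
        ⟦ headed? v us ⟧ * ⟦ trace us ≟ˢ trace us₀ ⟧ ≡ ⟦ list-≟ us forth ⟧ + ⟦ list-≟ us back ⟧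
      pointwise us cu = begin
        ⟦ headed? v us ⟧ * ⟦ trace us ≟ˢ trace us₀ ⟧
          ≡⟨ ⟦⟧-× (headed? v us) (trace us ≟ˢ trace us₀) ⟨
        ⟦ headed? v us ×-dec trace us ≟ˢ trace us₀ ⟧
          ≡⟨ ⟦⟧-cong (headed? v us ×-dec trace us ≟ˢ trace us₀) (list-≟ us forth ⊎-dec list-≟ us back)
               (λ (h , tu) → orientations us cu h tu)
               (λ { (inj₁ refl) → refl , sym t ; (inj₂ refl) → refl , sym
                   (trans t (trace-reverse v (x ∷ y ∷ zs))) }) ⟩
        ⟦ list-≟ us forth ⊎-dec list-≟ us back ⟧
          ≡⟨ exclusive us ⟨
        ⟦ list-≟ us forth ⟧ + ⟦ list-≟ us back ⟧ ∎

    -- Double counting of the pairs of a cycle `R` and a sequence from `v` that traces it: each `R`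
    -- through `v` has two such sequences, each sequence has one trace. The sum over cycles thus
    -- gets the index set of `cycle-expansion` and can be merged with it.
    ∑-fourKCycles : ∀ v (g : Subset n → ℤ) →
      (1ℤ + 1ℤ) * ∑ (fourKCycles H) (λ R → ⟦ v Subset.∈? vertices R ⟧ * g (vertices R)) ≡
      ∑ (sequences n) (λ us → ⟦ based? v us ⟧ * (⟦ 4 ∣? length us ⟧ * g (support us)))
    ∑-fourKCycles v g = begin
      (1ℤ + 1ℤ) * ∑ (fourKCycles H) (λ R → ⟦ v Subset.∈? vertices R ⟧ * g (vertices R))
        ≡⟨ ∑-*ˡ (1ℤ + 1ℤ) (fourKCycles H) _ ⟨
      ∑ (fourKCycles H) (λ R → (1ℤ + 1ℤ) * (⟦ v Subset.∈? vertices R ⟧ * g (vertices R)))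
        ≡⟨ ∑-cong∈ (fourKCycles H) (λ R R∈ → begin
             (1ℤ + 1ℤ) * (⟦ v Subset.∈? vertices R ⟧ * g (vertices R))
               ≡⟨ regroup (1ℤ + 1ℤ) _ _ ⟩
             g (vertices R) * ((1ℤ + 1ℤ) * ⟦ v Subset.∈? vertices R ⟧)
               ≡⟨ cong (g (vertices R) *_) (count-sequences v R R∈) ⟨
             g (vertices R) * ∑ cycleSequences (λ us → ⟦ headed? v us ⟧ * ⟦ trace us ≟ˢ R ⟧)
               ≡⟨ ∑-*ˡ (g (vertices R)) cycleSequences _ ⟨
             ∑ cycleSequences (λ us → g (vertices R) * (⟦ headed? v us ⟧ * ⟦ trace us ≟ˢ R ⟧)) ∎) ⟩
      ∑ (fourKCycles H) (λ R → ∑ cycleSequences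
          (λ us → g (vertices R) * (⟦ headed? v us ⟧ * ⟦ trace us ≟ˢ R ⟧)))
        ≡⟨ ∑-swap (fourKCycles H) cycleSequences _ ⟩
      ∑ cycleSequences (λ us → ∑ (fourKCycles H)
          (λ R → g (vertices R) * (⟦ headed? v us ⟧ * ⟦ trace us ≟ˢ R ⟧)))
        ≡⟨ ∑-cong∈ cycleSequences (λ us us∈ → ∑-single
             -- Deduplication makes the trace of `us` occur exactly once among the cycles.
             (deduplicate-! _≟ˢ_ (map trace cycleSequences))
             (List.∈-deduplicate⁺ _≟ˢ_ (List.∈-map⁺ trace us∈))
             {λ R → g (vertices R) * (⟦ headed? v us ⟧ * ⟦ trace us ≟ˢ R ⟧)}
             (λ R R≢ → trans (cong (λ s → g (vertices R) * (⟦ headed? v us ⟧ * s))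
                 (⟦⟧-no (trace us ≟ˢ R) (R≢ ∘ sym)))
                (trans (cong (g (vertices R) *_) (zeroʳ _)) (zeroʳ _)))) ⟩
      ∑ cycleSequences (λ us → g (support us) * (⟦ headed? v us ⟧ * ⟦ trace us ≟ˢ trace us ⟧))
        ≡⟨ ∑-filter (is4kCycleSequence? H) (sequences n) _ ⟩
      ∑ (sequences n) (λ us → ⟦ is4kCycleSequence? H us ⟧ *
          (g (support us) * (⟦ headed? v us ⟧ * ⟦ trace us ≟ˢ trace us ⟧)))
        ≡⟨ ∑-cong (sequences n) (λ us → begin
             ⟦ is4kCycleSequence? H us ⟧ * (g (support us) * (⟦ headed? v us ⟧ * ⟦ trace us ≟ˢ trace us ⟧))
               ≡⟨ cong (λ s → ⟦ is4kCycleSequence? H us ⟧ * (g (support us) * (⟦ headed? v us ⟧ * s)))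
                   (⟦⟧-yes (trace us ≟ˢ trace us) refl) ⟩
             ⟦ is4kCycleSequence? H us ⟧ * (g (support us) * (⟦ headed? v us ⟧ * 1ℤ))
               ≡⟨ collect _ _ _ ⟩
             (⟦ is4kCycleSequence? H us ⟧ * ⟦ headed? v us ⟧) * g (support us)
               ≡⟨ cong (_* g (support us)) (conditions us) ⟩
             (⟦ based? v us ⟧ * ⟦ 4 ∣? length us ⟧) * g (support us)
               ≡⟨ *-assoc _ _ _ ⟩
             ⟦ based? v us ⟧ * (⟦ 4 ∣? length us ⟧ * g (support us)) ∎) ⟩
      ∑ (sequences n) (λ us → ⟦ based? v us ⟧ * (⟦ 4 ∣? length us ⟧ * g (support us))) ∎
      where
      opaque
        unfolding _+_ _*_
        regroup : ∀ a b c → a * (b * c) ≡ c * (a * b)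
        regroup = solve-∀
        collect : ∀ a b c → a * (b * (c * 1ℤ)) ≡ (a * c) * b
        collect = solve-∀
      nonempty : ∀ us → head us ≡ just v → 0 < length us
      nonempty (u ∷ us) _ = s≤s z≤n
      conditions : ∀ us → ⟦ is4kCycleSequence? H us ⟧ * ⟦ headed? v us ⟧ ≡ ⟦ based? v us ⟧ * ⟦ 4 ∣? length us ⟧
      conditions us = begin
        ⟦ is4kCycleSequence? H us ⟧ * ⟦ headed? v us ⟧
          ≡⟨ ⟦⟧-× (is4kCycleSequence? H us) (headed? v us) ⟨
        ⟦ is4kCycleSequence? H us ×-dec headed? v us ⟧
          ≡⟨ ⟦⟧-cong (is4kCycleSequence? H us ×-dec headed? v us) (based? v us ×-dec 4 ∣? length us)
               (λ ((us! , es , _ , 4∣l) , h) → (h , us! , es) , 4∣l)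
               (λ ((h , us! , es) , 4∣l) → (us! , es , nonempty us h , 4∣l) , h) ⟩
        ⟦ based? v us ×-dec 4 ∣? length us ⟧
          ≡⟨ ⟦⟧-× (based? v us) (4 ∣? length us) ⟩
        ⟦ based? v us ⟧ * ⟦ 4 ∣? length us ⟧ ∎

  -- The recursion at a vertex

  -- Inductive in steps of two, to match the recursion of `halfSign` and the case analysis in
  -- `cycle-sign`.
  data Even : ℕ → Set where
    zero    : Even 0
    suc-suc : ∀ {k} → Even k → Even (2 ℕ.+ k)

  even-cancel : ∀ {a b} → Even a → Even (a ℕ.+ b) → Even b
  even-cancel zero        e           = e
  even-cancel (suc-suc a) (suc-suc e) = even-cancel a e

  even-+ : ∀ {a b} → Even a → Even b → Even (a ℕ.+ b)
  even-+ zero        b = b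
  even-+ (suc-suc a) b = suc-suc (even-+ a b)

  2∣⇒even : ∀ {k} → 2 ∣ k → Even k
  2∣⇒even (divides q refl) = double q
    where
    double : ∀ q → Even (q ℕ.* 2)
    double ℕ.zero    = zero
    double (ℕ.suc q) = suc-suc (double q)

  4∣⇒even : ∀ {k} → 4 ∣ k → Even k
  4∣⇒even (divides q refl) = quadruple q
    where
    quadruple : ∀ q → Even (q ℕ.* 4)
    quadruple ℕ.zero    = zero
    quadruple (ℕ.suc q) = suc-suc (suc-suc (quadruple q))

  -- halfSign (2 k) = (-1) ^ k; the values at odd arguments play no role.
  halfSign : ℕ → ℤ
  halfSign (ℕ.suc (ℕ.suc k)) = -1ℤ * halfSign k
  halfSign _                 = 1ℤ

  halfSign-+ : ∀ {a} → Even a → ∀ b → halfSign (a ℕ.+ b) ≡ halfSign a * halfSign b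
  halfSign-+ zero        b = sym (*-identityˡ _)
  halfSign-+ (suc-suc a) b = trans (cong (-1ℤ *_) (halfSign-+ a b)) (sym (*-assoc -1ℤ _ _))

  two : ℤ
  two = 1ℤ + 1ℤ

  opaque
    unfolding _+_ _*_

    -1*-1 : -1ℤ * -1ℤ ≡ 1ℤ
    -1*-1 = refl

    1*1 : 1ℤ * 1ℤ ≡ 1ℤ
    1*1 = refl

    two-cancel : ∀ i j → two * i ≡ two * j → i ≡ j
    two-cancel i j = ℤ.*-cancelˡ-≡ (ℤ.+ 2) i j

    -- A cycle of even length l > 0 contributes the sign (-1) ^ (l - 1) of its
    -- permutation, and twice as a 4k-cycle if 4 ∣ l: (-1) ^ (l / 2) in all.
    cycle-sign : ∀ {k} → Even k →
      -1ℤ ^ ℕ.suc k + two * ⟦ 4 ∣? 2 ℕ.+ k ⟧ ≡ halfSign (2 ℕ.+ k)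
    cycle-sign zero                  = refl
    cycle-sign (suc-suc zero)        = refl
    cycle-sign (suc-suc (suc-suc {k} e)) = begin
      -1ℤ ^ (5 ℕ.+ k) + two * ⟦ 4 ∣? 6 ℕ.+ k ⟧
        ≡⟨ cong₂ (λ s t → s + two * t) (fourfold (-1ℤ ^ ℕ.suc k))
             (⟦⟧-cong (4 ∣? 6 ℕ.+ k) (4 ∣? 2 ℕ.+ k) (λ d → ∣m+n∣m⇒∣n {4} {4} d ∣-refl) (∣m∣n⇒∣m+n ∣-refl)) ⟩
      -1ℤ ^ ℕ.suc k + two * ⟦ 4 ∣? 2 ℕ.+ k ⟧
        ≡⟨ cycle-sign e ⟩
      halfSign (2 ℕ.+ k)
        ≡⟨ twofold (halfSign (2 ℕ.+ k)) ⟨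
      halfSign (6 ℕ.+ k) ∎
      where
      fourfold : ∀ x → -1ℤ * (-1ℤ * (-1ℤ * (-1ℤ * x))) ≡ x
      fourfold = solve-∀
      twofold : ∀ x → -1ℤ * (-1ℤ * x) ≡ x
      twofold = solve-∀

  module _ (H : Graph n) (bipartite : Bipartite H) where

    open Graph H
    open CycleExpansion H
    private
      colour = proj₁ bipartite

    other-colour : {a b c : Bool} → a ≢ b → a ≢ c → b ≡ c
    other-colour {false} {false} {_}     a≢b a≢c = contradiction refl a≢b
    other-colour {false} {true}  {false} a≢b a≢c = contradiction refl a≢c
    other-colour {false} {true}  {true}  a≢b a≢c = refl
    other-colour {true}  {true}  {_}     a≢b a≢c = contradiction refl a≢b
    other-colour {true}  {false} {true}  a≢b a≢c = contradiction refl a≢c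
    other-colour {true}  {false} {false} a≢b a≢c = refl

    -- Colours alternate along a walk, so the parity of its length tells whether the colours of its
    -- ends agree.
    walk-parity : ∀ u ws v → All (uncurry _∼_) (walk u ws v) →
      (colour u ≡ colour v → Even (ℕ.suc (length ws))) × (colour u ≢ colour v → Even (length ws))
    walk-parity u []       v (e ∷ [])  = (λ eq → contradiction eq (proj₂ bipartite u v e)) , λ _ → zero
    walk-parity u (w ∷ ws) v (e ∷ es) with walk-parity w ws v es
    ... | same , different =
      (λ u≡v → suc-suc (different λ w≡v → u≢w (trans u≡v (sym w≡v)))) , λ u≢v → same (other-colour u≢w u≢v)
      where
      u≢w = proj₂ bipartite u w e

    -- A closed walk returns to its first colour, so its length is even and, being positive, at
    -- least two; `cycle-sign` expects it in this form.
    based-shape : ∀ v us → Based v us → ∃ λ k → Even k × length us ≡ 2 ℕ.+ k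
    based-shape v (v ∷ ws) (refl , _ , es) with length ws | proj₁
        (walk-parity v ws v (subst (All (uncurry _∼_)) (zip-walk v ws v) es)) refl
    ... | .(ℕ.suc _) | suc-suc {k} e = k , e , refl

  -- The condition `c-suc` expresses c z = c 0 * 4 ^ z / z! without division, and only up to `M`,
  -- where the integer multiples of the coefficients exist. The factor `z` in it absorbs the `z`
  -- positions at which the member through `v` can stand in an ordered tuple.
  module Identity (H : Graph n) (bipartite : Bipartite H)
                  (M : ℕ) (n<M : n < M)
                  (c : ℕ → ℤ) (c-suc : ∀ z → z < M → c (ℕ.suc z) * ℤ.+ ℕ.suc z ≡ (two * two) * c z) where

    open CycleExpansion H
    open CycleCount H
    open DisjointTuples (fourKCycles H) vertices (minor -1ℤ -1*-1)

    perMinor : Subset n → ℤ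
    perMinor = minor 1ℤ 1*1

    members-nonempty : ∀ R → R List.∈ fourKCycles H → Nonempty (vertices R)
    members-nonempty R R∈ = cycle-nonempty (∈-fourKCycles⁻ R∈)

    F : Subset n → ℤ
    F X = ∑ (upTo (ℕ.suc M)) (λ z → c z * τ z X)

    module _ (v : Fin n) (X : Subset n) (first : First v X) where

      private
        b s i : List (Fin n) → ℤ
        b us = ⟦ based? v us ⟧
        s us = -1ℤ ^ pred (length us)
        i us = ⟦ 4 ∣? length us ⟧

        t : ℕ → List (Fin n) → ℤ
        t z us = δ X (support us) * τ z (X ∪ support us)

        opaque
          unfolding _+_ _*_
          distribute : ∀ two c a z t → two * (c * (a + z * t)) ≡ two * (c * a) + (c * z) * (two * t)
          distribute = solve-∀
          combine : ∀ two c b s δ τ i → two * (c * ((b * s) * (δ * τ))) + (two * two) *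
              (c * (b * (i * (δ * τ)))) ≡
                                        two * (b * (δ * ((s + two * i) * (c * τ))))
          combine = solve-∀

        τ-recurrence : ∀ z → τ z X ≡ ∑ (sequences n) (λ us → (b us * s us) * t z us) + ℤ.+ z * τ-through v
            (pred z) X
        τ-recurrence z = τ-expansion v (sequences n) support (λ us → b us * s us)
          (λ us v∉ → trans (cong (_* s us) (⟦⟧-no (based? v us) λ { (h , _) → v∉ (headed us h) }))
              (zeroˡ (s us)))
          (λ Y Y-first → trans (cycle-expansion -1ℤ -1*-1 v Y Y-first)
              (∑-cong (sequences n) λ us → rearrange (b us) (δ Y (support us)) (s us) _))
          z X first
          where
          opaque
            unfolding _+_ _*_
            rearrange : ∀ b d s m → b * (d * (s * m)) ≡ (b * s) * (d * m)
            rearrange = solve-∀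
          headed : ∀ us → head us ≡ just v → v ∈ support us
          headed (u ∷ us) refl = ∈-support⁺ {us = u ∷ us} (here refl)

        through : ∀ z → two * τ-through v z X ≡ ∑ (sequences n) (λ us → b us * (i us * t z us))
        through z = ∑-fourKCycles v (λ R → δ X R * τ z (X ∪ R))

        through-null : ∑ (sequences n) (λ us → b us * (i us * t M us)) ≡ 0ℤ
        through-null = ∑-null (sequences n) λ us _ → trans
          (cong (λ s → b us * (i us * (δ X (support us) * s)))
            (τ-null members-nonempty M (X ∪ support us) (ℕ.≤-trans (s≤s (size≤n (X ∪ support us))) n<M)))
          (nulls (b us) (i us) (δ X (support us)))
          where
          opaque
            unfolding _+_ _*_
            nulls : ∀ a b c → a * (b * (c * 0ℤ)) ≡ 0ℤ
            nulls = solve-∀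

        -- Shifting z by one turns the tuples through v into a sum over z again.
        ∑-through : ∑ (upTo (ℕ.suc M)) (λ z → (c z * ℤ.+ z) * (two * τ-through v (pred z) X)) ≡
                    ∑ (upTo (ℕ.suc M)) (λ z → (two * two) *
                        (c z * ∑ (sequences n) (λ us → b us * (i us * t z us))))
        ∑-through = begin
          (c 0 * 0ℤ) * (two * τ-through v 0 X) + ∑ (List.applyUpTo ℕ.suc M)
              (λ z → (c z * ℤ.+ z) * (two * τ-through v (pred z) X))
            -- The factor `z` removes the term z = 0, whose index `pred 0` is only a default.
            ≡⟨ cong₂ _+_ (trans (cong (_* (two * τ-through v 0 X)) (zeroʳ (c 0))) (zeroˡ _))
                 (cong (λ zs → ∑ zs (λ z → (c z * ℤ.+ z) * (two * τ-through v (pred z) X)))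
                     (sym (List.map-applyUpTo id ℕ.suc M))) ⟩
          0ℤ + ∑ (map ℕ.suc (upTo M)) (λ z → (c z * ℤ.+ z) * (two * τ-through v (pred z) X))
            ≡⟨ trans (+-identityˡ _) (∑-map ℕ.suc (upTo M) _) ⟩
          ∑ (upTo M) (λ z → (c (ℕ.suc z) * ℤ.+ ℕ.suc z) * (two * τ-through v z X))
            ≡⟨ ∑-cong∈ (upTo M) (λ z z∈ → trans (cong₂ _*_ (c-suc z (List.∈-upTo⁻ z∈)) (through z))
                (*-assoc (two * two) (c z) _)) ⟩
          ∑ (upTo M) g
            ≡⟨ +-identityʳ _ ⟨
          ∑ (upTo M) g + 0ℤ
            -- After the shift the sum ends at M - 1. The missing term z = M can be added because
            -- `M` disjoint cycles exceed the `n` vertices.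
            ≡⟨ cong (∑ (upTo M) g +_) (sym
                (trans (+-identityʳ (g M)) (trans (cong (λ s → (two * two) * (c M * s)) through-null)
                (trans (cong ((two * two) *_) (zeroʳ (c M))) (zeroʳ _))))) ⟩
          ∑ (upTo M) g + (g M + 0ℤ)
            ≡⟨ ∑-++ (upTo M) (M ∷ []) g ⟨
          ∑ (upTo M List.∷ʳ M) g
            ≡⟨ cong (λ zs → ∑ zs g) (List.upTo-∷ʳ M) ⟩
          ∑ (upTo (ℕ.suc M)) g ∎
          where
          g : ℕ → ℤ
          g z = (two * two) * (c z * ∑ (sequences n) (λ us → b us * (i us * t z us)))

      -- Proved after doubling, because the two orientations express `two * τ-through` as a sum over
      -- sequences. The shift in `∑-through` brings a 4, and halving leaves the correction
      -- `two * i us` beside the sign `s us`.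
      F-recurrence : F X ≡ ∑ (sequences n)
          (λ us → b us * (δ X (support us) * ((s us + two * i us) * F (X ∪ support us))))
      F-recurrence = two-cancel _ _ (begin
        two * ∑ zs (λ z → c z * τ z X)
          ≡⟨ ∑-*ˡ two zs _ ⟨
        ∑ zs (λ z → two * (c z * τ z X))
          ≡⟨ ∑-cong zs (λ z → trans (cong (λ x → two * (c z * x)) (τ-recurrence z))
              (distribute two (c z) _ (ℤ.+ z) _)) ⟩
        ∑ zs (λ z → two * (c z * ∑ (sequences n) (λ us → (b us * s us) * t z us)) + (c z * ℤ.+ z) *
            (two * τ-through v (pred z) X))
          ≡⟨ ∑-+ zs _ _ ⟩
        ∑ zs (λ z → two * (c z * ∑ (sequences n) (λ us → (b us * s us) * t z us))) +
        ∑ zs (λ z → (c z * ℤ.+ z) * (two * τ-through v (pred z) X))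
          ≡⟨ cong (∑ zs (λ z → two * (c z * ∑ (sequences n) (λ us → (b us * s us) * t z us))) +_) ∑-through ⟩
        ∑ zs (λ z → two * (c z * ∑ (sequences n) (λ us → (b us * s us) * t z us))) +
        ∑ zs (λ z → (two * two) * (c z * ∑ (sequences n) (λ us → b us * (i us * t z us))))
          ≡⟨ ∑-+ zs _ _ ⟨
        ∑ zs (λ z → two * (c z * ∑ (sequences n) (λ us → (b us * s us) * t z us)) +
                    (two * two) * (c z * ∑ (sequences n) (λ us → b us * (i us * t z us))))
          ≡⟨ ∑-cong zs (λ z → trans (cong₂ _+_ (pull two (c z) _) (pull (two * two) (c z) _))
              (trans (sym (∑-+ (sequences n) _ _))
               (∑-cong (sequences n) λ us → combine two (c z) (b us) (s us) (δ X (support us))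
                   (τ z (X ∪ support us)) (i us)))) ⟩
        ∑ zs (λ z → ∑ (sequences n) (λ us → two *
            (b us * (δ X (support us) * ((s us + two * i us) * (c z * τ z (X ∪ support us)))))))
          ≡⟨ ∑-swap zs (sequences n) _ ⟩
        ∑ (sequences n) (λ us → ∑ zs (λ z → two *
            (b us * (δ X (support us) * ((s us + two * i us) * (c z * τ z (X ∪ support us)))))))
          ≡⟨ ∑-cong (sequences n) (λ us → trans (∑-*ˡ two zs _)
              (cong (two *_) (trans (∑-*ˡ (b us) zs _)
              (cong (b us *_) (trans (∑-*ˡ (δ X (support us)) zs _)
              (cong (δ X (support us) *_) (∑-*ˡ (s us + two * i us) zs _))))))) ⟩
        ∑ (sequences n) (λ us → two * (b us * (δ X (support us) * ((s us + two * i us) * F (X ∪ support us)))))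
          ≡⟨ ∑-*ˡ two (sequences n) _ ⟩
        two * ∑ (sequences n) (λ us → b us * (δ X (support us) * ((s us + two * i us) * F (X ∪ support us)))) ∎)
        where
        zs = upTo (ℕ.suc M)
        pull : ∀ x y (f : List (Fin n) → ℤ) → x * (y * ∑ (sequences n) f) ≡ ∑ (sequences n)
            (λ us → x * (y * f us))
        pull x y f = sym (trans (∑-*ˡ x (sequences n) _) (cong (x *_) (∑-*ˡ y (sequences n) f)))

    -- With all vertices deleted only the empty tuple fits, and its determinant is the empty one.
    F-⊤ : F ⊤ ≡ c 0
    F-⊤ = begin
      c 0 * minor -1ℤ -1*-1 ⊤ + ∑ (List.applyUpTo ℕ.suc M) (λ z → c z * τ z ⊤)
        ≡⟨ cong₂ _+_ (cong (λ vs → c 0 * immanant -1ℤ (adjacency H) vs vs) (free-⊤ n))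
             (∑-null (List.applyUpTo ℕ.suc M) λ z z∈ → trans (cong (c z *_) (vanish z z∈)) (zeroʳ (c z))) ⟩
      c 0 * 1ℤ + 0ℤ
        ≡⟨ units (c 0) ⟩
      c 0 ∎
      where
      opaque
        unfolding _+_ _*_
        units : ∀ a → a * 1ℤ + 0ℤ ≡ a
        units = solve-∀
      vanish : ∀ z → z List.∈ List.applyUpTo ℕ.suc M → τ z ⊤ ≡ 0ℤ
      vanish z z∈ with List.∈-applyUpTo⁻ ℕ.suc z∈
      ... | k , _ , refl = τ-null members-nonempty (ℕ.suc k) ⊤ (subst (_< ℕ.suc k) (sym (size-⊤ n)) (s≤s z≤n))

    -- Both sides obey the same recursion at the first remaining vertex: `cycle-sign` turns the
    -- coefficient for a sequence into `halfSign` of its length, and `halfSign` is multiplicative on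
    -- even numbers. Deleting an even cycle keeps the size even, so the induction can go on; `k`
    -- bounds the shrinking size.
    F-permanent : ∀ k X → size X < k → Even (size X) → F X ≡ c 0 * (halfSign (size X) * perMinor X)
    F-permanent (ℕ.suc k) X (s≤s size≤k) even with first⊎⊤ X
    ... | inj₂ refl = trans F-⊤ (sym (begin
      c 0 * (halfSign (size (⊤ {n})) * perMinor ⊤)
        ≡⟨ cong₂ (λ l vs → c 0 * (halfSign l * immanant 1ℤ (adjacency H) vs vs)) (size-⊤ n) (free-⊤ n) ⟩
      c 0 * (1ℤ * 1ℤ)
        ≡⟨ units (c 0) ⟩
      c 0 ∎))
      where
      opaque
        unfolding _+_ _*_
        units : ∀ a → a * (1ℤ * 1ℤ) ≡ a
        units = solve-∀
    ... | inj₁ (v , first) = begin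
      F X
        ≡⟨ F-recurrence v X first ⟩
      ∑ (sequences n) (λ us → ⟦ based? v us ⟧ *
          (δ X (support us) * ((-1ℤ ^ pred (length us) + two * ⟦ 4 ∣? length us ⟧) * F (X ∪ support us))))
        ≡⟨ ∑-cong (sequences n) (λ us → trans
             (⟦⟧-absorb (based? v us) (λ based → trans
                 (⟦⟧-absorb (disjoint? X (support us)) (step us based)) (out (δ X (support us)) κ _)))
             (out ⟦ based? v us ⟧ κ _)) ⟩
      ∑ (sequences n) (λ us → κ * (⟦ based? v us ⟧ *
          (δ X (support us) * (1ℤ ^ pred (length us) * perMinor (X ∪ support us)))))
        ≡⟨ ∑-*ˡ κ (sequences n) _ ⟩
      κ * ∑ (sequences n) (λ us → ⟦ based? v us ⟧ *
          (δ X (support us) * (1ℤ ^ pred (length us) * perMinor (X ∪ support us))))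
        ≡⟨ cong (κ *_) (cycle-expansion 1ℤ 1*1 v X first) ⟨
      κ * perMinor X
        ≡⟨ *-assoc (c 0) _ _ ⟩
      c 0 * (halfSign (size X) * perMinor X) ∎
      where
      κ : ℤ
      κ = c 0 * halfSign (size X)
      opaque
        unfolding _+_ _*_
        out : ∀ a k x → a * (k * x) ≡ k * (a * x)
        out = solve-∀
        assemble : ∀ h c h′ p → h * (c * (h′ * p)) ≡ (c * (h * h′)) * (1ℤ * p)
        assemble = solve-∀
      step : ∀ us → Based v us → Disjoint X (support us) →
             (-1ℤ ^ pred (length us) + two * ⟦ 4 ∣? length us ⟧) * F (X ∪ support us) ≡
             κ * (1ℤ ^ pred (length us) * perMinor (X ∪ support us))
      step us based@(_ , us! , _) d with based-shape H bipartite v us based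
      ... | j , j-even , length≡ = begin
        (-1ℤ ^ pred (length us) + two * ⟦ 4 ∣? length us ⟧) * F X′
          ≡⟨ cong (λ l → (-1ℤ ^ pred l + two * ⟦ 4 ∣? l ⟧) * F X′) length≡ ⟩
        (-1ℤ ^ ℕ.suc j + two * ⟦ 4 ∣? 2 ℕ.+ j ⟧) * F X′
          ≡⟨ cong₂ _*_ (cycle-sign j-even)
              (F-permanent k X′ size<k (even-cancel (suc-suc j-even) (subst Even size≡ even))) ⟩
        halfSign (2 ℕ.+ j) * (c 0 * (halfSign (size X′) * perMinor X′))
          ≡⟨ assemble (halfSign (2 ℕ.+ j)) (c 0) _ _ ⟩
        (c 0 * (halfSign (2 ℕ.+ j) * halfSign (size X′))) * (1ℤ * perMinor X′)
          ≡⟨ cong₂ (λ h p → (c 0 * h) * (p * perMinor X′))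
               (trans (sym (halfSign-+ (suc-suc j-even) (size X′))) (cong halfSign (sym size≡)))
               (sym (1^ (pred (length us)))) ⟩
        κ * (1ℤ ^ pred (length us) * perMinor X′) ∎
        where
        X′ = X ∪ support us
        size≡ : size X ≡ 2 ℕ.+ j ℕ.+ size X′
        size≡ = trans (size-∪-support X us us! d) (cong (ℕ._+ size X′) length≡)
        size<k : size X′ < k
        size<k = ℕ.≤-trans (s≤s (ℕ.m≤n+m (size X′) j)) (ℕ.≤-trans (ℕ.n≤1+n _) (subst (_≤ k) size≡ size≤k))

  -- Clearing denominators

  fromℚᵘ-homo-+ : ∀ p q → ℚ.fromℚᵘ p ℚ.+ ℚ.fromℚᵘ q ≡ ℚ.fromℚᵘ (p ℚᵘ.+ q)
  fromℚᵘ-homo-+ p q = trans (sym (ℚ.fromℚᵘ-toℚᵘ _)) (ℚ.fromℚᵘ-cong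
    (ℚᵘ.≃-trans (ℚ.toℚᵘ-homo-+ (ℚ.fromℚᵘ p) (ℚ.fromℚᵘ q)) (ℚᵘ.+-cong (ℚ.toℚᵘ-fromℚᵘ p) (ℚ.toℚᵘ-fromℚᵘ q))))

  fromℚᵘ-homo-* : ∀ p q → ℚ.fromℚᵘ p ℚ.* ℚ.fromℚᵘ q ≡ ℚ.fromℚᵘ (p ℚᵘ.* q)
  fromℚᵘ-homo-* p q = trans (sym (ℚ.fromℚᵘ-toℚᵘ _)) (ℚ.fromℚᵘ-cong
    (ℚᵘ.≃-trans (ℚ.toℚᵘ-homo-* (ℚ.fromℚᵘ p) (ℚ.fromℚᵘ q)) (ℚᵘ.*-cong (ℚ.toℚᵘ-fromℚᵘ p) (ℚ.toℚᵘ-fromℚᵘ q))))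

  fromℤ-injective : ∀ i j → fromℤ i ≡ fromℤ j → i ≡ j
  fromℤ-injective i j eq with ℚ.fromℚᵘ-injective {mkℚᵘ i 0} {mkℚᵘ j 0} eq
  ... | *≡* i≡j = trans (sym (ℤ.*-identityʳ i)) (trans i≡j (ℤ.*-identityʳ j))

  opaque
    unfolding _+_ _*_

    fromℤ-+ : ∀ i j → fromℤ (i + j) ≡ fromℤ i ℚ.+ fromℤ j
    fromℤ-+ i j = sym (trans (fromℚᵘ-homo-+ (mkℚᵘ i 0) (mkℚᵘ j 0))
        (ℚ.fromℚᵘ-cong {mkℚᵘ i 0 ℚᵘ.+ mkℚᵘ j 0} {mkℚᵘ (i + j) 0} (*≡* (eq i j))))
      where
      eq : ∀ i j → (i * 1ℤ + j * 1ℤ) * 1ℤ ≡ (i + j) * 1ℤ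
      eq = solve-∀

    fromℤ-* : ∀ i j → fromℤ (i * j) ≡ fromℤ i ℚ.* fromℤ j
    fromℤ-* i j = sym (fromℚᵘ-homo-* (mkℚᵘ i 0) (mkℚᵘ j 0))

    fromℤ-*-/ : ∀ k a b d .{{_ : ℕ.NonZero d}} → k * a ≡ b * ℤ.+ d → fromℤ k ℚ.* (a ℚ./ d) ≡ fromℤ b
    fromℤ-*-/ k a b (ℕ.suc d) eq = trans (fromℚᵘ-homo-* (mkℚᵘ k 0) (mkℚᵘ a d))
      (ℚ.fromℚᵘ-cong {mkℚᵘ k 0 ℚᵘ.* mkℚᵘ a d} {mkℚᵘ b 0}
          (*≡* (trans (ℤ.*-identityʳ (k * a))
          (trans eq (cong (λ e → b * ℤ.+ e) (sym (ℕ.+-identityʳ (ℕ.suc d))))))))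

  fromℤ-*-cancelˡ : ∀ k .{{_ : ℕ.NonZero k}} p q → fromℤ (ℤ.+ k) ℚ.* p ≡ fromℤ (ℤ.+ k) ℚ.* q → p ≡ q
  fromℤ-*-cancelˡ k p q eq = ℚ.≤-antisym
    (ℚ.*-cancelˡ-≤-pos (fromℤ (ℤ.+ k)) (ℚ.≤-reflexive eq))
    (ℚ.*-cancelˡ-≤-pos (fromℤ (ℤ.+ k)) (ℚ.≤-reflexive (sym eq)))
    where instance _ = ℚ.normalize-pos k 1

  -- (z + 1) (z + 2) ⋯ (z + d) = (z + d)! / z!
  rising : ℕ → ℕ → ℕ
  rising z ℕ.zero    = 1
  rising z (ℕ.suc d) = ℕ.suc z ℕ.* rising (ℕ.suc z) d

  !-rising : ∀ z d → z ! ℕ.* rising z d ≡ (z ℕ.+ d) !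
  !-rising z ℕ.zero    = trans (ℕ.*-identityʳ (z !)) (cong _! (sym (ℕ.+-identityʳ z)))
  !-rising z (ℕ.suc d) = begin
    z ! ℕ.* (ℕ.suc z ℕ.* rising (ℕ.suc z) d)  ≡⟨ ℕ.*-assoc (z !) (ℕ.suc z) _ ⟨
    (z ! ℕ.* ℕ.suc z) ℕ.* rising (ℕ.suc z) d  ≡⟨ cong (ℕ._* rising (ℕ.suc z) d) (ℕ.*-comm (z !) (ℕ.suc z)) ⟩
    (ℕ.suc z) ! ℕ.* rising (ℕ.suc z) d        ≡⟨ !-rising (ℕ.suc z) d ⟩
    (ℕ.suc z ℕ.+ d) !                         ≡⟨ cong _! (ℕ.+-suc z d) ⟨
    (z ℕ.+ ℕ.suc d) !                         ∎

  -- M! 4ᶻ / z!, which is integral for z ≤ M.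
  integerCoefficient : ℕ → ℕ → ℤ
  integerCoefficient M z = ℤ.+ (4 ℕ.^ z ℕ.* rising z (M ∸ z))

  opaque
    unfolding _+_ _*_

    integerCoefficient-suc : ∀ M z → z < M →
      integerCoefficient M (ℕ.suc z) * ℤ.+ ℕ.suc z ≡ (two * two) * integerCoefficient M z
    integerCoefficient-suc M z z<M = begin
      ℤ.+ (4 ℕ.^ ℕ.suc z ℕ.* r) * ℤ.+ ℕ.suc z
        ≡⟨ ℤ.pos-* (4 ℕ.^ ℕ.suc z ℕ.* r) (ℕ.suc z) ⟨
      ℤ.+ ((4 ℕ.* 4 ℕ.^ z) ℕ.* r ℕ.* ℕ.suc z)
        ≡⟨ cong ℤ.+_ (trans (ℕ.*-assoc (4 ℕ.* 4 ℕ.^ z) r (ℕ.suc z))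
            (trans (ℕ.*-assoc 4 (4 ℕ.^ z) _) (cong (λ x → 4 ℕ.* (4 ℕ.^ z ℕ.* x)) (ℕ.*-comm r (ℕ.suc z))))) ⟩
      ℤ.+ (4 ℕ.* (4 ℕ.^ z ℕ.* rising z (ℕ.suc (M ∸ ℕ.suc z))))
        ≡⟨ cong (λ d → ℤ.+ (4 ℕ.* (4 ℕ.^ z ℕ.* rising z d))) (sym (ℕ.+-∸-assoc 1 z<M)) ⟩
      ℤ.+ (4 ℕ.* (4 ℕ.^ z ℕ.* rising z (M ∸ z)))
        ≡⟨ ℤ.pos-* 4 (4 ℕ.^ z ℕ.* rising z (M ∸ z)) ⟩
      (two * two) * integerCoefficient M z ∎
      where
      r : ℕ
      r = rising (ℕ.suc z) (M ∸ ℕ.suc z)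

    integerCoefficient-! : ∀ M z → z ≤ M → ℤ.+ (M !) * ℤ.+ (4 ℕ.^ z) ≡ integerCoefficient M z * ℤ.+ (z !)
    integerCoefficient-! M z z≤M = begin
      ℤ.+ (M !) * ℤ.+ (4 ℕ.^ z)
        ≡⟨ ℤ.pos-* (M !) (4 ℕ.^ z) ⟨
      ℤ.+ (M ! ℕ.* 4 ℕ.^ z)
        ≡⟨ cong ℤ.+_ (begin
             M ! ℕ.* 4 ℕ.^ z
               ≡⟨ ℕ.*-comm (M !) (4 ℕ.^ z) ⟩
             4 ℕ.^ z ℕ.* M !
               ≡⟨ cong (λ k → 4 ℕ.^ z ℕ.* k !) (ℕ.m+[n∸m]≡n z≤M) ⟨
             4 ℕ.^ z ℕ.* (z ℕ.+ (M ∸ z)) !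
               ≡⟨ cong (4 ℕ.^ z ℕ.*_) (trans (sym (!-rising z (M ∸ z))) (ℕ.*-comm (z !) _)) ⟩
             4 ℕ.^ z ℕ.* (rising z (M ∸ z) ℕ.* z !)
               ≡⟨ ℕ.*-assoc (4 ℕ.^ z) _ (z !) ⟨
             4 ℕ.^ z ℕ.* rising z (M ∸ z) ℕ.* z ! ∎) ⟩
      ℤ.+ (4 ℕ.^ z ℕ.* rising z (M ∸ z) ℕ.* z !)
        ≡⟨ ℤ.pos-* (4 ℕ.^ z ℕ.* rising z (M ∸ z)) (z !) ⟩
      integerCoefficient M z * ℤ.+ (z !) ∎

    integerCoefficient-cancel : ∀ M z t → z ≤ M → integerCoefficient M z * t ≡ 0ℤ → t ≡ 0ℤ
    integerCoefficient-cancel M z t z≤M eq = ℤ.*-cancelˡ-≡ (integerCoefficient M z) t 0ℤ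
        (trans eq (sym (ℤ.*-zeroʳ (integerCoefficient M z))))
      where
      instance
        _ : ℕ.NonZero (4 ℕ.^ z ℕ.* rising z (M ∸ z))
        _ = ℕ.m*n≢0 (4 ℕ.^ z) (rising z (M ∸ z)) {{ℕ.m^n≢0 4 z}} {{rising≢0 z (M ∸ z)}}
          where
          rising≢0 : ∀ z d → ℕ.NonZero (rising z d)
          rising≢0 z ℕ.zero    = _
          rising≢0 z (ℕ.suc d) = ℕ.m*n≢0 (ℕ.suc z) (rising (ℕ.suc z) d) {{_}} {{rising≢0 (ℕ.suc z) d}}

    integerCoefficient-0 : ∀ M → integerCoefficient M 0 ≡ ℤ.+ (M !)
    integerCoefficient-0 M = cong ℤ.+_
        (trans (ℕ.*-identityˡ (rising 0 M)) (trans (sym (ℕ.*-identityˡ (rising 0 M))) (!-rising 0 M)))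

  halfSign-square : ∀ k → halfSign k * halfSign k ≡ 1ℤ
  halfSign-square 0                       = 1*1
  halfSign-square 1                       = 1*1
  halfSign-square (ℕ.suc (ℕ.suc k)) = trans (negate (halfSign k)) (halfSign-square k)
    where
    opaque
      unfolding _+_ _*_
      negate : ∀ x → (-1ℤ * x) * (-1ℤ * x) ≡ x * x
      negate = solve-∀

  halfSign-/2 : ∀ {k} → 2 ∣ k → -1ℤ ℤ.^ (k ℕ./ 2) ≡ halfSign k
  halfSign-/2 (divides q refl) = trans (cong (-1ℤ ℤ.^_) (ℕ.m*n/n≡m q 2)) (trans (^-ℤ -1ℤ q) (double q))
    where
    double : ∀ q → -1ℤ ^ q ≡ halfSign (q ℕ.* 2)
    double ℕ.zero    = refl
    double (ℕ.suc q) = cong (-1ℤ *_) (double q)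

  expansion-clear : ∀ M (t : ℕ → ℤ) (zs : List ℕ) → (∀ z → z List.∈ zs → z ≤ M) →
    fromℤ (ℤ.+ (M !)) ℚ.* sumℚ (map (λ z → coefficient z ℚ.* fromℤ (t z)) zs) ≡
    fromℤ (∑ zs (λ z → integerCoefficient M z * t z))
  expansion-clear M t []       z≤M = ℚ.*-zeroʳ (fromℤ (ℤ.+ (M !)))
  expansion-clear M t (z ∷ zs) z≤M = begin
    K ℚ.* (coefficient z ℚ.* fromℤ (t z) ℚ.+ rest)
      ≡⟨ ℚ.*-distribˡ-+ K _ rest ⟩
    K ℚ.* (coefficient z ℚ.* fromℤ (t z)) ℚ.+ K ℚ.* rest
      ≡⟨ cong₂ ℚ._+_ (begin
           K ℚ.* (coefficient z ℚ.* fromℤ (t z))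
             ≡⟨ ℚ.*-assoc K (coefficient z) (fromℤ (t z)) ⟨
           (K ℚ.* coefficient z) ℚ.* fromℤ (t z)
             ≡⟨ cong (ℚ._* fromℤ (t z)) (fromℤ-*-/ (ℤ.+ (M !)) (ℤ.+ (4 ℕ.^ z)) (integerCoefficient M z)
                 (z !) {{ℕ._!≢0 z}} (integerCoefficient-! M z (z≤M z (here refl)))) ⟩
           fromℤ (integerCoefficient M z) ℚ.* fromℤ (t z)
             ≡⟨ fromℤ-* (integerCoefficient M z) (t z) ⟨
           fromℤ (integerCoefficient M z * t z) ∎)
           (expansion-clear M t zs (λ y y∈ → z≤M y (there y∈))) ⟩
    fromℤ (integerCoefficient M z * t z) ℚ.+ fromℤ (∑ zs (λ z → integerCoefficient M z * t z))
      ≡⟨ fromℤ-+ (integerCoefficient M z * t z) _ ⟨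
    fromℤ (integerCoefficient M z * t z + ∑ zs (λ z → integerCoefficient M z * t z)) ∎
    where
    K rest : ℚ
    K = fromℤ (ℤ.+ (M !))
    rest = sumℚ (map (λ z → coefficient z ℚ.* fromℤ (t z)) zs)

  ∑-upTo-suc : ∀ k (f : ℕ → ℤ) → ∑ (upTo (ℕ.suc k)) f ≡ ∑ (upTo k) f + f k
  ∑-upTo-suc k f = trans (cong (λ zs → ∑ zs f) (sym (List.upTo-∷ʳ k)))
    (trans (∑-++ (upTo k) (k ∷ []) f) (cong (∑ (upTo k) f +_) (+-identityʳ (f k))))

  ∑-upTo-truncate : ∀ m k (f : ℕ → ℤ) → (∀ z → m ≤ z → f z ≡ 0ℤ) → ∑ (upTo (m ℕ.+ k)) f ≡ ∑ (upTo m) f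
  ∑-upTo-truncate m ℕ.zero    f null = cong (λ k → ∑ (upTo k) f) (ℕ.+-identityʳ m)
  ∑-upTo-truncate m (ℕ.suc k) f null = begin
    ∑ (upTo (m ℕ.+ ℕ.suc k)) f      ≡⟨ cong (λ k → ∑ (upTo k) f) (ℕ.+-suc m k) ⟩
    ∑ (upTo (ℕ.suc (m ℕ.+ k))) f    ≡⟨ ∑-upTo-suc (m ℕ.+ k) f ⟩
    ∑ (upTo (m ℕ.+ k)) f + f (m ℕ.+ k)  ≡⟨ cong₂ _+_ (∑-upTo-truncate m k f null)
        (null (m ℕ.+ k) (ℕ.m≤m+n m k)) ⟩
    ∑ (upTo m) f + 0ℤ               ≡⟨ +-identityʳ _ ⟩
    ∑ (upTo m) f                    ∎

  size-⊥ : ∀ n → size (⊥ {n}) ≡ n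
  size-⊥ ℕ.zero    = refl
  size-⊥ (ℕ.suc n) = cong ℕ.suc (size-⊥ n)

  ∈-vecs⁻ : ∀ {A : Set} (xs : List A) {z} {T : Vec A z} → T List.∈ vecs xs z → VecAll.All (List._∈ xs) T
  ∈-vecs⁻ xs {ℕ.zero}  {[]} T∈ = []
  ∈-vecs⁻ xs {ℕ.suc z} T∈ with List.∈-cartesianProductWith⁻ _∷_ xs (vecs xs z) T∈
  ... | x , T , x∈ , T∈′ , refl = x∈ ∷ ∈-vecs⁻ xs T∈′

  ∈-vecs⁺ : ∀ {A : Set} {xs : List A} {z} {T : Vec A z} → VecAll.All (List._∈ xs) T → T List.∈ vecs xs z
  ∈-vecs⁺ []        = here refl
  ∈-vecs⁺ (x∈ ∷ T∈) = List.∈-cartesianProductWith⁺ _∷_ x∈ (∈-vecs⁺ T∈)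

  cover : ∀ {z} → Vec (Subgraph n) z → Subset n
  cover T = ⋃ (toList (Vec.map vertices T))

  -- The expansion and its truncations for a whole graph

  module Expansion (H : Graph n) where

    open CycleExpansion H
    open CycleCount H
    open DisjointTuples (fourKCycles H) vertices (minor -1ℤ -1*-1) public

    detDelete-minor : ∀ {z} (T : Vec (Subgraph n) z) → detDelete H T ≡ minor -1ℤ -1*-1 (cover T)
    detDelete-minor T = trans (determinant-immanant (adjacency H) (element (∁ (cover T))))
      (cong (λ vs → immanant -1ℤ (adjacency H) vs vs) (tabulate-element (cover T)))

    per-minor : per H ≡ minor 1ℤ 1*1 ⊥
    per-minor = trans (permanent-immanant (adjacency H) id)
      (cong (λ vs → immanant 1ℤ (adjacency H) vs vs) (sym (free-⊥ n)))

    ⟦fits?-⊥⟧ : ∀ {z} (T : Vec (Subgraph n) z) → ⟦ AllPairs.allPairs? vertexDisjoint? T ⟧ ≡ ⟦ fits? ⊥ T ⟧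
    ⟦fits?-⊥⟧ T = ⟦⟧-cong (AllPairs.allPairs? vertexDisjoint? T) (fits? ⊥ T)
      (λ d → VecAll.universal (λ R → disjoint⁺ λ x∈⊥ → contradiction x∈⊥ Subset.∉⊥) T , d) proj₂

    τ-disjointTuples : ∀ z → sumℤ (map (detDelete H) (disjointTuples H z)) ≡ τ z ⊥
    τ-disjointTuples z = begin
      sumℤ (map (detDelete H) (disjointTuples H z))
        ≡⟨ ∑-sumℤ (disjointTuples H z) (detDelete H) ⟨
      ∑ (disjointTuples H z) (detDelete H)
        ≡⟨ ∑-filter (AllPairs.allPairs? vertexDisjoint?) (vecs (fourKCycles H) z) (detDelete H) ⟩
      ∑ (vecs (fourKCycles H) z) (λ T → ⟦ AllPairs.allPairs? vertexDisjoint? T ⟧ * detDelete H T)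
        ≡⟨ ∑-cong (vecs (fourKCycles H) z) (λ T → cong₂ _*_ (⟦fits?-⊥⟧ T)
             (trans (detDelete-minor T) (cong (minor -1ℤ -1*-1) (sym (Subset.∪-identityˡ (cover T)))))) ⟩
      ∑ (vecs (fourKCycles H) z) (λ T → ⟦ fits? ⊥ T ⟧ * minor -1ℤ -1*-1 (⊥ ∪ cover T))
        ≡⟨ ∑-vecs z ⊥ ⟩
      τ z ⊥ ∎

    ∈-disjointTuples⁺ : ∀ {z} {T : Vec (Subgraph n) z} → Disjoint4kCycles H T → T List.∈ disjointTuples H z
    ∈-disjointTuples⁺ (cycles , d) = List.∈-filter⁺ (AllPairs.allPairs? vertexDisjoint?)
        (∈-vecs⁺ (VecAll.map ∈-fourKCycles⁺ cycles)) d

    ∈-disjointTuples⁻ : ∀ {z} {T : Vec (Subgraph n) z} → T List.∈ disjointTuples H z → Disjoint4kCycles H T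
    ∈-disjointTuples⁻ {z} T∈ with List.∈-filter⁻ (AllPairs.allPairs? vertexDisjoint?) {xs = vecs
        (fourKCycles H) z} T∈
    ... | T∈vecs , d = VecAll.map ∈-fourKCycles⁻ (∈-vecs⁻ (fourKCycles H) T∈vecs) , d

    τ-vanish : ∀ {m} → ¬ HasMoreThan m Disjoint4kCycles H → ∀ z → m < z → τ z ⊥ ≡ 0ℤ
    τ-vanish few z m<z = trans (sym (τ-disjointTuples z))
        (trans (sym (∑-sumℤ (disjointTuples H z) (detDelete H)))
      (∑-null (disjointTuples H z) λ T T∈ → contradiction (z , m<z , T , ∈-disjointTuples⁻ T∈) few))

    cycle-even : ∀ {C} X → Is4kCycle H C → Disjoint X (vertices C) → Even (size (X ∪ vertices C)) → Even
        (size X)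
    cycle-even X (us , (us! , _ , _ , 4∣l) , refl) d even =
      subst Even (sym (size-∪-support X us us! d)) (even-+ (4∣⇒even 4∣l) even)

    -- Putting the cycles of the tuple back one by one adds multiples of four to the number of
    -- remaining vertices.
    tuple-even : ∀ {z} X (T : Vec (Subgraph n) z) → VecAll.All (Is4kCycle H) T → Fits X T → Even
        (size (X ∪ cover T)) → Even (size X)
    tuple-even X []      _        _                   even = subst (Even ∘ size) (Subset.∪-identityʳ X) even
    tuple-even X (C ∷ T) (c ∷ cs) (d ∷ ds , e ∷ es) even = cycle-even X c d
      (tuple-even (X ∪ vertices C) T cs
        (VecAll.map (uncurry disjoint-∪) (VecAll.zip (ds , e)) , es)
        (subst (Even ∘ size) (sym (Subset.∪-assoc X (vertices C) (cover T))) even))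

    -- The expansion is assumed for graphs of even order only; a graph spanned by disjoint 4k-cycles
    -- is one of them.
    covering-even : ∀ {z} (T : Vec (Subgraph n) z) → Disjoint4kCycles H T → cover T ≡ ⊤ → Even n
    covering-even T (cs , d) eq = subst Even (size-⊥ n)
      (tuple-even ⊥ T cs (VecAll.universal (λ R → disjoint⁺ λ x∈⊥ → contradiction x∈⊥ Subset.∉⊥) T , d)
        (subst Even (sym (trans (cong size (trans (Subset.∪-identityˡ (cover T)) eq)) (size-⊤ n))) zero))

    -- If all tuples cover the graph, every determinant in the sum is the empty one.
    τ-covering : ∀ z → (∀ (T : Vec
        (Subgraph n) z) → Disjoint4kCycles H T → cover T ≡ ⊤) → τ z ⊥ ≡ ℤ.+ length (disjointTuples H z)
    τ-covering z covering = begin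
      τ z ⊥
        ≡⟨ τ-disjointTuples z ⟨
      sumℤ (map (detDelete H) (disjointTuples H z))
        ≡⟨ ∑-sumℤ (disjointTuples H z) (detDelete H) ⟨
      ∑ (disjointTuples H z) (detDelete H)
        ≡⟨ ∑-cong∈ (disjointTuples H z) (λ T T∈ → trans (detDelete-minor T)
             (cong (λ vs → immanant -1ℤ (adjacency H) vs vs)
                 (trans (cong free (covering T (∈-disjointTuples⁻ T∈))) (free-⊤ n)))) ⟩
      ∑ (disjointTuples H z) (λ _ → 1ℤ)
        ≡⟨ ∑-one (disjointTuples H z) ⟩
      ℤ.+ length (disjointTuples H z) ∎
      where
      ∑-one : ∀ {A : Set} (xs : List A) → ∑ xs (λ _ → 1ℤ) ≡ ℤ.+ length xs
      ∑-one []       = refl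
      ∑-one (x ∷ xs) = trans (cong (1ℤ +_) (∑-one xs)) (sym (pos-+ 1 (length xs)))

  module PermanentExpansion (H : Graph n) (bipartite : Bipartite H) (m : ℕ) where

    open Expansion H

    -- Larger than `n`, as the recursion for `F` demands, and larger than `m`, so that the sum up to
    -- `m` is a part of the sum up to `M` and all its coefficients become integral when multiplied
    -- by M!. The surplus also leaves room for the term m + 1.
    M : ℕ
    M = m ℕ.+ ℕ.suc n

    n<M : n < M
    n<M = ℕ.m≤n+m (ℕ.suc n) m

    c : ℕ → ℤ
    c = integerCoefficient M

    truncated : ℕ → ℤ
    truncated k = ∑ (upTo (ℕ.suc k)) (λ z → c z * τ z ⊥)

    ExpansionHolds : Set
    ExpansionHolds = fromℤ (per H) ≡ fromℤ (-1ℤ ℤ.^ (n ℕ./ 2)) ℚ.* detExpansion m H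

    module _ (2∣n : 2 ∣ n) where

      private
        h : ℤ
        h = halfSign n

        instance _ = ℕ._!≢0 M

        M!*detExpansion : fromℤ (ℤ.+ (M !)) ℚ.* detExpansion m H ≡ fromℤ (truncated m)
        M!*detExpansion = trans
          (cong (λ ts → fromℤ (ℤ.+ (M !)) ℚ.* sumℚ ts)
              (List.map-cong (λ z → cong (λ t → coefficient z ℚ.* fromℤ t) (τ-disjointTuples z))
              (upTo (ℕ.suc m))))
          (expansion-clear M (λ z → τ z ⊥) (upTo (ℕ.suc m)) λ z z∈ → ℕ.≤-trans (ℕ.≤-pred (List.∈-upTo⁻ z∈))
              (ℕ.m≤m+n m (ℕ.suc n)))

        M!*rhs : fromℤ (ℤ.+ (M !)) ℚ.* (fromℤ (-1ℤ ℤ.^ (n ℕ./ 2)) ℚ.* detExpansion m H) ≡ fromℤ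
            (h * truncated m)
        M!*rhs = begin
          K ℚ.* (fromℤ (-1ℤ ℤ.^ (n ℕ./ 2)) ℚ.* detExpansion m H)
            ≡⟨ cong (λ s → K ℚ.* (fromℤ s ℚ.* detExpansion m H)) (halfSign-/2 2∣n) ⟩
          K ℚ.* (fromℤ h ℚ.* detExpansion m H)
            ≡⟨ ℚ.*-assoc K (fromℤ h) (detExpansion m H) ⟨
          (K ℚ.* fromℤ h) ℚ.* detExpansion m H
            ≡⟨ cong (ℚ._* detExpansion m H) (ℚ.*-comm K (fromℤ h)) ⟩
          (fromℤ h ℚ.* K) ℚ.* detExpansion m H
            ≡⟨ ℚ.*-assoc (fromℤ h) K (detExpansion m H) ⟩
          fromℤ h ℚ.* (K ℚ.* detExpansion m H)
            ≡⟨ cong (fromℤ h ℚ.*_) M!*detExpansion ⟩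
          fromℤ h ℚ.* fromℤ (truncated m)
            ≡⟨ fromℤ-* h (truncated m) ⟨
          fromℤ (h * truncated m) ∎
          where
          K : ℚ
          K = fromℤ (ℤ.+ (M !))

        untruncated : truncated M ≡ ℤ.+ (M !) * (h * per H)
        untruncated = begin
          truncated M
            ≡⟨ Identity.F-permanent H bipartite M n<M c (integerCoefficient-suc M) (ℕ.suc n) ⊥
                (s≤s (size≤n {n} ⊥)) (subst Even (sym (size-⊥ n)) (2∣⇒even 2∣n)) ⟩
          c 0 * (halfSign (size (⊥ {n})) * CycleExpansion.minor H 1ℤ 1*1 ⊥)
            ≡⟨ cong₂ (λ k l → k * (halfSign l * CycleExpansion.minor H 1ℤ 1*1 ⊥)) (integerCoefficient-0 M)
                (size-⊥ n) ⟩
          ℤ.+ (M !) * (h * CycleExpansion.minor H 1ℤ 1*1 ⊥)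
            ≡⟨ cong (λ p → ℤ.+ (M !) * (h * p)) per-minor ⟨
          ℤ.+ (M !) * (h * per H) ∎

        opaque
          unfolding _+_ _*_
          commute : ∀ h k p → h * (k * (h * p)) ≡ (h * h) * (k * p)
          commute = solve-∀

        h*untruncated : h * truncated M ≡ ℤ.+ (M !) * per H
        h*untruncated = begin
          h * truncated M                  ≡⟨ cong (h *_) untruncated ⟩
          h * (ℤ.+ (M !) * (h * per H))    ≡⟨ commute h (ℤ.+ (M !)) (per H) ⟩
          (h * h) * (ℤ.+ (M !) * per H)    ≡⟨ cong (_* (ℤ.+ (M !) * per H)) (halfSign-square n) ⟩
          1ℤ * (ℤ.+ (M !) * per H)         ≡⟨ *-identityˡ _ ⟩
          ℤ.+ (M !) * per H                ∎

        h-cancel : ∀ x y → h * x ≡ h * y → x ≡ y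
        h-cancel x y eq = begin
          x            ≡⟨ undo x ⟨
          h * (h * x)  ≡⟨ cong (h *_) eq ⟩
          h * (h * y)  ≡⟨ undo y ⟩
          y            ∎
          where
          undo : ∀ x → h * (h * x) ≡ x
          undo x = trans (sym (*-assoc h h x)) (trans (cong (_* x) (halfSign-square n)) (*-identityˡ x))

      -- By `untruncated`, the sum up to `M` gives the permanent of every bipartite graph of even
      -- order. The expansion cut off at `m` therefore says exactly that the terms beyond `m` add up
      -- to zero; `expansion⁻` is the converse.
      expansion⁺ : truncated M ≡ truncated m → ExpansionHolds
      expansion⁺ eq = fromℤ-*-cancelˡ (M !) (fromℤ (per H)) _ (begin
        fromℤ (ℤ.+ (M !)) ℚ.* fromℤ (per H)  ≡⟨ fromℤ-* (ℤ.+ (M !)) (per H) ⟨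
        fromℤ (ℤ.+ (M !) * per H)            ≡⟨ cong fromℤ (trans (sym h*untruncated) (cong (h *_) eq)) ⟩
        fromℤ (h * truncated m)              ≡⟨ M!*rhs ⟨
        fromℤ (ℤ.+ (M !)) ℚ.* (fromℤ (-1ℤ ℤ.^ (n ℕ./ 2)) ℚ.* detExpansion m H) ∎)

      expansion⁻ : ExpansionHolds → truncated M ≡ truncated m
      expansion⁻ holds = h-cancel _ _ (fromℤ-injective _ _ (begin
        fromℤ (h * truncated M)              ≡⟨ cong fromℤ h*untruncated ⟩
        fromℤ (ℤ.+ (M !) * per H)            ≡⟨ fromℤ-* (ℤ.+ (M !)) (per H) ⟩
        fromℤ (ℤ.+ (M !)) ℚ.* fromℤ (per H)  ≡⟨ cong (fromℤ (ℤ.+ (M !)) ℚ.*_) holds ⟩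
        fromℤ (ℤ.+ (M !)) ℚ.* (fromℤ (-1ℤ ℤ.^ (n ℕ./ 2)) ℚ.* detExpansion m H) ≡⟨ M!*rhs ⟩
        fromℤ (h * truncated m)              ∎))

      few⇒expansion : ¬ HasMoreThan m Disjoint4kCycles H → ExpansionHolds
      few⇒expansion few = expansion⁺
          (∑-upTo-truncate (ℕ.suc m) (ℕ.suc n) _ λ z m<z → trans (cong (c z *_) (τ-vanish few z m<z))
          (zeroʳ (c z)))

      -- One more term of the sum is visible in the identity for m + 1.
      expansion⇒τ-null : ¬ HasMoreThan (ℕ.suc m) Disjoint4kCycles H → ExpansionHolds → τ (ℕ.suc m) ⊥ ≡ 0ℤ
      expansion⇒τ-null few holds = integerCoefficient-cancel M (ℕ.suc m) (τ (ℕ.suc m) ⊥)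
        (subst (ℕ.suc m ≤_) (sym (ℕ.+-suc m n)) (ℕ.m≤m+n (ℕ.suc m) n))
        (cancel (truncated m) (c (ℕ.suc m) * τ (ℕ.suc m) ⊥) (begin
          truncated m + c (ℕ.suc m) * τ (ℕ.suc m) ⊥
            ≡⟨ ∑-upTo-suc (ℕ.suc m) _ ⟨
          truncated (ℕ.suc m)
            ≡⟨ ∑-upTo-truncate (ℕ.suc (ℕ.suc m)) n _
                (λ z m<z → trans (cong (c z *_) (τ-vanish few z m<z)) (zeroʳ (c z))) ⟨
          ∑ (upTo (ℕ.suc (ℕ.suc m) ℕ.+ n)) (λ z → c z * τ z ⊥)
            ≡⟨ cong (λ k → ∑ (upTo (ℕ.suc k)) (λ z → c z * τ z ⊥)) (ℕ.+-suc m n) ⟨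
          truncated M
            ≡⟨ expansion⁻ holds ⟩
          truncated m ∎))
        where
        opaque
          unfolding _+_
          cancel : ∀ x y → x + y ≡ x → y ≡ 0ℤ
          cancel x y eq = +-cancelˡ x y 0ℤ (trans eq (sym (ℤ.+-identityʳ x)))

  -- Induced subgraphs

  even⇒2∣ : ∀ {k} → Even k → 2 ∣ k
  even⇒2∣ zero = divides 0 refl
  even⇒2∣ (suc-suc e) with even⇒2∣ e
  ... | divides q eq = divides (ℕ.suc q) (cong (2 ℕ.+_) eq)

  element-injective : (S : Subset n) {i j : Fin ∣ S ∣} → element S i ≡ element S j → i ≡ j
  element-injective (inside  ∷ S) {zero}  {zero}  eq = refl
  element-injective (inside  ∷ S) {suc i} {suc j} eq = cong suc (element-injective S (Fin.suc-injective eq))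
  element-injective (outside ∷ S)                 eq = element-injective S (Fin.suc-injective eq)

  element-∈ : (S : Subset n) (i : Fin ∣ S ∣) → element S i ∈ S
  element-∈ (inside  ∷ S) zero    = Vec.here
  element-∈ (inside  ∷ S) (suc i) = Vec.there (element-∈ S i)
  element-∈ (outside ∷ S) i       = Vec.there (element-∈ S i)

  element-surjective : (S : Subset n) {x : Fin n} → x ∈ S → ∃ λ i → element S i ≡ x
  element-surjective (inside  ∷ S) {zero}  Vec.here       = zero , refl
  element-surjective (inside  ∷ S) {suc x} (Vec.there x∈) with element-surjective S x∈
  ... | i , eq = suc i , cong suc eq
  element-surjective (outside ∷ S) {suc x} (Vec.there x∈) with element-surjective S x∈
  ... | i , eq = i , cong suc eq

  cyclicSteps-map : {A B : Set} (f : A → B) (us : List A) → cyclicSteps (map f us) ≡ map (Product.map f f)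
      (cyclicSteps us)
  cyclicSteps-map f []       = refl
  cyclicSteps-map f (v ∷ ws) = trans (zip-walk (f v) (map f ws) (f v))
      (trans (walk-map v ws v) (cong (map (Product.map f f)) (sym (zip-walk v ws v))))
    where
    walk-map : ∀ u ws v → walk (f u) (map f ws) (f v) ≡ map (Product.map f f) (walk u ws v)
    walk-map u []       v = refl
    walk-map u (w ∷ ws) v = cong ((f u , f w) ∷_) (walk-map w ws v)

  -- Cycles are kept as vertex sequences here because `map (element S)` carries these between
  -- `G [ S ]` and `G`, whereas the edge matrix of a `Subgraph` would have to be rebuilt over
  -- another vertex set. The set `S` records where the cycles lie.
  Packing : Graph n → Subset n → ℕ → Set
  Packing {n} G S z = Σ (Vec (List (Fin n)) z) λ ks →
    VecAll.All (Is4kCycleSequence G) ks × AllPairs ListDisjoint.Disjoint ks × VecAll.All (All (_∈ S)) ks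

  tuple⇒packing : ∀ {z} (G : Graph n) (T : Vec (Subgraph n) z) → Disjoint4kCycles G T → Packing G (cover T) z
  tuple⇒packing G T (cs , d) = sequence T cs , cycles T cs , pairs T cs d , inCover T cs
    where
    sequence : ∀ {z} (T : Vec (Subgraph _) z) → VecAll.All (Is4kCycle G) T → Vec (List (Fin _)) z
    sequence []      []                  = []
    sequence (C ∷ T) ((us , _ , _) ∷ cs) = us ∷ sequence T cs
    cycles : ∀ {z} (T : Vec (Subgraph _) z) (cs : VecAll.All (Is4kCycle G) T) → VecAll.All
        (Is4kCycleSequence G) (sequence T cs)
    cycles []      []                 = []
    cycles (C ∷ T) ((_ , c , _) ∷ cs) = c ∷ cycles T cs
    apart : ∀ {z} us (T : Vec (Subgraph _) z) (cs : VecAll.All (Is4kCycle G) T) →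
            VecAll.All (VertexDisjoint (trace us)) T → VecAll.All (ListDisjoint.Disjoint us) (sequence T cs)
    apart us []      []                     []       = []
    apart us (_ ∷ T) ((vs , _ , refl) ∷ cs) (d ∷ ds) =
      (λ (x∈us , x∈vs) → disjoint⁻ {X = support us} d (∈-support⁺ x∈us) (∈-support⁺ x∈vs)) ∷ apart us T cs ds
    pairs : ∀ {z} (T : Vec (Subgraph _) z) (cs : VecAll.All (Is4kCycle G) T) →
            AllPairs VertexDisjoint T → AllPairs ListDisjoint.Disjoint (sequence T cs)
    pairs []      []                     []       = []
    pairs (_ ∷ T) ((us , _ , refl) ∷ cs) (d ∷ ds) = apart us T cs d ∷ pairs T cs ds
    inCover : ∀ {z} (T : Vec (Subgraph _) z) (cs : VecAll.All (Is4kCycle G) T) → VecAll.All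
        (All (_∈ cover T)) (sequence T cs)
    inCover []      []                     = []
    inCover (_ ∷ T) ((us , _ , refl) ∷ cs) =
      All.tabulate (λ x∈ → Subset.x∈p∪q⁺ (inj₁ (∈-support⁺ x∈))) ∷
      VecAll.map (All.map λ x∈ → Subset.x∈p∪q⁺ (inj₂ x∈)) (inCover T cs)

  packing⇒tuple : ∀ {z S} (G : Graph n) → Packing G S z → Σ (Vec (Subgraph n) z) (Disjoint4kCycles G)
  packing⇒tuple G (ks , cs , d , _) = Vec.map trace ks , cycles ks cs , pairs ks d
    where
    cycles : ∀ {z} (ks : Vec (List (Fin _)) z) → VecAll.All (Is4kCycleSequence G) ks → VecAll.All
        (Is4kCycle G) (Vec.map trace ks)
    cycles []       []       = []
    cycles (us ∷ ks) (c ∷ cs) = (us , c , refl) ∷ cycles ks cs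
    apart : ∀ {z} us (ks : Vec (List (Fin _)) z) → VecAll.All (ListDisjoint.Disjoint us) ks →
            VecAll.All (VertexDisjoint (trace us)) (Vec.map trace ks)
    apart us []        []       = []
    apart us (vs ∷ ks) (d ∷ ds) =
      disjoint⁺ {X = support us} (λ x∈us x∈vs → d (∈-support⁻ us x∈us , ∈-support⁻ vs x∈vs)) ∷ apart us ks ds
    pairs : ∀ {z} (ks : Vec (List (Fin _)) z) → AllPairs ListDisjoint.Disjoint ks → AllPairs VertexDisjoint
        (Vec.map trace ks)
    pairs []        []       = []
    pairs (us ∷ ks) (d ∷ ds) = apart us ks d ∷ pairs ks ds

  module _ (G : Graph n) (S : Subset n) where

    open Graph G

    private
      e : Fin ∣ S ∣ → Fin n
      e = element S

    cycle-embed : ∀ us → Is4kCycleSequence (G [ S ]) us → Is4kCycleSequence G (map e us)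
    cycle-embed us (us! , es , 0<l , 4∣l) =
      Unique.map⁺ (element-injective S) us! ,
      subst (All (uncurry _∼_)) (sym (cyclicSteps-map e us)) (All.map⁺ es) ,
      subst (0 <_) (sym (List.length-map e us)) 0<l ,
      subst (4 ∣_) (sym (List.length-map e us)) 4∣l

    cycle-restrict : ∀ us → Is4kCycleSequence G (map e us) → Is4kCycleSequence (G [ S ]) us
    cycle-restrict us (us! , es , 0<l , 4∣l) =
      Unique.map⁻ us! ,
      All.map⁻ (subst (All (uncurry _∼_)) (cyclicSteps-map e us) es) ,
      subst (0 <_) (List.length-map e us) 0<l ,
      subst (4 ∣_) (List.length-map e us) 4∣l

    disjoint-embed : ∀ {us vs} → ListDisjoint.Disjoint us vs → ListDisjoint.Disjoint (map e us) (map e vs)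
    disjoint-embed d (x∈us , x∈vs) with List.∈-map⁻ e x∈us | List.∈-map⁻ e x∈vs
    ... | i , i∈ , refl | j , j∈ , eq with element-injective S eq
    ... | refl = d (i∈ , j∈)

    packing-embed : ∀ {z X Y} → (∀ {i} → i ∈ X → e i ∈ Y) → Packing (G [ S ]) X z → Packing G Y z
    packing-embed {X = X} {Y} X⊆Y (ks , cs , ds , ss) = Vec.map
        (map e) ks , cycles ks cs , pairs ks ds , within ks ss
      where
      cycles : ∀ {z} (ks : Vec _ z) → VecAll.All (Is4kCycleSequence (G [ S ])) ks → VecAll.All
          (Is4kCycleSequence G) (Vec.map (map e) ks)
      cycles []        []       = []
      cycles (us ∷ ks) (c ∷ cs) = cycle-embed us c ∷ cycles ks cs
      apart : ∀ {z us} (ks : Vec _ z) → VecAll.All (ListDisjoint.Disjoint us) ks → VecAll.All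
          (ListDisjoint.Disjoint (map e us)) (Vec.map (map e) ks)
      apart []        []       = []
      apart (vs ∷ ks) (d ∷ ds) = disjoint-embed d ∷ apart ks ds
      pairs : ∀ {z} (ks : Vec _ z) → AllPairs ListDisjoint.Disjoint ks → AllPairs ListDisjoint.Disjoint
          (Vec.map (map e) ks)
      pairs []        []       = []
      pairs (us ∷ ks) (d ∷ ds) = apart ks d ∷ pairs ks ds
      within : ∀ {z} (ks : Vec _ z) → VecAll.All (All (_∈ X)) ks → VecAll.All (All (_∈ Y)) (Vec.map (map e) ks)
      within []        []       = []
      within (us ∷ ks) (s ∷ ss) = All.map⁺ (All.map X⊆Y s) ∷ within ks ss

    lift : (us : List (Fin n)) → All (_∈ S) us → ∃ λ vs → map e vs ≡ us
    lift []       []        = [] , refl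
    lift (u ∷ us) (u∈ ∷ us∈) with element-surjective S u∈ | lift us us∈
    ... | i , refl | vs , refl = i ∷ vs , refl

    packing-restrict : ∀ {z} → Packing G S z → Packing (G [ S ]) ⊤ z
    packing-restrict (ks , cs , ds , ss) with lifts ks ss
      where
      lifts : ∀ {z} (ks : Vec _ z) → VecAll.All (All (_∈ S)) ks → ∃ λ ls → Vec.map (map e) ls ≡ ks
      lifts []        []       = [] , refl
      lifts (us ∷ ks) (s ∷ ss) with lift us s | lifts ks ss
      ... | vs , refl | ls , refl = vs ∷ ls , refl
    ... | ls , refl = ls , cycles ls cs , pairs ls ds , VecAll.universal
        (λ vs → All.tabulate λ _ → Subset.∈⊤) ls
      where
      cycles : ∀ {z} (ls : Vec _ z) → VecAll.All (Is4kCycleSequence G) (Vec.map (map e) ls) → VecAll.All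
          (Is4kCycleSequence (G [ S ])) ls
      cycles []        []       = []
      cycles (vs ∷ ls) (c ∷ cs) = cycle-restrict vs c ∷ cycles ls cs
      apart : ∀ {z us} (ls : Vec _ z) → VecAll.All (ListDisjoint.Disjoint (map e us))
          (Vec.map (map e) ls) → VecAll.All (ListDisjoint.Disjoint us) ls
      apart []        []       = []
      apart (vs ∷ ls) (d ∷ ds) = (λ (x∈ , y∈) → d (List.∈-map⁺ e x∈ , List.∈-map⁺ e y∈)) ∷ apart ls ds
      pairs : ∀ {z} (ls : Vec _ z) → AllPairs ListDisjoint.Disjoint
          (Vec.map (map e) ls) → AllPairs ListDisjoint.Disjoint ls
      pairs []        []       = []
      pairs (vs ∷ ls) (d ∷ ds) = apart ls d ∷ pairs ls ds

  bipartite-[] : (G : Graph n) → Bipartite G → (S : Subset n) → Bipartite (G [ S ])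
  bipartite-[] G (colour , proper) S = colour ∘ element S , λ u v → proper (element S u) (element S v)

  few-[] : ∀ {m} (G : Graph n) (S : Subset n) → ¬ HasMoreThan m Disjoint4kCycles G → ¬ HasMoreThan m Disjoint4kCycles (G [ S ])
  few-[] G S few (z , m<z , T , d) = few
      (z , m<z , packing⇒tuple G (packing-embed G S {Y = ⊤} (λ _ → Subset.∈⊤) (tuple⇒packing (G [ S ]) T d)))

  -- A smallest vertex set containing too many disjoint cycles

  -- There are no tuples of more than m + 1 disjoint 4k-cycles, as dropping a cycle
  -- from one would leave a tuple that is not spanning.
  spanning-violates : ∀ {m} (H : Graph n) (bipartite : Bipartite H) →
    (∀ {z} (T : Vec (Subgraph n) z) → m < z → Disjoint4kCycles H T → cover T ≡ ⊤) →
    (2 ∣ n → PermanentExpansion.ExpansionHolds H bipartite m) →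
    ¬ HasMoreThan m Disjoint4kCycles H
  spanning-violates {n} {m} H bipartite spanning expansion (z , m<z , T , d) = nonempty
      -- By `few` the given tuple has exactly m + 1 members.
      (ℕ.≤-antisym m<z (ℕ.≮⇒≥ λ m+1<z → few (z , m+1<z , T , d))) T d
    where
    open Expansion H
    open PermanentExpansion H bipartite m
    few : ¬ HasMoreThan (ℕ.suc m) Disjoint4kCycles H
    avoid : ∀ {z u} {C : Subgraph n} → u ∈ vertices C → (T : Vec (Subgraph n) z) → VecAll.All
        (VertexDisjoint C) T → u ∉ cover T
    avoid         u∈C []      []       u∈ = Subset.∉⊥ u∈
    avoid {C = C} u∈C (D ∷ T) (d ∷ ds) u∈ with Subset.x∈p∪q⁻ (vertices D) (cover T) u∈
    ... | inj₁ u∈D = disjoint⁻ {X = vertices C} d u∈C u∈D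
    ... | inj₂ u∈T = avoid {C = C} u∈C T ds u∈T
    few (_ , s≤s m<z , C ∷ T , c ∷ cs , d ∷ ds) =
      let u , u∈C = CycleCount.cycle-nonempty H c
      in avoid {C = C} u∈C T d (subst (u ∈_) (sym (spanning T m<z (cs , ds))) Subset.∈⊤)
    2∣n : 2 ∣ n
    2∣n = even⇒2∣ (covering-even T d (spanning T m<z d))
    no-tuples : length (disjointTuples H (ℕ.suc m)) ≡ 0
    -- All tuples of m + 1 members span, so `τ (suc m) ⊥` is their number.
    no-tuples = ℤ.+-injective (trans (sym (τ-covering (ℕ.suc m) λ T → spanning T ℕ.≤-refl))
      (expansion⇒τ-null 2∣n few (expansion 2∣n)))
    nonempty : ∀ {z} → ℕ.suc m ≡ z → (T : Vec (Subgraph n) z) → ¬ Disjoint4kCycles H T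
    nonempty refl T d = length≢0 (∈-disjointTuples⁺ {T = T} d) no-tuples
      where
      length≢0 : ∀ {A : Set} {x : A} {xs} → x List.∈ xs → length xs ≢ 0
      length≢0 (here _)  ()
      length≢0 (there _) ()

  -- Induction on the size of `S`: as no proper subset holds more than `m` disjoint cycles, every
  -- such tuple in `G [ S ]` spans it, which `spanning-violates` excludes.
  no-packing : ∀ {m} (G : Graph n) (bipartite : Bipartite G) →
    (∀ S → 2 ∣ ∣ S ∣ → PermanentExpansion.ExpansionHolds (G [ S ]) (bipartite-[] G bipartite S) m) →
    ∀ k S → ∣ S ∣ < k → ∀ z → m < z → ¬ Packing G S z
  no-packing {n} {m} G bipartite expansion (ℕ.suc k) S (s≤s ∣S∣≤k) z m<z packing =
    spanning-violates (G [ S ]) (bipartite-[] G bipartite S) spanning (expansion S)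
      (z , m<z , packing⇒tuple (G [ S ]) (packing-restrict G S packing))
    where
    spanning : ∀ {z} (T : Vec (Subgraph ∣ S ∣) z) → m < z → Disjoint4kCycles (G [ S ]) T → cover T ≡ ⊤
    spanning {z} T m<z d = Subset.⊆-antisym Subset.⊆⊤ λ {i} _ → covered i
      where
      covered : ∀ i → i ∈ cover T
      covered i with i Subset.∈? cover T
      ... | yes i∈ = i∈
      ... | no i∉ = contradiction
        -- A tuple that misses the vertex `i` already lives on `S` without it, contrary to the
        -- induction hypothesis.
        (packing-embed G S {Y = S - element S i}
          (λ j∈ → Subset.x∈p∧x≢y⇒x∈p-y (element-∈ S _) λ eq → i∉
              (subst (_∈ cover T) (element-injective S eq) j∈))
          (tuple⇒packing (G [ S ]) T d))
        (no-packing G bipartite expansion k (S - element S i)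
          (ℕ.≤-trans (Subset.x∈p⇒∣p-x∣<∣p∣ (element-∈ S i)) ∣S∣≤k) z m<z)

open CycleExpansions
  using (module PermanentExpansion; bipartite-[]; few-[]; no-packing; cover; tuple⇒packing)
open import Data.Integer.Base using (-1ℤ; _^_)
open import Data.Nat.Base using (ℕ; _/_)
open import Data.Nat.Divisibility using (_∣_)
open import Data.Rational.Base using (_*_)
open import Function.Bundles using (_⇔_)

theorem2 : ∀ {n} (G : Graph n) → Bipartite G → (m : ℕ) →
    (¬ HasMoreThan m Disjoint4kCycles G) ⇔
    (∀ (S : Subset n) → 2 ∣ ∣ S ∣ →
    fromℤ (per (G [ S ])) ≡ fromℤ (-1ℤ ^ (∣ S ∣ / 2)) * detExpansion m (G [ S ]))
theorem2 {n} G bipartite m = mk⇔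
  (λ few S 2∣S → PermanentExpansion.few⇒expansion (G [ S ]) (bipartite-[] G bipartite S) m 2∣S (few-[] G S few))
  -- The descent starts from the vertices covered by the given tuple, which need not be all of `G`.
  λ expansion (z , m<z , T , d) →
    no-packing G bipartite expansion (ℕ.suc n) (cover T) (s≤s (Subset.∣p∣≤n (cover T))) z m<z (tuple⇒packing G T d)
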